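{- Let $k\ge 2$ be a fixed integer and let $p^*(n)=(k-1)\frac{\ln n}{n}$. Then $p^*$ is a threshold function for the event that the random $k$-uniform hypergraph $H^k_{n,p}$ is rainbow-free colourable. That is, for every function $p:\mathbb N\to[0,1]$: (i) if $p(n)\ll p^*(n)$, then $\lim_{n\to\infty}\Pr[H^k_{n,p}\text{ is rainbow-free colourable}]=1$; (ii) if $p(n)\gg p^*(n)$, then $\lim_{n\to\infty}\Pr[H^k_{n,p}\text{ is rainbow-free colourable}]=0$.
   Context: A $k$-uniform hypergraph $H$ consists of a vertex set $V(H)$ and a collection $E(H)$ of $k$-element subsets of $V(H)$, called hyperedges. Write $[k]=\{1,\dots,k\}$. A $k$-colouring of $H$ is a map $c:V(H)\to[k]$. It is rainbow-free if it is surjective onto $[k]$ and $c(e)=\{c(v): v\in e\}\ne[k]$ for every hyperedge $e\in E(H)$. A $k$-uniform hypergraph is rainbow-free colourable if it has a rainbow-free $k$-colouring. For $p:\mathbb N\to[0,1]$, the random $k$-uniform hypergraph $H^k_{n,p}$ has a vertex set $V$ with $|V|=n$, and each $k$-element subset of $V$ is a hyperedge with probability $p=p(n)$, independently of all others. A function $r(n)$ is a threshold function for a hypergraph property $A$ if (i) $\Pr[H^k_{n,p}\models A]\to 0$ whenever $p(n)\ll r(n)$, and (ii) $\Pr[H^k_{n,p}\models A]\to 1$ whenever $p(n)\gg r(n)$, or vice versa (limits $0$ and $1$ interchanged). Here $f(n)\ll g(n)$ (equivalently $g(n)\gg f(n)$) means $f(n)/g(n)\to0$ as $n\to\infty$.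 -}

module Defs where

open import Data.Bool using (true; false)
open import Data.Fin using (Fin; zero; suc)
import Data.Fin.Properties as Finₚ
open import Data.Fin.Subset using (Subset; inside; outside; ∣_∣; _∈_)
open import Data.Fin.Subset.Properties using (_∈?_)
open import Data.Integer using (+_; -[1+_])
import Data.Integer as ℤ
import Data.Integer.Properties as ℤₚ
open import Data.List using (List; []; _∷_; _++_; map; filter; foldr; length; lookup)
import Data.List.Membership.Propositional as Mem
open import Data.List.Membership.Propositional.Properties
  using (∈-map⁺; ∈-map⁻; ∈-++⁺ˡ; ∈-++⁺ʳ; ∈-filter⁺)
open import Data.List.Relation.Unary.Any using (here)
import Data.List.Relation.Unary.All as All
import Data.List.Relation.Unary.AllPairs as AllPairs
open import Data.List.Relation.Unary.Unique.Propositional using (Unique)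
import Data.List.Relation.Unary.Unique.Propositional.Properties as Uniqueₚ
open import Data.Nat as ℕ using (ℕ; zero; suc; s≤s; z≤n)
import Data.Nat.Properties as ℕₚ
open import Data.Product using (_×_; _,_; ∃; Σ)
open import Data.Rational as ℚ using (ℚ; 0ℚ; 1ℚ; ½)
import Data.Rational.Properties as ℚₚ
open import Data.Rational.Solver using (module +-*-Solver)
import Data.Rational.Unnormalised as ℚᵘ
import Data.Rational.Unnormalised.Properties as ℚᵘₚ
open import Data.Sum using (_⊎_; inj₁; inj₂)
open import Data.Vec using ([]; _∷_)
import Data.Vec.Functional as F
open import Data.Vec.Properties using (∷-injectiveʳ)
open import Function.Base using (_∘_)
open import Function.Definitions using (StrictlySurjective)
open import Level using (0ℓ)
open import Relation.Binary.PropositionalEquality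
open import Relation.Nullary using (¬_; Dec; yes; no; contradiction)
open import Relation.Nullary.Decidable using (map′; ¬?; _×-dec_; _→-dec_)
open import Relation.Unary using (Pred; Decidable)

∣p-q∣-sym : ∀ p q → ℚ.∣ p ℚ.- q ∣ ≡ ℚ.∣ q ℚ.- p ∣
∣p-q∣-sym p q = trans (sym (ℚₚ.∣-p∣≡∣p∣ (p ℚ.- q))) (cong ℚ.∣_∣ (lemma p q))
  where
  open +-*-Solver
  lemma : ∀ p q → ℚ.- (p ℚ.- q) ≡ q ℚ.- p
  lemma = solve 2 (λ p q → :- (p :- q) := q :- p) refl

∣p∣≤∣p-q∣+∣q∣ : ∀ p q → ℚ.∣ p ∣ ℚ.≤ ℚ.∣ p ℚ.- q ∣ ℚ.+ ℚ.∣ q ∣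
∣p∣≤∣p-q∣+∣q∣ p q = begin
  ℚ.∣ p ∣                     ≡⟨ cong ℚ.∣_∣ (lemma p q) ⟩
  ℚ.∣ (p ℚ.- q) ℚ.+ q ∣       ≤⟨ ℚₚ.∣p+q∣≤∣p∣+∣q∣ (p ℚ.- q) q ⟩
  ℚ.∣ p ℚ.- q ∣ ℚ.+ ℚ.∣ q ∣   ∎
  where
  open ℚₚ.≤-Reasoning
  open +-*-Solver
  lemma : ∀ p q → p ≡ (p ℚ.- q) ℚ.+ q
  lemma = solve 2 (λ p q → p := (p :- q) :+ q) refl

p≤∣p∣ : ∀ p → p ℚ.≤ ℚ.∣ p ∣
p≤∣p∣ p with ℚₚ.≤-total 0ℚ p
... | inj₁ 0≤p = ℚₚ.≤-reflexive (sym (ℚₚ.0≤p⇒∣p∣≡p 0≤p))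
... | inj₂ p≤0 = ℚₚ.≤-trans p≤0 (ℚₚ.0≤∣p∣ p)

p-q≤r : ∀ {p q r} → p ℚ.≤ r ℚ.+ q → p ℚ.- q ℚ.≤ r
p-q≤r {p} {q} {r} p≤r+q = begin
  p ℚ.- q            ≤⟨ ℚₚ.+-monoˡ-≤ (ℚ.- q) p≤r+q ⟩
  (r ℚ.+ q) ℚ.- q    ≡⟨ lemma r q ⟩
  r                  ∎
  where
  open ℚₚ.≤-Reasoning
  open +-*-Solver
  lemma : ∀ r q → (r ℚ.+ q) ℚ.- q ≡ r
  lemma = solve 2 (λ r q → (r :+ q) :- q := r) refl

∣p∣-bound : ∀ {p r} → p ℚ.≤ r → ℚ.- p ℚ.≤ r → ℚ.∣ p ∣ ℚ.≤ r
∣p∣-bound {p} p≤r -p≤r with ℚₚ.∣p∣≡p∨∣p∣≡-p p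
... | inj₁ eq = ℚₚ.≤-trans (ℚₚ.≤-reflexive eq) p≤r
... | inj₂ eq = ℚₚ.≤-trans (ℚₚ.≤-reflexive eq) -p≤r

∣p-q∣-bound : ∀ {p q r} → p ℚ.≤ r ℚ.+ q → q ℚ.≤ r ℚ.+ p → ℚ.∣ p ℚ.- q ∣ ℚ.≤ r
∣p-q∣-bound {p} {q} p≤r+q q≤r+p =
  ∣p∣-bound (p-q≤r p≤r+q)
    (ℚₚ.≤-trans (ℚₚ.≤-reflexive (lemma p q)) (p-q≤r q≤r+p))
  where
  open +-*-Solver
  lemma : ∀ p q → ℚ.- (p ℚ.- q) ≡ q ℚ.- p
  lemma = solve 2 (λ p q → :- (p :- q) := q :- p) refl

∣∣p∣-∣q∣∣≤∣p-q∣ : ∀ p q → ℚ.∣ ℚ.∣ p ∣ ℚ.- ℚ.∣ q ∣ ∣ ℚ.≤ ℚ.∣ p ℚ.- q ∣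
∣∣p∣-∣q∣∣≤∣p-q∣ p q = ∣p-q∣-bound (∣p∣≤∣p-q∣+∣q∣ p q)
  (ℚₚ.≤-trans (∣p∣≤∣p-q∣+∣q∣ q p)
    (ℚₚ.≤-reflexive (cong (ℚ._+ ℚ.∣ p ∣) (∣p-q∣-sym q p))))

+-difference : ∀ a b c d → (a ℚ.+ b) ℚ.- (c ℚ.+ d) ≡ (a ℚ.- c) ℚ.+ (b ℚ.- d)
+-difference = solve 4 (λ a b c d → (a :+ b) :- (c :+ d) := (a :- c) :+ (b :- d)) refl
  where open +-*-Solver

neg-difference : ∀ a b → b ℚ.- a ≡ (ℚ.- a) ℚ.- (ℚ.- b)
neg-difference = solve 2 (λ a b → b :- a := (:- a) :- (:- b)) refl
  where open +-*-Solver

*-difference : ∀ a b c d → (a ℚ.* b) ℚ.- (c ℚ.* d) ≡ a ℚ.* (b ℚ.- d) ℚ.+ d ℚ.* (a ℚ.- c)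
*-difference = solve 4 (λ a b c d → (a :* b) :- (c :* d) := a :* (b :- d) :+ d :* (a :- c)) refl
  where open +-*-Solver

clear-denominators : ∀ a b a′ b′ →
  (a ℚ.* b) ℚ.* (a′ ℚ.- b′) ≡ (a ℚ.* a′) ℚ.* b ℚ.- (b ℚ.* b′) ℚ.* a
clear-denominators =
  solve 4 (λ a b a′ b′ → (a :* b) :* (a′ :- b′) := (a :* a′) :* b :- (b :* b′) :* a) refl
  where open +-*-Solver

cancel-sum : ∀ a d → d ≡ (a ℚ.+ d) ℚ.- a
cancel-sum = solve 2 (λ a d → d := (a :+ d) :- a) refl
  where open +-*-Solver

half : ∀ {ε} → 0ℚ ℚ.< ε → 0ℚ ℚ.< ½ ℚ.* ε
half {ε} 0<ε = ℚₚ.*-monoʳ-<-pos ½ 0<ε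

half+half : ∀ ε → ½ ℚ.* ε ℚ.+ ½ ℚ.* ε ≡ ε
half+half ε = trans (sym (ℚₚ.*-distribʳ-+ ε ½ ½)) (ℚₚ.*-identityˡ ε)

record ℝ : Set where
  field
    seq    : ℕ → ℚ
    cauchy : ∀ ε → 0ℚ ℚ.< ε →
             ∃ λ N → ∀ m n → N ℕ.≤ m → N ℕ.≤ n → ℚ.∣ seq m ℚ.- seq n ∣ ℚ.< ε

open ℝ public

infix 4 _<_ _≤_ _#_

_<_ : ℝ → ℝ → Set
x < y = ∃ λ ε → 0ℚ ℚ.< ε × ∃ λ N → ∀ n → N ℕ.≤ n → seq x n ℚ.+ ε ℚ.< seq y n

_≤_ : ℝ → ℝ → Set
x ≤ y = ∀ ε → 0ℚ ℚ.< ε → ∃ λ N → ∀ n → N ℕ.≤ n → seq x n ℚ.< seq y n ℚ.+ ε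

-- Apartness, the constructive form of x ≠ y.
_#_ : ℝ → ℝ → Set
x # y = x < y ⊎ y < x

fromℚ : ℚ → ℝ
fromℚ q = record
  { seq    = λ _ → q
  ; cauchy = λ ε 0<ε → 0 , λ _ _ _ _ →
      subst (ℚ._< ε) (sym (cong ℚ.∣_∣ (ℚₚ.+-inverseʳ q))) 0<ε
  }

fromℕ : ℕ → ℝ
fromℕ n = fromℚ (+ n ℚ./ 1)

0ℝ 1ℝ : ℝ
0ℝ = fromℚ 0ℚ
1ℝ = fromℚ 1ℚ

infixl 6 _+_ _-_
infixl 7 _*_ _÷_

_+_ : ℝ → ℝ → ℝ
x + y = record { seq = λ n → seq x n ℚ.+ seq y n ; cauchy = c }
  where
  open ℚₚ.≤-Reasoning
  c : ∀ ε → 0ℚ ℚ.< ε → ∃ λ N → ∀ m n → N ℕ.≤ m → N ℕ.≤ n →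
      ℚ.∣ (seq x m ℚ.+ seq y m) ℚ.- (seq x n ℚ.+ seq y n) ∣ ℚ.< ε
  c ε 0<ε with cauchy x (½ ℚ.* ε) (half 0<ε) | cauchy y (½ ℚ.* ε) (half 0<ε)
  ... | M , hx | N , hy = M ℕ.⊔ N , λ m n m≥ n≥ → begin-strict
    ℚ.∣ (seq x m ℚ.+ seq y m) ℚ.- (seq x n ℚ.+ seq y n) ∣
      ≡⟨ cong ℚ.∣_∣ (+-difference (seq x m) (seq y m) (seq x n) (seq y n)) ⟩
    ℚ.∣ (seq x m ℚ.- seq x n) ℚ.+ (seq y m ℚ.- seq y n) ∣
      ≤⟨ ℚₚ.∣p+q∣≤∣p∣+∣q∣ (seq x m ℚ.- seq x n) (seq y m ℚ.- seq y n) ⟩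
    ℚ.∣ seq x m ℚ.- seq x n ∣ ℚ.+ ℚ.∣ seq y m ℚ.- seq y n ∣
      <⟨ ℚₚ.+-mono-< (hx m n (ℕₚ.m⊔n≤o⇒m≤o M N m≥) (ℕₚ.m⊔n≤o⇒m≤o M N n≥))
                     (hy m n (ℕₚ.m⊔n≤o⇒n≤o M N m≥) (ℕₚ.m⊔n≤o⇒n≤o M N n≥)) ⟩
    ½ ℚ.* ε ℚ.+ ½ ℚ.* ε
      ≡⟨ half+half ε ⟩
    ε ∎

-_ : ℝ → ℝ
- x = record { seq = λ n → ℚ.- seq x n ; cauchy = c }
  where
  c : ∀ ε → 0ℚ ℚ.< ε → ∃ λ N → ∀ m n → N ℕ.≤ m → N ℕ.≤ n →
      ℚ.∣ (ℚ.- seq x m) ℚ.- (ℚ.- seq x n) ∣ ℚ.< ε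
  c ε 0<ε with cauchy x ε 0<ε
  ... | N , h = N , λ m n m≥ n≥ → subst (ℚ._< ε)
    (cong ℚ.∣_∣ (neg-difference (seq x m) (seq x n)))
    (h n m n≥ m≥)

_-_ : ℝ → ℝ → ℝ
x - y = x + (- y)

∣_∣ᴿ : ℝ → ℝ
∣ x ∣ᴿ = record
  { seq    = λ n → ℚ.∣ seq x n ∣
  ; cauchy = λ ε 0<ε → let N , h = cauchy x ε 0<ε in
      N , λ m n m≥ n≥ →
        ℚₚ.≤-<-trans (∣∣p∣-∣q∣∣≤∣p-q∣ (seq x m) (seq x n)) (h m n m≥ n≥)
  }

bounded : ∀ x → ∃ λ B → 0ℚ ℚ.< B × ∃ λ N → ∀ n → N ℕ.≤ n → ℚ.∣ seq x n ∣ ℚ.≤ B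
bounded x with cauchy x 1ℚ (ℚₚ.positive⁻¹ 1ℚ)
... | N , h = 1ℚ ℚ.+ ℚ.∣ seq x N ∣
            , ℚₚ.+-mono-<-≤ (ℚₚ.positive⁻¹ 1ℚ) (ℚₚ.0≤∣p∣ (seq x N))
            , N
            , λ n n≥ → ℚₚ.≤-trans (∣p∣≤∣p-q∣+∣q∣ (seq x n) (seq x N))
                (ℚₚ.+-monoˡ-≤ ℚ.∣ seq x N ∣ (ℚₚ.<⇒≤ (h n N n≥ ℕₚ.≤-refl)))

quotient : ∀ {B ε} → 0ℚ ℚ.< B → 0ℚ ℚ.< ε → ∃ λ δ → 0ℚ ℚ.< δ × B ℚ.* δ ≡ ε
quotient {B} {ε} 0<B 0<ε = (ℚ.1/ B) ℚ.* ε , 0<δ , eq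
  where
  instance
    _ = ℚ.positive 0<B
    _ = ℚₚ.pos⇒nonZero B
    _ = ℚₚ.1/pos⇒pos B
  0<δ : 0ℚ ℚ.< (ℚ.1/ B) ℚ.* ε
  0<δ = subst (ℚ._< (ℚ.1/ B) ℚ.* ε) (ℚₚ.*-zeroʳ (ℚ.1/ B)) (ℚₚ.*-monoʳ-<-pos (ℚ.1/ B) 0<ε)
  eq : B ℚ.* ((ℚ.1/ B) ℚ.* ε) ≡ ε
  eq = trans (sym (ℚₚ.*-assoc B (ℚ.1/ B) ε))
      (trans (cong (ℚ._* ε) (ℚₚ.*-inverseʳ B)) (ℚₚ.*-identityˡ ε))

scale : ∀ {B δ a b} → 0ℚ ℚ.< B → 0ℚ ℚ.< δ →
        ℚ.∣ a ∣ ℚ.≤ B → ℚ.∣ b ∣ ℚ.< δ → ℚ.∣ a ℚ.* b ∣ ℚ.< B ℚ.* δ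
scale {B} {δ} {a} {b} 0<B 0<δ a≤B b<δ = begin-strict
  ℚ.∣ a ℚ.* b ∣          ≡⟨ ℚₚ.∣p*q∣≡∣p∣*∣q∣ a b ⟩
  ℚ.∣ a ∣ ℚ.* ℚ.∣ b ∣    ≤⟨ ℚₚ.*-monoʳ-≤-nonNeg ℚ.∣ b ∣ {{ℚₚ.∣-∣-nonNeg b}} a≤B ⟩
  B ℚ.* ℚ.∣ b ∣          <⟨ ℚₚ.*-monoʳ-<-pos B {{ℚ.positive 0<B}} b<δ ⟩
  B ℚ.* δ                ∎
  where open ℚₚ.≤-Reasoning

*-close : ∀ {A B α β ε} a b c d → 0ℚ ℚ.< A → 0ℚ ℚ.< B → 0ℚ ℚ.< α → 0ℚ ℚ.< β →
          A ℚ.* α ≡ ½ ℚ.* ε → B ℚ.* β ≡ ½ ℚ.* ε →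
          ℚ.∣ a ∣ ℚ.≤ A → ℚ.∣ d ∣ ℚ.≤ B → ℚ.∣ b ℚ.- d ∣ ℚ.< α → ℚ.∣ a ℚ.- c ∣ ℚ.< β →
          ℚ.∣ a ℚ.* b ℚ.- c ℚ.* d ∣ ℚ.< ε
*-close {A} {B} {α} {β} {ε} a b c d 0<A 0<B 0<α 0<β Aα≡ Bβ≡ a≤A d≤B b-d<α a-c<β =
  subst₂ ℚ._<_
    (cong ℚ.∣_∣ (sym (*-difference a b c d)))
    (trans (cong₂ ℚ._+_ Aα≡ Bβ≡) (half+half ε))
    (ℚₚ.≤-<-trans (ℚₚ.∣p+q∣≤∣p∣+∣q∣ (a ℚ.* (b ℚ.- d)) (d ℚ.* (a ℚ.- c)))
      (ℚₚ.+-mono-< (scale {a = a} {b = b ℚ.- d} 0<A 0<α a≤A b-d<α)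
                   (scale {a = d} {b = a ℚ.- c} 0<B 0<β d≤B a-c<β)))

_*_ : ℝ → ℝ → ℝ
x * y = record { seq = λ n → seq x n ℚ.* seq y n ; cauchy = c }
  where
  c : ∀ ε → 0ℚ ℚ.< ε → ∃ λ N → ∀ m n → N ℕ.≤ m → N ℕ.≤ n →
      ℚ.∣ (seq x m ℚ.* seq y m) ℚ.- (seq x n ℚ.* seq y n) ∣ ℚ.< ε
  c ε 0<ε =
    let A , 0<A , K , hA = bounded x
        B , 0<B , L , hB = bounded y
        α , 0<α , Aα≡    = quotient 0<A (half 0<ε)
        β , 0<β , Bβ≡    = quotient 0<B (half 0<ε)
        M , hx           = cauchy x β 0<β
        N , hy           = cauchy y α 0<α
    in (K ℕ.⊔ L) ℕ.⊔ (M ℕ.⊔ N) , λ m n m≥ n≥ →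
    let M⊔N≤m = ℕₚ.m⊔n≤o⇒n≤o (K ℕ.⊔ L) (M ℕ.⊔ N) m≥
        M⊔N≤n = ℕₚ.m⊔n≤o⇒n≤o (K ℕ.⊔ L) (M ℕ.⊔ N) n≥
        K≤m   = ℕₚ.m⊔n≤o⇒m≤o K L (ℕₚ.m⊔n≤o⇒m≤o (K ℕ.⊔ L) (M ℕ.⊔ N) m≥)
        L≤n   = ℕₚ.m⊔n≤o⇒n≤o K L (ℕₚ.m⊔n≤o⇒m≤o (K ℕ.⊔ L) (M ℕ.⊔ N) n≥)
    in *-close (seq x m) (seq y m) (seq x n) (seq y n) 0<A 0<B 0<α 0<β Aα≡ Bβ≡
         (hA m K≤m) (hB n L≤n)
         (hy m n (ℕₚ.m⊔n≤o⇒n≤o M N M⊔N≤m) (ℕₚ.m⊔n≤o⇒n≤o M N M⊔N≤n))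
         (hx m n (ℕₚ.m⊔n≤o⇒m≤o M N M⊔N≤m) (ℕₚ.m⊔n≤o⇒m≤o M N M⊔N≤n))

recip : ℚ → ℚ
recip q with q ℚₚ.≟ 0ℚ
... | yes _   = 0ℚ
... | no  q≢0 = ℚ.1/_ q {{ℚ.≢-nonZero q≢0}}

recip-inverse : ∀ q → q ≢ 0ℚ → q ℚ.* recip q ≡ 1ℚ
recip-inverse q q≢0 with q ℚₚ.≟ 0ℚ
... | yes q≡0 = contradiction q≡0 q≢0
... | no  q≢0 = ℚₚ.*-inverseʳ q {{ℚ.≢-nonZero q≢0}}

δ<∣q∣⇒q≢0 : ∀ {δ q} → 0ℚ ℚ.< δ → δ ℚ.< ℚ.∣ q ∣ → q ≢ 0ℚ
δ<∣q∣⇒q≢0 0<δ δ<∣q∣ refl = ℚₚ.<-asym 0<δ δ<∣q∣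

#0⇒away : ∀ x → x # 0ℝ →
          ∃ λ δ → 0ℚ ℚ.< δ × ∃ λ N → ∀ n → N ℕ.≤ n → δ ℚ.< ℚ.∣ seq x n ∣
#0⇒away x (inj₁ (δ , 0<δ , N , h)) = δ , 0<δ , N , λ n n≥ → begin-strict
  δ                                            ≡⟨ cancel-sum (seq x n) δ ⟩
  (seq x n ℚ.+ δ) ℚ.- seq x n                  <⟨ ℚₚ.+-monoˡ-< (ℚ.- seq x n) (h n n≥) ⟩
  0ℚ ℚ.- seq x n                               ≡⟨ ℚₚ.+-identityˡ (ℚ.- seq x n) ⟩
  ℚ.- seq x n                                  ≤⟨ p≤∣p∣ (ℚ.- seq x n) ⟩
  ℚ.∣ ℚ.- seq x n ∣                            ≡⟨ ℚₚ.∣-p∣≡∣p∣ (seq x n) ⟩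
  ℚ.∣ seq x n ∣                                ∎
  where
  open ℚₚ.≤-Reasoning
#0⇒away x (inj₂ (δ , 0<δ , N , h)) = δ , 0<δ , N , λ n n≥ →
  ℚₚ.<-≤-trans (subst (ℚ._< seq x n) (ℚₚ.+-identityˡ δ) (h n n≥)) (p≤∣p∣ (seq x n))

recip-close : ∀ {δ ε} a b → 0ℚ ℚ.< δ → δ ℚ.< ℚ.∣ a ∣ → δ ℚ.< ℚ.∣ b ∣ →
              ℚ.∣ b ℚ.- a ∣ ℚ.< (δ ℚ.* δ) ℚ.* ε → ℚ.∣ recip a ℚ.- recip b ∣ ℚ.< ε
recip-close {δ} {ε} a b 0<δ δ<∣a∣ δ<∣b∣ b-a<δδε =
  ℚₚ.*-cancelˡ-<-nonNeg (δ ℚ.* δ) (ℚₚ.≤-<-trans shrink (subst (ℚ._< (δ ℚ.* δ) ℚ.* ε) (sym exact) b-a<δδε))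
  where
  r = recip a ℚ.- recip b
  instance
    _ = ℚ.positive 0<δ
    _ = ℚₚ.pos⇒nonNeg δ
    _ = ℚₚ.pos*pos⇒pos δ δ
    _ = ℚₚ.pos⇒nonNeg (δ ℚ.* δ)
  shrink : (δ ℚ.* δ) ℚ.* ℚ.∣ r ∣ ℚ.≤ (ℚ.∣ a ∣ ℚ.* ℚ.∣ b ∣) ℚ.* ℚ.∣ r ∣
  shrink = ℚₚ.*-monoʳ-≤-nonNeg ℚ.∣ r ∣ {{ℚₚ.∣-∣-nonNeg r}}
    (ℚₚ.≤-trans (ℚₚ.*-monoʳ-≤-nonNeg δ (ℚₚ.<⇒≤ δ<∣a∣))
                (ℚₚ.*-monoˡ-≤-nonNeg ℚ.∣ a ∣ {{ℚₚ.∣-∣-nonNeg a}} (ℚₚ.<⇒≤ δ<∣b∣)))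
  exact : (ℚ.∣ a ∣ ℚ.* ℚ.∣ b ∣) ℚ.* ℚ.∣ r ∣ ≡ ℚ.∣ b ℚ.- a ∣
  exact = trans (cong (ℚ._* ℚ.∣ r ∣) (sym (ℚₚ.∣p*q∣≡∣p∣*∣q∣ a b)))
    (trans (sym (ℚₚ.∣p*q∣≡∣p∣*∣q∣ (a ℚ.* b) r))
    (trans (cong ℚ.∣_∣ (clear-denominators a b (recip a) (recip b)))
    (trans (cong₂ (λ u v → ℚ.∣ u ℚ.* b ℚ.- v ℚ.* a ∣)
                  (recip-inverse a (δ<∣q∣⇒q≢0 0<δ δ<∣a∣))
                  (recip-inverse b (δ<∣q∣⇒q≢0 0<δ δ<∣b∣)))
           (cong₂ (λ u v → ℚ.∣ u ℚ.- v ∣) (ℚₚ.*-identityˡ b) (ℚₚ.*-identityˡ a)))))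

0<* : ∀ {p q} → 0ℚ ℚ.< p → 0ℚ ℚ.< q → 0ℚ ℚ.< p ℚ.* q
0<* {p} {q} 0<p 0<q =
  subst (ℚ._< p ℚ.* q) (ℚₚ.*-zeroʳ p) (ℚₚ.*-monoʳ-<-pos p {{ℚ.positive 0<p}} 0<q)

inverse : (x : ℝ) → x # 0ℝ → ℝ
inverse x x#0 = record { seq = λ n → recip (seq x n) ; cauchy = c }
  where
  c : ∀ ε → 0ℚ ℚ.< ε → ∃ λ N → ∀ m n → N ℕ.≤ m → N ℕ.≤ n →
      ℚ.∣ recip (seq x m) ℚ.- recip (seq x n) ∣ ℚ.< ε
  c ε 0<ε =
    let δ , 0<δ , M , away = #0⇒away x x#0
        N , h              = cauchy x ((δ ℚ.* δ) ℚ.* ε) (0<* (0<* 0<δ 0<δ) 0<ε)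
    in M ℕ.⊔ N , λ m n m≥ n≥ →
       recip-close (seq x m) (seq x n) 0<δ
         (away m (ℕₚ.m⊔n≤o⇒m≤o M N m≥)) (away n (ℕₚ.m⊔n≤o⇒m≤o M N n≥))
         (h n m (ℕₚ.m⊔n≤o⇒n≤o M N n≥) (ℕₚ.m⊔n≤o⇒n≤o M N m≥))

_÷_ : ℝ → (y : ℝ) → y # 0ℝ → ℝ
(x ÷ y) y#0 = x * inverse y y#0

∑ : List ℝ → ℝ
∑ = foldr _+_ 0ℝ

infix 4 _⟶_ _≪_

_⟶_ : (ℕ → ℝ) → ℝ → Set
f ⟶ L = ∀ ε → 0ℝ < ε → ∃ λ N → ∀ n → N ℕ.≤ n → ∣ f n - L ∣ᴿ < ε

-- f(n)/g(n) → 0, where the quotient need only be defined for all large n.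
_≪_ : (ℕ → ℝ) → (ℕ → ℝ) → Set
f ≪ g = ∃ λ N → Σ (∀ n → g (N ℕ.+ n) # 0ℝ) λ g#0 →
        (λ n → (f (N ℕ.+ n) ÷ g (N ℕ.+ n)) (g#0 n)) ⟶ 0ℝ

∑< : ℕ → (ℕ → ℚ) → ℚ
∑< zero    f = 0ℚ
∑< (suc n) f = ∑< n f ℚ.+ f n

1/suc : ℕ → ℚ
1/suc n = + 1 ℚ./ suc n

-- ln n = ∫₁ⁿ dt/t.  With d = n - 1 and M = suc m, the right Riemann sum of mesh
-- 1/M is ∑_{i < d M} (1/M) · 1/(1 + (i+1)/M) = ∑_{i < d M} 1/(M + i + 1).
lnSum : ℕ → ℕ → ℚ
lnSum d m = ∑< (d ℕ.* suc m) (λ i → 1/suc (suc m ℕ.+ i))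

∑<-cong : ∀ n {f g} → (∀ i → f i ≡ g i) → ∑< n f ≡ ∑< n g
∑<-cong zero    f≡g = refl
∑<-cong (suc n) f≡g = cong₂ ℚ._+_ (∑<-cong n f≡g) (f≡g n)

∑<-mono : ∀ n {f g} → (∀ i → i ℕ.< n → f i ℚ.≤ g i) → ∑< n f ℚ.≤ ∑< n g
∑<-mono zero    f≤g = ℚₚ.≤-refl
∑<-mono (suc n) f≤g = ℚₚ.+-mono-≤ (∑<-mono n (λ i i<n → f≤g i (ℕₚ.m<n⇒m<1+n i<n))) (f≤g n ℕₚ.≤-refl)

∑<-+ : ∀ m n f → ∑< (m ℕ.+ n) f ≡ ∑< m f ℚ.+ ∑< n (λ i → f (m ℕ.+ i))
∑<-+ m zero f = trans (cong (λ k → ∑< k f) (ℕₚ.+-identityʳ m)) (sym (ℚₚ.+-identityʳ (∑< m f)))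
∑<-+ m (suc n) f = trans (cong (λ k → ∑< k f) (ℕₚ.+-suc m n))
  (trans (cong (ℚ._+ f (m ℕ.+ n)) (∑<-+ m n f))
         (ℚₚ.+-assoc (∑< m f) (∑< n (λ i → f (m ℕ.+ i))) (f (m ℕ.+ n))))

∑<-blocks : ∀ b r f → ∑< (b ℕ.* r) f ≡ ∑< b (λ j → ∑< r (λ t → f (j ℕ.* r ℕ.+ t)))
∑<-blocks zero    r f = refl
∑<-blocks (suc b) r f = trans (cong (λ k → ∑< k f) (ℕₚ.+-comm r (b ℕ.* r)))
  (trans (∑<-+ (b ℕ.* r) r f)
         (cong (ℚ._+ ∑< r (λ t → f (b ℕ.* r ℕ.+ t))) (∑<-blocks b r f)))

1/suc-anti : ∀ {m n} → m ℕ.≤ n → 1/suc n ℚ.≤ 1/suc m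
1/suc-anti {m} {n} m≤n = ℚₚ.toℚᵘ-cancel-≤ (begin
  ℚ.toℚᵘ (1/suc n)      ≃⟨ ℚₚ.toℚᵘ-fromℚᵘ (ℚᵘ.mkℚᵘ (+ 1) n) ⟩
  ℚᵘ.mkℚᵘ (+ 1) n       ≤⟨ ℚᵘ.*≤* (ℤₚ.*-monoˡ-≤-nonNeg (+ 1) (ℤ.+≤+ (s≤s m≤n))) ⟩
  ℚᵘ.mkℚᵘ (+ 1) m       ≃⟨ ℚₚ.toℚᵘ-fromℚᵘ (ℚᵘ.mkℚᵘ (+ 1) m) ⟨
  ℚ.toℚᵘ (1/suc m)      ∎)
  where open ℚᵘₚ.≤-Reasoning

0<1/suc : ∀ n → 0ℚ ℚ.< 1/suc n
0<1/suc n = ℚₚ.toℚᵘ-cancel-< (begin-strict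
  ℚᵘ.0ℚᵘ                ≡⟨⟩
  ℚᵘ.mkℚᵘ (+ 0) 0       <⟨ ℚᵘ.*<* (ℤ.+<+ (s≤s z≤n)) ⟩
  ℚᵘ.mkℚᵘ (+ 1) n       ≃⟨ ℚₚ.toℚᵘ-fromℚᵘ (ℚᵘ.mkℚᵘ (+ 1) n) ⟨
  ℚ.toℚᵘ (1/suc n)      ∎)
  where open ℚᵘₚ.≤-Reasoning

archimedean : ∀ ε → 0ℚ ℚ.< ε → ∃ λ N → 1/suc N ℚ.≤ ε
archimedean ε@(ℚ.mkℚ (+ suc a) d _) 0<ε = d , ℚₚ.toℚᵘ-cancel-≤ (begin
  ℚ.toℚᵘ (1/suc d)      ≃⟨ ℚₚ.toℚᵘ-fromℚᵘ (ℚᵘ.mkℚᵘ (+ 1) d) ⟩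
  ℚᵘ.mkℚᵘ (+ 1) d       ≤⟨ ℚᵘ.*≤* (ℤₚ.*-monoʳ-≤-nonNeg (+ suc d) {+ 1} {+ suc a} (ℤ.+≤+ (s≤s z≤n))) ⟩
  ℚ.toℚᵘ ε              ∎)
  where open ℚᵘₚ.≤-Reasoning
archimedean (ℚ.mkℚ (+ 0) d _)      (ℚ.*<* (ℤ.+<+ ()))
archimedean (ℚ.mkℚ -[1+ a ] d _)   (ℚ.*<* ())

suc/1 : ∀ n → (+ n ℚ./ 1) ℚ.+ 1ℚ ≡ + suc n ℚ./ 1
suc/1 n = ℚₚ.toℚᵘ-injective (begin-equality
  ℚ.toℚᵘ ((+ n ℚ./ 1) ℚ.+ 1ℚ)
    ≃⟨ ℚₚ.toℚᵘ-homo-+ (+ n ℚ./ 1) 1ℚ ⟩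
  ℚ.toℚᵘ (+ n ℚ./ 1) ℚᵘ.+ ℚᵘ.1ℚᵘ
    ≃⟨ ℚᵘₚ.+-congˡ ℚᵘ.1ℚᵘ (ℚₚ.toℚᵘ-fromℚᵘ (ℚᵘ.mkℚᵘ (+ n) 0)) ⟩
  ℚᵘ.mkℚᵘ (+ n) 0 ℚᵘ.+ ℚᵘ.1ℚᵘ
    ≃⟨ ℚᵘ.*≡* (cong (ℤ._* + 1) (trans (cong (ℤ._+ + 1) (ℤₚ.*-identityʳ (+ n))) (cong +_ (ℕₚ.+-comm n 1)))) ⟩
  ℚᵘ.mkℚᵘ (+ suc n) 0
    ≃⟨ ℚₚ.toℚᵘ-fromℚᵘ (ℚᵘ.mkℚᵘ (+ suc n) 0) ⟨
  ℚ.toℚᵘ (+ suc n ℚ./ 1) ∎)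
  where open ℚᵘₚ.≤-Reasoning

∑<-const : ∀ n q → ∑< n (λ _ → q) ≡ (+ n ℚ./ 1) ℚ.* q
∑<-const zero    q = sym (ℚₚ.*-zeroˡ q)
∑<-const (suc n) q = begin-equality
  ∑< n (λ _ → q) ℚ.+ q                      ≡⟨ cong₂ ℚ._+_ (∑<-const n q) (sym (ℚₚ.*-identityˡ q)) ⟩
  (+ n ℚ./ 1) ℚ.* q ℚ.+ 1ℚ ℚ.* q            ≡⟨ ℚₚ.*-distribʳ-+ q (+ n ℚ./ 1) 1ℚ ⟨
  ((+ n ℚ./ 1) ℚ.+ 1ℚ) ℚ.* q                ≡⟨ cong (ℚ._* q) (suc/1 n) ⟩
  (+ suc n ℚ./ 1) ℚ.* q                     ∎
  where
  open ℚₚ.≤-Reasoning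

-- r copies of 1/((k+1) r) add up to 1/(k+1), where r = suc s.
∑<-split : ∀ s k → ∑< (suc s) (λ _ → 1/suc (s ℕ.+ k ℕ.* suc s)) ≡ 1/suc k
∑<-split s k = trans (∑<-const (suc s) (1/suc (s ℕ.+ k ℕ.* suc s))) (ℚₚ.toℚᵘ-injective (begin-equality
  ℚ.toℚᵘ ((+ suc s ℚ./ 1) ℚ.* 1/suc (s ℕ.+ k ℕ.* suc s))
    ≃⟨ ℚₚ.toℚᵘ-homo-* (+ suc s ℚ./ 1) (1/suc (s ℕ.+ k ℕ.* suc s)) ⟩
  ℚ.toℚᵘ (+ suc s ℚ./ 1) ℚᵘ.* ℚ.toℚᵘ (1/suc (s ℕ.+ k ℕ.* suc s))
    ≃⟨ ℚᵘₚ.*-cong (ℚₚ.toℚᵘ-fromℚᵘ (ℚᵘ.mkℚᵘ (+ suc s) 0))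
                  (ℚₚ.toℚᵘ-fromℚᵘ (ℚᵘ.mkℚᵘ (+ 1) (s ℕ.+ k ℕ.* suc s))) ⟩
  ℚᵘ.mkℚᵘ (+ suc s) 0 ℚᵘ.* ℚᵘ.mkℚᵘ (+ 1) (s ℕ.+ k ℕ.* suc s)
    ≃⟨ ℚᵘ.*≡* (cong +_ (cross s k)) ⟩
  ℚᵘ.mkℚᵘ (+ 1) k
    ≃⟨ ℚₚ.toℚᵘ-fromℚᵘ (ℚᵘ.mkℚᵘ (+ 1) k) ⟨
  ℚ.toℚᵘ (1/suc k) ∎))
  where
  open ℚᵘₚ.≤-Reasoning
  cross : ∀ s k → suc s ℕ.* 1 ℕ.* suc k ≡ 1 ℕ.* (1 ℕ.* (suc k ℕ.* suc s))
  cross s k = trans (cong (ℕ._* suc k) (ℕₚ.*-identityʳ (suc s)))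
    (trans (ℕₚ.*-comm (suc s) (suc k))
    (trans (sym (ℕₚ.*-identityˡ (suc k ℕ.* suc s))) (sym (ℕₚ.*-identityˡ (1 ℕ.* (suc k ℕ.* suc s))))))

-- The Riemann sum of mesh 1/((m+1)(s+1)), grouped into the cells of mesh 1/(m+1).
fine : ℕ → ℕ → ℕ → ℚ
fine d m s = ∑< (d ℕ.* suc m)
  (λ j → ∑< (suc s) (λ t → 1/suc (suc m ℕ.* suc s ℕ.+ (j ℕ.* suc s ℕ.+ t))))

lnSum-fine : ∀ d m s → lnSum d (s ℕ.+ m ℕ.* suc s) ≡ fine d m s
lnSum-fine d m s = trans
  (cong (λ k → ∑< k f) (sym (ℕₚ.*-assoc d (suc m) (suc s))))
  (∑<-blocks (d ℕ.* suc m) (suc s) f)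
  where
  f : ℕ → ℚ
  f i = 1/suc (suc m ℕ.* suc s ℕ.+ i)

regroup : ∀ m s j t → suc m ℕ.* suc s ℕ.+ (j ℕ.* suc s ℕ.+ t) ≡ t ℕ.+ (suc m ℕ.+ j) ℕ.* suc s
regroup m s j t = trans (sym (ℕₚ.+-assoc (suc m ℕ.* suc s) (j ℕ.* suc s) t))
  (trans (cong (ℕ._+ t) (sym (ℕₚ.*-distribʳ-+ (suc s) (suc m) j)))
         (ℕₚ.+-comm ((suc m ℕ.+ j) ℕ.* suc s) t))

lnSum≤fine : ∀ d m s → lnSum d m ℚ.≤ fine d m s
lnSum≤fine d m s = ∑<-mono (d ℕ.* suc m) λ j _ → begin
  1/suc (suc m ℕ.+ j)
    ≡⟨ ∑<-split s (suc m ℕ.+ j) ⟨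
  ∑< (suc s) (λ _ → 1/suc (s ℕ.+ (suc m ℕ.+ j) ℕ.* suc s))
    ≤⟨ ∑<-mono (suc s) (λ t t<r → 1/suc-anti (ℕₚ.≤-trans (ℕₚ.≤-reflexive (regroup m s j t))
         (ℕₚ.+-monoˡ-≤ ((suc m ℕ.+ j) ℕ.* suc s) (ℕₚ.≤-pred t<r)))) ⟩
  ∑< (suc s) (λ t → 1/suc (suc m ℕ.* suc s ℕ.+ (j ℕ.* suc s ℕ.+ t)))
    ∎
  where open ℚₚ.≤-Reasoning

fine≤leftSum : ∀ d m s → fine d m s ℚ.≤ ∑< (d ℕ.* suc m) (λ j → 1/suc (m ℕ.+ j))
fine≤leftSum d m s = ∑<-mono (d ℕ.* suc m) λ j _ → begin
  ∑< (suc s) (λ t → 1/suc (suc m ℕ.* suc s ℕ.+ (j ℕ.* suc s ℕ.+ t)))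
    ≤⟨ ∑<-mono (suc s) (λ t _ → 1/suc-anti (ℕₚ.≤-trans
         (ℕₚ.≤-trans (ℕₚ.n≤1+n _) (ℕₚ.m≤n+m ((suc m ℕ.+ j) ℕ.* suc s) t))
         (ℕₚ.≤-reflexive (sym (regroup m s j t))))) ⟩
  ∑< (suc s) (λ _ → 1/suc (s ℕ.+ (m ℕ.+ j) ℕ.* suc s))
    ≡⟨ ∑<-split s (m ℕ.+ j) ⟩
  1/suc (m ℕ.+ j)
    ∎
  where open ℚₚ.≤-Reasoning

telescope : ∀ b m → ∑< b (λ j → 1/suc (m ℕ.+ j)) ℚ.+ 1/suc (m ℕ.+ b)
                  ≡ 1/suc m ℚ.+ ∑< b (λ j → 1/suc (suc m ℕ.+ j))
telescope zero m = trans (ℚₚ.+-comm 0ℚ (1/suc (m ℕ.+ 0)))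
  (cong (λ k → 1/suc k ℚ.+ 0ℚ) (ℕₚ.+-identityʳ m))
telescope (suc b) m = trans
  (cong₂ ℚ._+_ (telescope b m) (cong 1/suc (ℕₚ.+-suc m b)))
  (ℚₚ.+-assoc (1/suc m) (∑< b (λ j → 1/suc (suc m ℕ.+ j))) (1/suc (suc m ℕ.+ b)))

fine≤lnSum : ∀ d m s → fine d m s ℚ.≤ 1/suc m ℚ.+ lnSum d m
fine≤lnSum d m s = begin
  fine d m s                                         ≤⟨ fine≤leftSum d m s ⟩
  ∑< b (λ j → 1/suc (m ℕ.+ j))                       ≡⟨ ℚₚ.+-identityʳ _ ⟨
  ∑< b (λ j → 1/suc (m ℕ.+ j)) ℚ.+ 0ℚ
    ≤⟨ ℚₚ.+-monoʳ-≤ (∑< b (λ j → 1/suc (m ℕ.+ j))) (ℚₚ.<⇒≤ (0<1/suc (m ℕ.+ b))) ⟩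
  ∑< b (λ j → 1/suc (m ℕ.+ j)) ℚ.+ 1/suc (m ℕ.+ b)   ≡⟨ telescope b m ⟩
  1/suc m ℚ.+ lnSum d m                              ∎
  where
  open ℚₚ.≤-Reasoning
  b = d ℕ.* suc m

lnSum-step : ∀ d m s → lnSum d m ℚ.≤ 1/suc s ℚ.+ lnSum d s
lnSum-step d m s = begin
  lnSum d m                       ≤⟨ lnSum≤fine d m s ⟩
  fine d m s                      ≡⟨ lnSum-fine d m s ⟨
  lnSum d (s ℕ.+ m ℕ.* suc s)     ≡⟨ cong (lnSum d) (ℕₚ.suc-injective (ℕₚ.*-comm (suc m) (suc s))) ⟩
  lnSum d (m ℕ.+ s ℕ.* suc m)     ≡⟨ lnSum-fine d s m ⟩
  fine d s m                      ≤⟨ fine≤lnSum d s m ⟩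
  1/suc s ℚ.+ lnSum d s           ∎
  where open ℚₚ.≤-Reasoning

-- ln 0 is a junk value (0).
ln : ℕ → ℝ
ln n = record { seq = lnSum (n ℕ.∸ 1) ; cauchy = c }
  where
  d = n ℕ.∸ 1
  c : ∀ ε → 0ℚ ℚ.< ε → ∃ λ N → ∀ m s → N ℕ.≤ m → N ℕ.≤ s → ℚ.∣ lnSum d m ℚ.- lnSum d s ∣ ℚ.< ε
  c ε 0<ε with archimedean (½ ℚ.* ε) (half 0<ε)
  ... | N , 1/N≤ε/2 = N , λ m s m≥ s≥ → ℚₚ.≤-<-trans
    (∣p-q∣-bound
      (ℚₚ.≤-trans (lnSum-step d m s) (ℚₚ.+-monoˡ-≤ (lnSum d s) (ℚₚ.≤-trans (1/suc-anti s≥) 1/N≤ε/2)))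
      (ℚₚ.≤-trans (lnSum-step d s m) (ℚₚ.+-monoˡ-≤ (lnSum d m) (ℚₚ.≤-trans (1/suc-anti m≥) 1/N≤ε/2))))
    ε/2<ε
    where
    ε/2<ε : ½ ℚ.* ε ℚ.< ε
    ε/2<ε = subst₂ ℚ._<_ (ℚₚ.+-identityʳ (½ ℚ.* ε)) (half+half ε) (ℚₚ.+-monoʳ-< (½ ℚ.* ε) (half 0<ε))

-- (k - 1) ln n / n for n ≥ 1; the value at n = 0 is junk.
p* : ℕ → ℕ → ℝ
p* k zero      = 0ℝ
p* k n@(suc m) = fromℕ (k ℕ.∸ 1) * ln n * fromℚ (1/suc m)

allSubsets : ∀ n → List (Subset n)
allSubsets zero    = [] ∷ []
allSubsets (suc n) = map (inside ∷_) (allSubsets n) ++ map (outside ∷_) (allSubsets n)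

kSubsets : ∀ k n → List (Subset n)
kSubsets k n = filter (λ e → ∣ e ∣ ℕ.≟ k) (allSubsets n)

-- A hypergraph is given by the set of positions of its hyperedges in kSubsets k n,
-- which lists every k-element subset exactly once (∈-kSubsets, kSubsets-unique).
record Hypergraph (k n : ℕ) : Set where
  constructor hypergraph
  field
    edges : Subset (length (kSubsets k n))

open Hypergraph public

∈-allSubsets : ∀ {n} (e : Subset n) → e Mem.∈ allSubsets n
∈-allSubsets []            = here refl
∈-allSubsets (true  ∷ e)   = ∈-++⁺ˡ (∈-map⁺ (inside ∷_) (∈-allSubsets e))
∈-allSubsets {suc n} (false ∷ e) =
  ∈-++⁺ʳ (map (inside ∷_) (allSubsets n)) (∈-map⁺ (outside ∷_) (∈-allSubsets e))

allSubsets-unique : ∀ n → Unique (allSubsets n)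
allSubsets-unique zero    = All.[] AllPairs.∷ AllPairs.[]
allSubsets-unique (suc n) = Uniqueₚ.++⁺
  (Uniqueₚ.map⁺ ∷-injectiveʳ (allSubsets-unique n))
  (Uniqueₚ.map⁺ ∷-injectiveʳ (allSubsets-unique n))
  λ (e∈ , e∈′) → disjoint (∈-map⁻ (inside ∷_) e∈) (∈-map⁻ (outside ∷_) e∈′)
  where
  disjoint : ∀ {e : Subset (suc n)} →
    ∃ (λ s → s Mem.∈ allSubsets n × e ≡ inside ∷ s) →
    ∃ (λ s → s Mem.∈ allSubsets n × e ≡ outside ∷ s) → _
  disjoint (_ , _ , refl) (_ , _ , ())

∈-kSubsets : ∀ {k n} (e : Subset n) → ∣ e ∣ ≡ k → e Mem.∈ kSubsets k n
∈-kSubsets {k} e ∣e∣≡k = ∈-filter⁺ (λ e → ∣ e ∣ ℕ.≟ k) (∈-allSubsets e) ∣e∣≡k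

kSubsets-unique : ∀ k n → Unique (kSubsets k n)
kSubsets-unique k n = Uniqueₚ.filter⁺ (λ e → ∣ e ∣ ℕ.≟ k) (allSubsets-unique n)

module _ {k n : ℕ} where

  infix 4 _∈E_

  _∈E_ : Subset n → Hypergraph k n → Set
  e ∈E H = ∃ λ i → i ∈ edges H × lookup (kSubsets k n) i ≡ e

  _∈image_of_ : Fin k → (Fin n → Fin k) → Subset n → Set
  j ∈image c of e = ∃ λ v → v ∈ e × c v ≡ j

  RainbowFree : Hypergraph k n → (Fin n → Fin k) → Set
  RainbowFree H c = StrictlySurjective _≡_ c
                  × (∀ e → e ∈E H → ¬ (∀ j → j ∈image c of e))

  RainbowFreeColourable : Hypergraph k n → Set
  RainbowFreeColourable H = ∃ λ c → RainbowFree H c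

∃-colouring? : ∀ {k} n {P : Pred (Fin n → Fin k) 0ℓ} →
               (∀ {c c′} → (∀ v → c v ≡ c′ v) → P c → P c′) →
               Decidable P → Dec (∃ P)
∃-colouring? zero resp P? =
  map′ (λ Pc → F.[] , Pc) (λ (c , Pc) → resp {c} {F.[]} (λ ()) Pc) (P? F.[])
∃-colouring? (suc n) {P} resp P? =
  map′ (λ (a , c , Pc) → (a F.∷ c) , Pc)
       (λ (c , Pc) → c zero , c ∘ suc , resp {c} {c zero F.∷ c ∘ suc} (λ { zero → refl ; (suc _) → refl }) Pc)
       (Finₚ.any? λ a → ∃-colouring? n
          (λ {c} {c′} eq → resp {a F.∷ c} {a F.∷ c′} (λ { zero → refl ; (suc v) → eq v }))
          (λ c → P? (a F.∷ c)))

RainbowFree-resp : ∀ {k n} (H : Hypergraph k n) {c c′ : Fin n → Fin k} →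
                   (∀ v → c v ≡ c′ v) → RainbowFree H c → RainbowFree H c′
RainbowFree-resp H eq (surj , rf) =
  (λ j → let v , cv≡j = surj j in v , trans (sym (eq v)) cv≡j) ,
  (λ e e∈H full → rf e e∈H λ j → let v , v∈e , c′v≡j = full j in v , v∈e , trans (eq v) c′v≡j)

rainbowFree? : ∀ {k n} (H : Hypergraph k n) → Decidable (RainbowFree H)
rainbowFree? {k} {n} H c =
  Finₚ.all? (λ j → Finₚ.any? λ v → c v Finₚ.≟ j)
  ×-dec
  map′ (λ f e (i , i∈H , eq) full → f i i∈H (subst (λ e → ∀ j → j ∈image c of e) (sym eq) full))
       (λ f i i∈H → f (lookup (kSubsets k n) i) (i , i∈H , refl))
       (Finₚ.all? λ i → (i ∈? edges H) →-dec ¬? (Finₚ.all? λ j → Finₚ.any? λ v →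
          (v ∈? lookup (kSubsets k n) i) ×-dec (c v Finₚ.≟ j)))

rainbowFreeColourable? : ∀ {k n} → Decidable (RainbowFreeColourable {k} {n})
rainbowFreeColourable? {n = n} H = ∃-colouring? n (RainbowFree-resp H) (rainbowFree? H)

-- The product of N Bernoulli(p) measures, at the outcome S.
weight : ∀ {N} → ℝ → Subset N → ℝ
weight p []            = 1ℝ
weight p (true  ∷ S)   = p * weight p S
weight p (false ∷ S)   = (1ℝ - p) * weight p S

allHypergraphs : ∀ k n → List (Hypergraph k n)
allHypergraphs k n = map hypergraph (allSubsets (length (kSubsets k n)))

Pr : ∀ k n → ℝ → {A : Pred (Hypergraph k n) 0ℓ} → Decidable A → ℝ
Pr k n p A? = ∑ (map (weight p ∘ edges) (filter A? (allHypergraphs k n)))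

{-# OPTIONS --safe #-}

-- Sparse range.  Fix k - 2 vertices with private colours.  For each of m further vertices v, give v
-- a private colour as well and all remaining vertices the last colour: the rainbow edges are then
-- among the at most n edges through the k - 1 privately coloured vertices.  Up to the at most m²
-- edges rainbow for two choices of v, these edge sets are disjoint, hence independent, so
-- all m colourings fail with probability about (1 - (1 - p)ⁿ)ᵐ, which is small for m = n^{1/4}.
--
-- Dense range.  First moment over all colourings.  If j is the largest colour class and t vertices
-- avoid it, there are at least n t / k² rainbow k-sets, so the colouring is rainbow-free with
-- probability at most yᵗ, y = (1 - p)^⌊n/k²⌋ (or a slightly smaller exponent).  Summing over
-- the colourings with t ≥ 1 gives k ((1 + k y)ⁿ - 1), which is small as soon as n y is.
--
-- Real numbers enter only through rational approximations p j clamped to [0,1], since the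
-- probability is a polynomial in p, and ln n is compared with s = ⌊log₂ n / 8⌋.

module Submission where

open import Data.Bool using (Bool; true; false; T; not; _∧_; _∨_; if_then_else_)
open import Data.Bool.Properties using (T?)
open import Data.Empty using (⊥)
open import Data.Fin using (Fin; zero; suc; punchIn; _↑ˡ_; _↑ʳ_; splitAt)
open import Data.Fin.Patterns using (0F; 1F)
import Data.Fin.Properties as Finₚ
open import Data.Fin.Subset using (Subset; ∣_∣; _∈_; _⊆_)
open import Data.Fin.Subset.Properties using (_∈?_; ⊆-antisym; p⊂q⇒∣p∣<∣q∣; x∈p⇒∣p-x∣<∣p∣)
import Data.Integer as ℤ
open import Data.List as List
  using (List; []; _∷_; _++_; map; filter; filterᵇ; length; allFin; cartesianProduct)
import Data.List.Membership.Propositional as Mem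
open import Data.List.Membership.Propositional.Properties
  using (∈-map⁺; ∈-map⁻; ∈-++⁺ˡ; ∈-++⁺ʳ; ∈-++⁻; ∈-∃++; ∈-filter⁺; ∈-filter⁻; ∈-allFin;
         ∈-cartesianProduct⁺; ∈-cartesianProduct⁻)
import Data.List.Properties as Listₚ
open import Data.List.Relation.Unary.All as All using (All)
import Data.List.Relation.Unary.All.Properties as Allₚ
open import Data.List.Relation.Unary.AllPairs as AllPairs using (AllPairs)
import Data.List.Relation.Unary.AllPairs.Properties as AllPairsₚ
open import Data.List.Relation.Unary.Any using (here; there)
open import Data.List.Relation.Unary.Unique.Propositional using (Unique)
import Data.List.Relation.Unary.Unique.Propositional.Properties as Uniqueₚ
open import Data.Nat as ℕ using (ℕ; zero; suc; s≤s; z≤n)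
open import Data.Nat.DivMod using (_/_; _%_; m/n*n≤m; m≡m%n+[m/n]*n; m%n<n; m≥n⇒m/n>0)
import Data.Nat.Properties as ℕₚ
open import Data.Product using (_×_; _,_; ∃; ∃₂; proj₁; proj₂)
open import Data.Rational as ℚ using (ℚ; 0ℚ; 1ℚ; ½)
import Data.Rational.Properties as ℚₚ
open import Data.Sum using (_⊎_; inj₁; inj₂)
open import Data.Unit using (tt)
open import Data.Vec as Vec using (Vec; []; _∷_; lookup; tabulate)
import Data.Vec.Functional as F
open import Data.Vec.Properties using (lookup∘tabulate; lookup⇒[]=; []=⇒lookup)
open import Function.Base using (_∘_; id)
open import Function.Definitions using (StrictlySurjective)
open import Level using (0ℓ)
open import Relation.Binary.PropositionalEquality
open import Relation.Nullary using (¬_; Dec; yes; no; does; contradiction)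
open import Relation.Nullary.Decidable using (dec-true; dec-false; ¬?; _×-dec_)
open import Relation.Unary using (Pred; Decidable)

open import Defs hiding (_+_; _*_; _-_; -_; _≤_; _<_)

-- In the sparse range m must lie in a window: the estimates give (1 - p)ⁿ ≥ `w` = 2⁻ˢ, so m
-- independent tries succeed once m w is large, while the shared edges are absent only if m² p is
-- small, with p at most about s / n. As 2⁸ˢ ≤ n, m = 4ˢ meets both demands. In the dense range a
-- bound uniform in t would fail, because the number of colourings with t vertices off j grows like
-- binom(n, t) kᵗ; the exponent t in yᵗ matches this count factor by factor. Exponentials are
-- replaced by Bernoulli-type inequalities such as (1 - x)ⁿ (1 + n x) ≤ 1, multiplied out to stay
-- free of division. Passing from an approximation of p to its clamped value costs a Lipschitz
-- constant exponential in the number of k-sets. This is harmless: n is fixed before the accuracy of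
-- the approximation is chosen.

-- Powers and Bernoulli-type inequalities over the rationals.

module RationalArithmetic where

  open import Data.Rational using (_+_; _*_; _-_; -_; _≤_; _<_)
  open import Data.Rational.Solver using (module +-*-Solver)

  Unit : ℚ → Set
  Unit x = 0ℚ ≤ x × x ≤ 1ℚ

  infixr 8 _^_

  _^_ : ℚ → ℕ → ℚ
  x ^ zero    = 1ℚ
  x ^ (suc n) = x * x ^ n

  opaque
    -- Opaque, so that `ι n` remains an atom for the ring solver and is handled only through its
    -- laws.
    ι : ℕ → ℚ
    ι n = ℤ.+ n ℚ./ 1

    ι-def : ∀ n → ι n ≡ ℤ.+ n ℚ./ 1
    ι-def n = refl

    ι-0 : ι 0 ≡ 0ℚ
    ι-0 = refl

    ι-1 : ι 1 ≡ 1ℚ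
    ι-1 = refl

    ι-2 : ι 2 ≡ 1ℚ + 1ℚ
    ι-2 = refl

    ι-suc : ∀ n → ι (suc n) ≡ ι n + 1ℚ
    ι-suc n = sym (suc/1 n)

  0≤1 : 0ℚ ≤ 1ℚ
  0≤1 = ℚₚ.nonNegative⁻¹ 1ℚ

  ≤-by : ∀ {a b} d → 0ℚ ≤ d → a + d ≡ b → a ≤ b
  ≤-by {a} d 0≤d eq = subst₂ _≤_ (ℚₚ.+-identityʳ a) eq (ℚₚ.+-monoʳ-≤ a 0≤d)

  *-nonNeg : ∀ {a b} → 0ℚ ≤ a → 0ℚ ≤ b → 0ℚ ≤ a * b
  *-nonNeg {a} {b} 0≤a 0≤b = subst (_≤ a * b) (ℚₚ.*-zeroʳ a)
    (ℚₚ.*-monoˡ-≤-nonNeg a {{ℚ.nonNegative 0≤a}} 0≤b)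

  +-nonNeg : ∀ {a b} → 0ℚ ≤ a → 0ℚ ≤ b → 0ℚ ≤ a + b
  +-nonNeg = ℚₚ.+-mono-≤

  *-monoˡ : ∀ {a b} c → 0ℚ ≤ c → a ≤ b → c * a ≤ c * b
  *-monoˡ c 0≤c = ℚₚ.*-monoˡ-≤-nonNeg c {{ℚ.nonNegative 0≤c}}

  *-monoʳ : ∀ {a b} c → 0ℚ ≤ c → a ≤ b → a * c ≤ b * c
  *-monoʳ c 0≤c = ℚₚ.*-monoʳ-≤-nonNeg c {{ℚ.nonNegative 0≤c}}

  *-mono : ∀ {a b c d} → 0ℚ ≤ b → 0ℚ ≤ c → a ≤ b → c ≤ d → a * c ≤ b * d
  *-mono {b = b} {c} 0≤b 0≤c a≤b c≤d = ℚₚ.≤-trans (*-monoʳ c 0≤c a≤b) (*-monoˡ b 0≤b c≤d)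

  *-cancelˡ : ∀ {a b} c → 0ℚ < c → c * a ≤ c * b → a ≤ b
  *-cancelˡ c 0<c = ℚₚ.*-cancelˡ-≤-pos c {{ℚ.positive 0<c}}

  0≤q-p : ∀ {p q} → p ≤ q → 0ℚ ≤ q - p
  0≤q-p {p} {q} p≤q = subst (_≤ q - p) (ℚₚ.+-inverseʳ p) (ℚₚ.+-monoˡ-≤ (- p) p≤q)

  1-x∈Unit : ∀ {x} → Unit x → Unit (1ℚ - x)
  1-x∈Unit {x} (0≤x , x≤1) = 0≤q-p x≤1 , ≤-by x 0≤x (solve 1 (λ x → (con 1ℚ :- x) :+ x := con 1ℚ) refl x)
    where open +-*-Solver

  ι-+ : ∀ m n → ι (m ℕ.+ n) ≡ ι m + ι n
  ι-+ zero    n = trans (sym (ℚₚ.+-identityˡ (ι n))) (cong (_+ ι n) (sym ι-0))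
  ι-+ (suc m) n = begin
    ι (suc (m ℕ.+ n))     ≡⟨ ι-suc (m ℕ.+ n) ⟩
    ι (m ℕ.+ n) + 1ℚ      ≡⟨ cong (_+ 1ℚ) (ι-+ m n) ⟩
    (ι m + ι n) + 1ℚ      ≡⟨ solve 3 (λ a b c → (a :+ b) :+ c := (a :+ c) :+ b) refl (ι m) (ι n) 1ℚ ⟩
    (ι m + 1ℚ) + ι n      ≡⟨ cong (_+ ι n) (sym (ι-suc m)) ⟩
    ι (suc m) + ι n       ∎
    where
    open ≡-Reasoning
    open +-*-Solver

  ι-* : ∀ m n → ι (m ℕ.* n) ≡ ι m * ι n
  ι-* zero    n = trans ι-0 (trans (sym (ℚₚ.*-zeroˡ (ι n))) (cong (_* ι n) (sym ι-0)))
  ι-* (suc m) n = begin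
    ι (n ℕ.+ m ℕ.* n)     ≡⟨ ι-+ n (m ℕ.* n) ⟩
    ι n + ι (m ℕ.* n)     ≡⟨ cong (ι n +_) (ι-* m n) ⟩
    ι n + ι m * ι n       ≡⟨ solve 2 (λ a b → b :+ a :* b := (a :+ con 1ℚ) :* b) refl (ι m) (ι n) ⟩
    (ι m + 1ℚ) * ι n      ≡⟨ cong (_* ι n) (sym (ι-suc m)) ⟩
    ι (suc m) * ι n       ∎
    where
    open ≡-Reasoning
    open +-*-Solver

  0≤ι : ∀ n → 0ℚ ≤ ι n
  0≤ι zero    = ℚₚ.≤-reflexive (sym ι-0)
  0≤ι (suc n) = subst (0ℚ ≤_) (sym (ι-suc n)) (+-nonNeg (0≤ι n) 0≤1)

  0<ι : ∀ {n} → 0 ℕ.< n → 0ℚ < ι n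
  0<ι {suc n} _ = subst (0ℚ <_) (sym (ι-suc n)) (ℚₚ.+-mono-≤-< (0≤ι n) (ℚₚ.positive⁻¹ 1ℚ))

  ι-mono : ∀ {m n} → m ℕ.≤ n → ι m ≤ ι n
  ι-mono {m} m≤n with ℕₚ.m≤n⇒∃[o]m+o≡n m≤n
  ... | o , refl = ≤-by (ι o) (0≤ι o) (sym (ι-+ m o))

  ι*1/suc : ∀ n → ι (suc n) * 1/suc n ≡ 1ℚ
  ι*1/suc n = trans (cong (_* 1/suc n) (ι-def (suc n))) (trans (sym (∑<-const (suc n) (1/suc n)))
    (trans (∑<-cong (suc n) (λ _ → cong 1/suc (sym (ℕₚ.+-identityʳ n)))) (∑<-split n 0)))

  ^-nonNeg : ∀ {x} n → 0ℚ ≤ x → 0ℚ ≤ x ^ n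
  ^-nonNeg zero    0≤x = 0≤1
  ^-nonNeg (suc n) 0≤x = *-nonNeg 0≤x (^-nonNeg n 0≤x)

  ^-mono : ∀ {x y} n → 0ℚ ≤ x → x ≤ y → x ^ n ≤ y ^ n
  ^-mono zero    0≤x x≤y = ℚₚ.≤-refl
  ^-mono (suc n) 0≤x x≤y =
    *-mono (ℚₚ.≤-trans 0≤x x≤y) (^-nonNeg n 0≤x) x≤y (^-mono n 0≤x x≤y)

  ^-≤1 : ∀ {x} n → 0ℚ ≤ x → x ≤ 1ℚ → x ^ n ≤ 1ℚ
  ^-≤1 zero    0≤x x≤1 = ℚₚ.≤-refl
  ^-≤1 {x} (suc n) 0≤x x≤1 = subst (x * x ^ n ≤_) (ℚₚ.*-identityˡ 1ℚ)
    (*-mono 0≤1 (^-nonNeg n 0≤x) x≤1 (^-≤1 n 0≤x x≤1))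

  ^-+ : ∀ x m n → x ^ (m ℕ.+ n) ≡ x ^ m * x ^ n
  ^-+ x zero    n = sym (ℚₚ.*-identityˡ (x ^ n))
  ^-+ x (suc m) n = trans (cong (x *_) (^-+ x m n)) (sym (ℚₚ.*-assoc x (x ^ m) (x ^ n)))

  ^-* : ∀ x m n → x ^ (n ℕ.* m) ≡ (x ^ m) ^ n
  ^-* x m zero    = refl
  ^-* x m (suc n) = trans (^-+ x m (n ℕ.* m)) (cong (x ^ m *_) (^-* x m n))

  ^-anti : ∀ {x m n} → 0ℚ ≤ x → x ≤ 1ℚ → m ℕ.≤ n → x ^ n ≤ x ^ m
  ^-anti {x} {m} 0≤x x≤1 m≤n with ℕₚ.m≤n⇒∃[o]m+o≡n m≤n
  ... | o , refl = subst₂ _≤_ (sym (^-+ x m o)) (ℚₚ.*-identityʳ (x ^ m))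
    (*-monoˡ (x ^ m) (^-nonNeg m 0≤x) (^-≤1 o 0≤x x≤1))

  bernoulli : ∀ {x} → 0ℚ ≤ x → x ≤ 1ℚ → ∀ n → 1ℚ - ι n * x ≤ (1ℚ - x) ^ n
  bernoulli {x} 0≤x x≤1 zero    = ℚₚ.≤-reflexive
    (trans (cong (λ k → 1ℚ - k * x) ι-0) (cong (λ y → 1ℚ - y) (ℚₚ.*-zeroˡ x)))
  bernoulli {x} 0≤x x≤1 (suc n) = ℚₚ.≤-trans
    (≤-by (ι n * (x * x)) (*-nonNeg (0≤ι n) (*-nonNeg 0≤x 0≤x))
      (trans (cong (λ k → 1ℚ - k * x + ι n * (x * x)) (ι-suc n))
        (solve 2 (λ x k → con 1ℚ :- (k :+ con 1ℚ) :* x :+ k :* (x :* x) := (con 1ℚ :- x) :* (con 1ℚ :- k :* x)) refl x (ι n))))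
    (*-monoˡ (1ℚ - x) (0≤q-p x≤1) (bernoulli 0≤x x≤1 n))
    where open +-*-Solver

  -- A rational substitute for (1 - x)ⁿ ≤ exp(- n x). The induction step discards a multiple of x².
  [1-x]^n[1+nx]≤1 : ∀ {x} → 0ℚ ≤ x → x ≤ 1ℚ → ∀ n → (1ℚ - x) ^ n * (1ℚ + ι n * x) ≤ 1ℚ
  [1-x]^n[1+nx]≤1 {x} 0≤x x≤1 zero = ℚₚ.≤-reflexive (trans (cong (λ k → 1ℚ * (1ℚ + k * x)) ι-0)
    (solve 1 (λ x → con 1ℚ :* (con 1ℚ :+ con 0ℚ :* x) := con 1ℚ) refl x))
    where open +-*-Solver
  [1-x]^n[1+nx]≤1 {x} 0≤x x≤1 (suc n) = ℚₚ.≤-trans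
    (≤-by (q * (ι (suc n) * (x * x))) (*-nonNeg (^-nonNeg n (0≤q-p x≤1)) (*-nonNeg (0≤ι (suc n)) (*-nonNeg 0≤x 0≤x)))
      (trans (cong (λ k → (1ℚ - x) * q * (1ℚ + k * x) + q * (k * (x * x))) (ι-suc n))
        (solve 3 (λ x k q → (con 1ℚ :- x) :* q :* (con 1ℚ :+ (k :+ con 1ℚ) :* x) :+ q :* ((k :+ con 1ℚ) :* (x :* x))
             := q :* (con 1ℚ :+ k :* x)) refl x (ι n) q)))
    ([1-x]^n[1+nx]≤1 0≤x x≤1 n)
    where
    open +-*-Solver
    q = (1ℚ - x) ^ n

  -- The counterpart of (1 + x)ⁿ ≤ exp(n x), informative only for n x < 1, where it bounds the power
  -- by 1 / (1 - n x).
  [1+x]^n[1-nx]≤1 : ∀ {x} → 0ℚ ≤ x → ∀ n → (1ℚ + x) ^ n * (1ℚ - ι n * x) ≤ 1ℚ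
  [1+x]^n[1-nx]≤1 {x} 0≤x zero = ℚₚ.≤-reflexive (trans (cong (λ k → 1ℚ * (1ℚ - k * x)) ι-0)
    (solve 1 (λ x → con 1ℚ :* (con 1ℚ :- con 0ℚ :* x) := con 1ℚ) refl x))
    where open +-*-Solver
  [1+x]^n[1-nx]≤1 {x} 0≤x (suc n) = ℚₚ.≤-trans
    (≤-by (q * (ι (suc n) * (x * x))) (*-nonNeg (^-nonNeg n (+-nonNeg 0≤1 0≤x)) (*-nonNeg (0≤ι (suc n)) (*-nonNeg 0≤x 0≤x)))
      (trans (cong (λ k → (1ℚ + x) * q * (1ℚ - k * x) + q * (k * (x * x))) (ι-suc n))
        (solve 3 (λ x k q → (con 1ℚ :+ x) :* q :* (con 1ℚ :- (k :+ con 1ℚ) :* x) :+ q :* ((k :+ con 1ℚ) :* (x :* x))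
             := q :* (con 1ℚ :- k :* x)) refl x (ι n) q)))
    ([1+x]^n[1-nx]≤1 0≤x n)
    where
    open +-*-Solver
    q = (1ℚ + x) ^ n

  0≤½ : 0ℚ ≤ ½
  0≤½ = ℚₚ.nonNegative⁻¹ ½

  ½≤1 : ½ ≤ 1ℚ
  ½≤1 = ≤-by ½ 0≤½ refl

  ι2^*½^ : ∀ n → ι (2 ℕ.^ n) * ½ ^ n ≡ 1ℚ
  ι2^*½^ zero    = cong (_* 1ℚ) ι-1
  ι2^*½^ (suc n) = trans (cong (_* (½ * ½ ^ n)) (trans (ι-* 2 (2 ℕ.^ n)) (cong (_* ι (2 ℕ.^ n)) ι-2)))
    (trans (solve 2 (λ a h → ((con 1ℚ :+ con 1ℚ) :* a) :* (con ½ :* h) := a :* h) refl (ι (2 ℕ.^ n)) (½ ^ n)) (ι2^*½^ n))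
    where open +-*-Solver

  n<2^n : ∀ n → n ℕ.< 2 ℕ.^ n
  n<2^n zero    = ℕ.s≤s ℕ.z≤n
  n<2^n (suc n) = ℕₚ.≤-trans (ℕ.s≤s (n<2^n n))
    (ℕₚ.≤-trans (ℕₚ.+-monoˡ-≤ (2 ℕ.^ n) (ℕₚ.≤-trans (ℕ.s≤s ℕ.z≤n) (n<2^n n)))
      (ℕₚ.≤-reflexive (cong (2 ℕ.^ n ℕ.+_) (sym (ℕₚ.+-identityʳ (2 ℕ.^ n))))))

  -- As 2ˢ > s, every s ≥ K (N + 1) satisfies K / 2ˢ ≤ 1 / (N + 1), and N comes from the Archimedean
  -- property.
  ½^-small : ∀ K ε → 0ℚ < ε → ∃ λ s₀ → ∀ s → s₀ ℕ.≤ s → ι K * ½ ^ s ≤ ε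
  ½^-small K ε 0<ε with archimedean ε 0<ε
  ... | N , 1/N≤ε = K ℕ.* suc N , λ s s≥ → ℚₚ.≤-trans
    (*-cancelˡ (ι (suc N)) (0<ι (ℕ.s≤s ℕ.z≤n)) (begin
      ι (suc N) * (ι K * ½ ^ s)
        ≡⟨ solve 3 (λ a b c → a :* (b :* c) := (b :* a) :* c) refl (ι (suc N)) (ι K) (½ ^ s) ⟩
      (ι K * ι (suc N)) * ½ ^ s
        ≡⟨ cong (_* ½ ^ s) (ι-* K (suc N)) ⟨
      ι (K ℕ.* suc N) * ½ ^ s
        ≤⟨ *-monoʳ (½ ^ s) (^-nonNeg s 0≤½) (ι-mono (ℕₚ.≤-trans s≥ (ℕₚ.<⇒≤ (n<2^n s)))) ⟩
      ι (2 ℕ.^ s) * ½ ^ s    ≡⟨ ι2^*½^ s ⟩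
      1ℚ                     ≡⟨ ι*1/suc N ⟨
      ι (suc N) * 1/suc N    ∎))
    1/N≤ε
    where
    open ℚₚ.≤-Reasoning
    open +-*-Solver

open RationalArithmetic

-- Rainbow k-sets of a fixed colouring.

module Counting where

  open import Data.Nat using (_+_; _*_; _≤_)
  open import Data.Nat.Solver using (module +-*-Solver)
  open import Algebra.Properties.CommutativeMonoid.Sum ℕₚ.+-0-commutativeMonoid
    using (sum; sum-cong-≗; sum-remove; ∑-distrib-+; sum-replicate-zero)

  T-does⁺ : ∀ {A : Set} (A? : Dec A) → A → T (does A?)
  T-does⁺ A? a = subst T (sym (dec-true A? a)) tt

  T-does⁻ : ∀ {A : Set} (A? : Dec A) → T (does A?) → A
  T-does⁻ (yes a) _ = a

  -- Matched elements are deleted from `ys` one at a time. A relation replaces an injection because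
  -- the partner `y` is often extracted from the proof of membership.
  length-≤ : ∀ {A B : Set} (R : A → B → Set) xs ys → Unique xs →
             (∀ {x} → x Mem.∈ xs → ∃ λ y → y Mem.∈ ys × R x y) →
             (∀ {x x′ y} → x Mem.∈ xs → x′ Mem.∈ xs → R x y → R x′ y → x ≡ x′) →
             length xs ≤ length ys
  length-≤ R []       ys _ total inj = z≤n
  length-≤ R (x ∷ xs) ys (x∉xs AllPairs.∷ u) total inj
    with y , y∈ , Rxy ← total (here refl)
    with as , bs , refl ← ∈-∃++ y∈ =
    subst (suc (length xs) ≤_) (sym len)
      (s≤s (length-≤ R xs (as ++ bs) u total′ (λ p q → inj (there p) (there q))))
    where
    len : length (as ++ y ∷ bs) ≡ suc (length (as ++ bs))
    len = trans (Listₚ.length-++ as) (trans (ℕₚ.+-suc (length as) (length bs)) (cong suc (sym (Listₚ.length-++ as))))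
    total′ : ∀ {x′} → x′ Mem.∈ xs → ∃ λ z → z Mem.∈ as ++ bs × R x′ z
    total′ x′∈ with total (there x′∈)
    ... | z , z∈ , Rx′z with ∈-++⁻ as z∈
    ... | inj₁ z∈as         = z , ∈-++⁺ˡ z∈as , Rx′z
    ... | inj₂ (there z∈bs) = z , ∈-++⁺ʳ as z∈bs , Rx′z
    ... | inj₂ (here refl)  =
      contradiction (inj (here refl) (there x′∈) Rxy Rx′z) (All.lookup x∉xs x′∈)

  length-cartesianProduct : ∀ {A B : Set} (xs : List A) (ys : List B) →
    length (cartesianProduct xs ys) ≡ length xs * length ys
  length-cartesianProduct []       ys = refl
  length-cartesianProduct (x ∷ xs) ys = trans (Listₚ.length-++ (map (x ,_) ys))
    (cong₂ _+_ (Listₚ.length-map (x ,_) ys) (length-cartesianProduct xs ys))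

  elements : ∀ {n} → Subset n → List (Fin n)
  elements []          = []
  elements (true ∷ e)  = zero ∷ map suc (elements e)
  elements (false ∷ e) = map suc (elements e)

  length-elements : ∀ {n} (e : Subset n) → length (elements e) ≡ ∣ e ∣
  length-elements []          = refl
  length-elements (true ∷ e)  = cong suc (trans (Listₚ.length-map suc (elements e)) (length-elements e))
  length-elements (false ∷ e) = trans (Listₚ.length-map suc (elements e)) (length-elements e)

  elements-unique : ∀ {n} (e : Subset n) → Unique (elements e)
  elements-unique []          = AllPairs.[]
  elements-unique (true ∷ e)  =
    Allₚ.map⁺ (All.tabulate (λ _ ())) AllPairs.∷ Uniqueₚ.map⁺ Finₚ.suc-injective (elements-unique e)
  elements-unique (false ∷ e) = Uniqueₚ.map⁺ Finₚ.suc-injective (elements-unique e)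

  ∈-elements⁺ : ∀ {n} {e : Subset n} {v} → v ∈ e → v Mem.∈ elements e
  ∈-elements⁺ {e = true ∷ e}  Vec.here       = here refl
  ∈-elements⁺ {e = true ∷ e}  (Vec.there v∈) = there (∈-map⁺ suc (∈-elements⁺ v∈))
  ∈-elements⁺ {e = false ∷ e} (Vec.there v∈) = ∈-map⁺ suc (∈-elements⁺ v∈)

  ∈-elements⁻ : ∀ {n} {e : Subset n} {v} → v Mem.∈ elements e → v ∈ e
  ∈-elements⁻ {e = true ∷ e}  (here refl) = Vec.here
  ∈-elements⁻ {e = true ∷ e}  (there v∈) with w , w∈ , refl ← ∈-map⁻ suc v∈ = Vec.there (∈-elements⁻ w∈)
  ∈-elements⁻ {e = false ∷ e} v∈         with w , w∈ , refl ← ∈-map⁻ suc v∈ = Vec.there (∈-elements⁻ w∈)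

  subsetOf : ∀ {n} {P : Fin n → Set} → Decidable P → Subset n
  subsetOf P? = tabulate (does ∘ P?)

  ∈-subsetOf⁺ : ∀ {n} {P : Fin n → Set} (P? : Decidable P) {v} → P v → v ∈ subsetOf P?
  ∈-subsetOf⁺ P? {v} Pv = lookup⇒[]= v _ (trans (lookup∘tabulate (does ∘ P?) v) (dec-true (P? v) Pv))

  ∈-subsetOf⁻ : ∀ {n} {P : Fin n → Set} (P? : Decidable P) {v} → v ∈ subsetOf P? → P v
  ∈-subsetOf⁻ P? {v} v∈ with P? v | trans (sym (lookup∘tabulate (does ∘ P?) v)) ([]=⇒lookup v∈)
  ... | yes Pv | _  = Pv
  ... | no _   | ()

  ⊆∧∣∣≡⇒≡ : ∀ {n} {p q : Subset n} → p ⊆ q → ∣ p ∣ ≡ ∣ q ∣ → p ≡ q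
  ⊆∧∣∣≡⇒≡ {p = p} {q} p⊆q eq = ⊆-antisym p⊆q q⊆p
    where
    q⊆p : q ⊆ p
    q⊆p {v} v∈q with v ∈? p
    ... | yes v∈p = v∈p
    ... | no  v∉p = contradiction eq (ℕₚ.<⇒≢ (p⊂q⇒∣p∣<∣q∣ (p⊆q , v , v∈q , v∉p)))

  module _ {k n : ℕ} where

    Rainbow : (Fin n → Fin k) → Subset n → Set
    Rainbow c e = ∀ j → j ∈image c of e

    rainbow? : ∀ c → Decidable (Rainbow c)
    rainbow? c e = Finₚ.all? λ j → Finₚ.any? λ v → (v ∈? e) ×-dec (c v Finₚ.≟ j)

    -- The image of a section s of c is described by its fixed-point equation s (c v) = v.
    transversal : (Fin n → Fin k) → (Fin k → Fin n) → Subset n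
    transversal c s = subsetOf (λ v → s (c v) Finₚ.≟ v)

    -- `c` and `s` restrict to mutually inverse bijections between the image of `s` and the colours.
    ∣transversal∣ : ∀ c s → (∀ l → c (s l) ≡ l) → ∣ transversal c s ∣ ≡ k
    ∣transversal∣ c s section = trans (sym (length-elements e)) (ℕₚ.≤-antisym
      (subst (length (elements e) ≤_) (Listₚ.length-tabulate id)
        (length-≤ (λ v l → c v ≡ l) (elements e) (allFin k) (elements-unique e)
          (λ {v} _ → c v , ∈-allFin (c v) , refl)
          (λ v∈ v′∈ eq eq′ → trans (sym (fixed v∈)) (trans (cong s (trans eq (sym eq′))) (fixed v′∈)))))
      (subst (_≤ length (elements e)) (Listₚ.length-tabulate id)
        (length-≤ (λ l v → s l ≡ v) (allFin k) (elements e) (Uniqueₚ.allFin⁺ k)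
          (λ {l} _ → s l , ∈-elements⁺ (∈-subsetOf⁺ P? (cong s (section l))) , refl)
          (λ {l} {l′} _ _ eq eq′ → trans (sym (section l)) (trans (cong c (trans eq (sym eq′))) (section l′))))))
      where
      P? = λ v → s (c v) Finₚ.≟ v
      e = transversal c s
      fixed : ∀ {v} → v Mem.∈ elements e → s (c v) ≡ v
      fixed = ∈-subsetOf⁻ P? ∘ ∈-elements⁻

    -- Choosing one vertex of `e` for each colour gives a transversal inside `e` that also has k
    -- elements, hence is all of `e`.
    rainbow-injective : ∀ c {e} → ∣ e ∣ ≡ k → Rainbow c e →
                        ∀ {v w} → v ∈ e → w ∈ e → c v ≡ c w → v ≡ w
    rainbow-injective c {e} ∣e∣≡k full v∈e w∈e eq = trans (sym (fixed v∈e)) (trans (cong s eq) (fixed w∈e))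
      where
      s : Fin k → Fin n
      s = proj₁ ∘ full
      P? = λ v → s (c v) Finₚ.≟ v
      ⊆e : transversal c s ⊆ e
      ⊆e {v} v∈ = subst (_∈ e) (∈-subsetOf⁻ P? v∈) (proj₁ (proj₂ (full (c v))))
      fixed : ∀ {v} → v ∈ e → s (c v) ≡ v
      fixed {v} v∈e = ∈-subsetOf⁻ P? (subst (v ∈_)
        (sym (⊆∧∣∣≡⇒≡ ⊆e (trans (∣transversal∣ c s (λ l → proj₂ (proj₂ (full l)))) (sym ∣e∣≡k)))) v∈e)

    -- Every colour but `τ` occurs at most once, so a rainbow edge can vary only in its vertex of
    -- colour `τ`.
    rainbow-unique : ∀ c (τ : Fin k) → (∀ v w → c v ≢ τ → c v ≡ c w → v ≡ w) →
                     ∀ {e e′ w} → ∣ e ∣ ≡ k → ∣ e′ ∣ ≡ k → Rainbow c e → Rainbow c e′ →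
                     w ∈ e → w ∈ e′ → c w ≡ τ → e ≡ e′
    rainbow-unique c τ single ∣e∣ ∣e′∣ full full′ w∈e w∈e′ cw≡τ =
      ⊆-antisym (sub ∣e∣ full full′ w∈e w∈e′) (sub ∣e′∣ full′ full w∈e′ w∈e)
      where
      sub : ∀ {e e′} → ∣ e ∣ ≡ k → Rainbow c e → Rainbow c e′ → _ ∈ e → _ ∈ e′ → e ⊆ e′
      sub {e} {e′} ∣e∣ full full′ w∈e w∈e′ {v} v∈e with c v Finₚ.≟ τ
      ... | yes cv≡τ = subst (_∈ e′) (rainbow-injective c ∣e∣ full w∈e v∈e (trans cw≡τ (sym cv≡τ))) w∈e′
      ... | no  cv≢τ = let u , u∈e′ , cu≡cv = full′ (c v) in
        subst (_∈ e′) (sym (single v u cv≢τ (sym cu≡cv))) u∈e′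

    class : (Fin n → Fin k) → Fin k → Subset n
    class c l = subsetOf (λ v → c v Finₚ.≟ l)

  count : {A : Set} → (A → Bool) → List A → ℕ
  count P xs = length (filterᵇ P xs)

  ∈-kSubsets⁻ : ∀ {k n} {e : Subset n} → e Mem.∈ kSubsets k n → ∣ e ∣ ≡ k
  ∈-kSubsets⁻ {k} {n} = proj₂ ∘ ∈-filter⁻ (λ e → ∣ e ∣ ℕ.≟ k) {xs = allSubsets n}

  ∈-filterᵇ⁻ : ∀ {A : Set} (P : A → Bool) {x} xs → x Mem.∈ filterᵇ P xs → x Mem.∈ xs × T (P x)
  ∈-filterᵇ⁻ P xs = ∈-filter⁻ (T? ∘ P) {xs = xs}

  -- Fixing representatives of the remaining colours, every pair in Cⱼ × Cᵢ extends to its own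
  -- rainbow edge.
  class*class≤rainbow : ∀ {k n} (c : Fin n → Fin k) → StrictlySurjective _≡_ c → ∀ {i j} → i ≢ j →
    ∣ class c j ∣ * ∣ class c i ∣ ≤ count (does ∘ rainbow? c) (kSubsets k n)
  class*class≤rainbow {k} {n} c surj {i} {j} i≢j = subst (_≤ length rainbows) len
    (length-≤ R pairs rainbows
      (Uniqueₚ.cartesianProduct⁺ (elements-unique (class c j)) (elements-unique (class c i)))
      (λ p∈ → let u∈ , w∈ = split p∈ in _ , edge-∈ u∈ w∈ , refl)
      (λ p∈ p′∈ eq eq′ → let u∈ , w∈ = split p∈ ; u′∈ , w′∈ = split p′∈ ; e≡ = trans eq (sym eq′) in
         cong₂ _,_ (fst-unique u∈ u′∈ e≡) (snd-unique w∈ w′∈ e≡)))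
    where
    rainbows : List (Subset n)
    rainbows = filterᵇ (does ∘ rainbow? c) (kSubsets k n)
    pairs : List (Fin n × Fin n)
    pairs = cartesianProduct (elements (class c j)) (elements (class c i))
    len : length pairs ≡ ∣ class c j ∣ * ∣ class c i ∣
    len = trans (length-cartesianProduct (elements (class c j)) (elements (class c i)))
      (cong₂ _*_ (length-elements (class c j)) (length-elements (class c i)))
    s : Fin n → Fin n → Fin k → Fin n
    s u w l with l Finₚ.≟ j | l Finₚ.≟ i
    ... | yes _ | _     = u
    ... | no _  | yes _ = w
    ... | no _  | no _  = proj₁ (surj l)
    s-section : ∀ {u w} → c u ≡ j → c w ≡ i → ∀ l → c (s u w l) ≡ l
    s-section cu cw l with l Finₚ.≟ j | l Finₚ.≟ i
    ... | yes l≡j | _       = trans cu (sym l≡j)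
    ... | no _    | yes l≡i = trans cw (sym l≡i)
    ... | no _    | no _    = proj₂ (surj l)
    s-j : ∀ u w → s u w j ≡ u
    s-j u w with j Finₚ.≟ j
    ... | yes _   = refl
    ... | no  j≢j = contradiction refl j≢j
    s-i : ∀ u w → s u w i ≡ w
    s-i u w with i Finₚ.≟ j | i Finₚ.≟ i
    ... | yes i≡j | _       = contradiction i≡j i≢j
    ... | no _    | yes _   = refl
    ... | no _    | no i≢i  = contradiction refl i≢i
    R : Fin n × Fin n → Subset n → Set
    R (u , w) e = transversal c (s u w) ≡ e
    split : ∀ {u w} → (u , w) Mem.∈ pairs → c u ≡ j × c w ≡ i
    split p∈ = let u∈ , w∈ = ∈-cartesianProduct⁻ (elements (class c j)) _ p∈ in
      ∈-subsetOf⁻ (λ v → c v Finₚ.≟ j) (∈-elements⁻ u∈) , ∈-subsetOf⁻ (λ v → c v Finₚ.≟ i) (∈-elements⁻ w∈)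
    P? = λ u w v → s u w (c v) Finₚ.≟ v
    edge-∈ : ∀ {u w} → c u ≡ j → c w ≡ i → transversal c (s u w) Mem.∈ rainbows
    edge-∈ {u} {w} cu cw = ∈-filter⁺ (T? ∘ does ∘ rainbow? c)
      (∈-kSubsets _ (∣transversal∣ c (s u w) sec))
      (T-does⁺ (rainbow? c _) λ l → s u w l , ∈-subsetOf⁺ (P? u w) (cong (s u w) (sec l)) , sec l)
      where sec = s-section cu cw
    fst-unique : ∀ {u w u′ w′} → c u ≡ j → c u′ ≡ j → transversal c (s u w) ≡ transversal c (s u′ w′) → u ≡ u′
    fst-unique {u} {w} {u′} {w′} cu cu′ eq = trans (sym (∈-subsetOf⁻ (P? u′ w′) (subst (u ∈_) eq
      (∈-subsetOf⁺ (P? u w) (trans (cong (s u w) cu) (s-j u w))))))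
      (trans (cong (s u′ w′) cu) (s-j u′ w′))
    snd-unique : ∀ {u w u′ w′} → c w ≡ i → c w′ ≡ i → transversal c (s u w) ≡ transversal c (s u′ w′) → w ≡ w′
    snd-unique {u} {w} {u′} {w′} cw cw′ eq = trans (sym (∈-subsetOf⁻ (P? u′ w′) (subst (w ∈_) eq
      (∈-subsetOf⁺ (P? u w) (trans (cong (s u w) cw) (s-i u w))))))
      (trans (cong (s u′ w′) cw) (s-i u′ w′))

  indicator : ∀ {k} → Fin k → Fin k → ℕ
  indicator a l = if does (a Finₚ.≟ l) then 1 else 0

  sum-indicator : ∀ {k} (a : Fin k) → sum (indicator a) ≡ 1
  sum-indicator {suc k} zero    = cong suc (sum-replicate-zero k)
  sum-indicator {suc k} (suc a) = sum-indicator a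

  ∣class∣-suc : ∀ {k n} (c : Fin (suc n) → Fin k) l →
                ∣ class c l ∣ ≡ indicator (c zero) l + ∣ class (c ∘ suc) l ∣
  ∣class∣-suc c l with does (c zero Finₚ.≟ l)
  ... | true  = refl
  ... | false = refl

  sum-∣class∣ : ∀ {k} n (c : Fin n → Fin k) → sum (λ l → ∣ class c l ∣) ≡ n
  sum-∣class∣ {k} zero    c = sum-replicate-zero k
  sum-∣class∣ {k} (suc n) c = trans (sum-cong-≗ (∣class∣-suc c))
    (trans (∑-distrib-+ (indicator (c zero)) (λ l → ∣ class (c ∘ suc) l ∣))
      (cong₂ _+_ (sum-indicator (c zero)) (sum-∣class∣ n (c ∘ suc))))

  -- The number of vertices whose colour is not j.
  off : ∀ {k n} → Fin k → Vec (Fin k) n → ℕ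
  off j []      = 0
  off j (a ∷ v) = if does (a Finₚ.≟ j) then off j v else suc (off j v)

  ∣class∣+off : ∀ {k n} j (v : Vec (Fin k) n) → ∣ class (lookup v) j ∣ + off j v ≡ n
  ∣class∣+off j []      = refl
  ∣class∣+off j (a ∷ v) with does (a Finₚ.≟ j)
  ... | true  = cong suc (∣class∣+off j v)
  ... | false = trans (ℕₚ.+-suc ∣ class (lookup v) j ∣ (off j v)) (cong suc (∣class∣+off j v))

  pigeonhole : ∀ k (f : Fin (suc k) → ℕ) → ∃ λ j → sum f ≤ suc k * f j
  pigeonhole zero    f = zero , ℕₚ.≤-refl
  pigeonhole (suc k) f with pigeonhole k (f ∘ suc)
  ... | j , h with ℕₚ.≤-total (f zero) (f (suc j))
  ... | inj₁ ≤ = suc j , ℕₚ.+-mono-≤ ≤ h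
  ... | inj₂ ≥ = zero , ℕₚ.+-monoʳ-≤ (f zero) (ℕₚ.≤-trans h (ℕₚ.*-monoʳ-≤ (suc k) ≥))

  -- Let Cⱼ be the largest class and Cᵢ the largest of the others: |Cⱼ| ≥ n / k and |Cᵢ| ≥ t / k, so
  -- |Cⱼ| |Cᵢ| ≥ t n / k². Any integer `h` up to n / k² may stand for the quotient, and `j` does not
  -- depend on it.
  major-colour : ∀ {b n} (v : Vec (Fin (2 + b)) n) → StrictlySurjective _≡_ (lookup v) →
    ∃ λ j → 1 ≤ off j v × (∀ h → (2 + b) * (2 + b) * h ≤ n →
      off j v * h ≤ count (does ∘ rainbow? (lookup v)) (kSubsets (2 + b) n))
  major-colour {b} {n} v surj
    with j , n≤ ← pigeonhole (suc b) (λ l → ∣ class (lookup v) l ∣)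
    with i , t≤ ← pigeonhole b (F.removeAt (λ l → ∣ class (lookup v) l ∣) j) =
    j , 1≤t , λ h k²h≤n → ℕₚ.≤-trans (bound h k²h≤n)
      (class*class≤rainbow (lookup v) surj (Finₚ.punchInᵢ≢i j i))
    where
    k = 2 + b
    t = off j v
    size : Fin k → ℕ
    size l = ∣ class (lookup v) l ∣
    rest : sum (F.removeAt size j) ≡ t
    rest = ℕₚ.+-cancelˡ-≡ (size j) _ _
      (trans (sym (sum-remove {i = j} size)) (trans (sum-∣class∣ n (lookup v)) (sym (∣class∣+off j v))))
    1≤t : 1 ≤ t
    -- As k ≥ 2, there is a colour other than `j`, and surjectivity supplies a vertex that bears it.
    1≤t with w , eq ← surj (punchIn j zero) = ℕₚ.≤-trans
      (ℕₚ.≤-trans (s≤s z≤n) (x∈p⇒∣p-x∣<∣p∣ (∈-subsetOf⁺ (λ u → lookup v u Finₚ.≟ punchIn j zero) eq)))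
      (subst (size (punchIn j zero) ≤_) rest (ℕₚ.m≤m+n _ _))
    bound : ∀ h → k * k * h ≤ n → t * h ≤ size j * size (punchIn j i)
    bound h k²h≤n = ℕₚ.*-cancelˡ-≤ (k * k) (begin
      k * k * (t * h)                          ≡⟨ solve 3 (λ k t h → k :* k :* (t :* h) := t :* (k :* k :* h)) refl k t h ⟩
      t * (k * k * h)                          ≤⟨ ℕₚ.*-mono-≤ t≤′ (ℕₚ.≤-trans k²h≤n (subst (_≤ k * size j) (sum-∣class∣ n (lookup v)) n≤)) ⟩
      (k * size (punchIn j i)) * (k * size j)  ≡⟨ solve 3 (λ k x y → (k :* x) :* (k :* y) := k :* k :* (y :* x)) refl k (size (punchIn j i)) (size j) ⟩
      k * k * (size j * size (punchIn j i))    ∎)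
      where
      open ℕₚ.≤-Reasoning
      open +-*-Solver
      t≤′ : t ≤ k * size (punchIn j i)
      t≤′ = ℕₚ.≤-trans (subst (_≤ suc b * size (punchIn j i)) rest t≤) (ℕₚ.*-monoˡ-≤ (size (punchIn j i)) (ℕₚ.n≤1+n (suc b)))

open Counting

-- Expectations over independent edges, and their dependence on the edge probability.

module Expectation where

  open import Data.Rational using (_+_; _*_; _-_; -_; _≤_; _<_)
  open import Data.Rational.Solver using (module +-*-Solver)
  open import Algebra.Properties.CommutativeMonoid.Sum ℚₚ.+-0-commutativeMonoid
    using (sum; sum-cong-≗; ∑-comm)

  -- The expectation as a polynomial in `x`, meaningful for every rational: approximations of a real
  -- in [0,1] may leave the interval.
  E : ℚ → ∀ N → (Subset N → ℚ) → ℚ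
  E x zero    f = f []
  E x (suc N) f = x * E x N (f ∘ (true ∷_)) + (1ℚ - x) * E x N (f ∘ (false ∷_))

  module _ {x : ℚ} where

    open +-*-Solver

    E-cong : ∀ N {f g} → (∀ S → f S ≡ g S) → E x N f ≡ E x N g
    E-cong zero    f≡g = f≡g []
    E-cong (suc N) f≡g = cong₂ (λ a b → x * a + (1ℚ - x) * b)
      (E-cong N (f≡g ∘ (true ∷_))) (E-cong N (f≡g ∘ (false ∷_)))

    E-const : ∀ N c → E x N (λ _ → c) ≡ c
    E-const zero    c = refl
    E-const (suc N) c = trans (cong₂ (λ a b → x * a + (1ℚ - x) * b) (E-const N c) (E-const N c))
      (solve 2 (λ x c → x :* c :+ (con 1ℚ :- x) :* c := c) refl x c)

    E-+ : ∀ N f g → E x N (λ S → f S + g S) ≡ E x N f + E x N g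
    E-+ zero    f g = refl
    E-+ (suc N) f g = trans (cong₂ (λ a b → x * a + (1ℚ - x) * b) (E-+ N _ _) (E-+ N _ _))
      (solve 6 (λ x y a b c d → x :* (a :+ b) :+ y :* (c :+ d) := (x :* a :+ y :* c) :+ (x :* b :+ y :* d))
        refl x (1ℚ - x) _ _ _ _)

    E-- : ∀ N f g → E x N (λ S → f S - g S) ≡ E x N f - E x N g
    E-- zero    f g = refl
    E-- (suc N) f g = trans (cong₂ (λ a b → x * a + (1ℚ - x) * b) (E-- N _ _) (E-- N _ _))
      (solve 6 (λ x y a b c d → x :* (a :- b) :+ y :* (c :- d) := (x :* a :+ y :* c) :- (x :* b :+ y :* d))
        refl x (1ℚ - x) _ _ _ _)

    E-sum : ∀ N {k} (f : Fin k → Subset N → ℚ) → E x N (λ S → sum (λ i → f i S)) ≡ sum (λ i → E x N (f i))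
    E-sum N {zero}  f = E-const N 0ℚ
    E-sum N {suc k} f = trans (E-+ N (f zero) _) (cong (E x N (f zero) +_) (E-sum N (f ∘ suc)))

    E-mono : Unit x → ∀ N {f g} → (∀ S → f S ≤ g S) → E x N f ≤ E x N g
    E-mono _               zero    f≤g = f≤g []
    E-mono u@(0≤x , x≤1)   (suc N) f≤g = ℚₚ.+-mono-≤
      (*-monoˡ x 0≤x (E-mono u N (f≤g ∘ (true ∷_))))
      (*-monoˡ (1ℚ - x) (0≤q-p x≤1) (E-mono u N (f≤g ∘ (false ∷_))))

  sum-mono : ∀ {k} {f g : Fin k → ℚ} → (∀ i → f i ≤ g i) → sum f ≤ sum g
  sum-mono {zero}  f≤g = ℚₚ.≤-refl
  sum-mono {suc k} f≤g = ℚₚ.+-mono-≤ (f≤g zero) (sum-mono (f≤g ∘ suc))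

  sum-nonNeg : ∀ {k} {f : Fin k → ℚ} → (∀ i → 0ℚ ≤ f i) → 0ℚ ≤ sum f
  sum-nonNeg {zero}  0≤f = ℚₚ.≤-refl
  sum-nonNeg {suc k} 0≤f = +-nonNeg (0≤f zero) (sum-nonNeg (0≤f ∘ suc))

  term≤sum : ∀ {k} {f : Fin k → ℚ} → (∀ i → 0ℚ ≤ f i) → ∀ i → f i ≤ sum f
  term≤sum {suc k} {f} 0≤f zero    = ≤-by _ (sum-nonNeg (0≤f ∘ suc)) refl
  term≤sum {suc k} {f} 0≤f (suc i) = ℚₚ.≤-trans (term≤sum (0≤f ∘ suc) i)
    (≤-by (f zero) (0≤f zero) (ℚₚ.+-comm _ (f zero)))

  sum-const : ∀ k c → sum {k} (λ _ → c) ≡ ι k * c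
  sum-const zero    c = sym (trans (cong (_* c) ι-0) (ℚₚ.*-zeroˡ c))
  sum-const (suc k) c = trans (cong (c +_) (sum-const k c))
    (trans (solve 2 (λ c k → c :+ k :* c := (k :+ con 1ℚ) :* c) refl c (ι k)) (cong (_* c) (sym (ι-suc k))))
    where open +-*-Solver

  ∑ᶜ : ∀ {k} n → (Vec (Fin k) n → ℚ) → ℚ
  ∑ᶜ zero    f = f []
  ∑ᶜ (suc n) f = sum (λ a → ∑ᶜ n (f ∘ (a ∷_)))

  ∑ᶜ-mono : ∀ {k} n {f g : Vec (Fin k) n → ℚ} → (∀ v → f v ≤ g v) → ∑ᶜ n f ≤ ∑ᶜ n g
  ∑ᶜ-mono zero    f≤g = f≤g []
  ∑ᶜ-mono (suc n) f≤g = sum-mono (λ a → ∑ᶜ-mono n (f≤g ∘ (a ∷_)))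

  ∑ᶜ-nonNeg : ∀ {k} n {f : Vec (Fin k) n → ℚ} → (∀ v → 0ℚ ≤ f v) → 0ℚ ≤ ∑ᶜ n f
  ∑ᶜ-nonNeg zero    0≤f = 0≤f []
  ∑ᶜ-nonNeg (suc n) 0≤f = sum-nonNeg (λ a → ∑ᶜ-nonNeg n (0≤f ∘ (a ∷_)))

  term≤∑ᶜ : ∀ {k} n {f : Vec (Fin k) n → ℚ} → (∀ v → 0ℚ ≤ f v) → ∀ v → f v ≤ ∑ᶜ n f
  term≤∑ᶜ zero    0≤f []      = ℚₚ.≤-refl
  term≤∑ᶜ (suc n) 0≤f (a ∷ v) = ℚₚ.≤-trans (term≤∑ᶜ n (0≤f ∘ (a ∷_)) v)
    (term≤sum (λ a → ∑ᶜ-nonNeg n (0≤f ∘ (a ∷_))) a)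

  E-∑ᶜ : ∀ {x k} N n (f : Vec (Fin k) n → Subset N → ℚ) →
         E x N (λ S → ∑ᶜ n (λ v → f v S)) ≡ ∑ᶜ n (λ v → E x N (f v))
  E-∑ᶜ N zero    f = refl
  E-∑ᶜ N (suc n) f = trans (E-sum N (λ a S → ∑ᶜ n (λ v → f (a ∷ v) S)))
    (sum-cong-≗ (λ a → E-∑ᶜ N n (f ∘ (a ∷_))))

  ∑ᶜ-sum : ∀ {k m} n (f : Fin m → Vec (Fin k) n → ℚ) →
           ∑ᶜ n (λ v → sum (λ j → f j v)) ≡ sum (λ j → ∑ᶜ n (f j))
  ∑ᶜ-sum         zero    f = refl
  ∑ᶜ-sum {k} {m} (suc n) f = trans (sum-cong-≗ (λ a → ∑ᶜ-sum n (λ j → f j ∘ (a ∷_))))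
    (∑-comm (λ a j → ∑ᶜ n (f j ∘ (a ∷_))))

  ind : Bool → ℚ
  ind true  = 1ℚ
  ind false = 0ℚ

  0≤ind : ∀ b → 0ℚ ≤ ind b
  0≤ind true  = 0≤1
  0≤ind false = ℚₚ.≤-refl

  ind≤1 : ∀ b → ind b ≤ 1ℚ
  ind≤1 true  = ℚₚ.≤-refl
  ind≤1 false = 0≤1

  ind-∧ : ∀ a b → ind (a ∧ b) ≡ ind a * ind b
  ind-∧ true  b = sym (ℚₚ.*-identityˡ (ind b))
  ind-∧ false b = sym (ℚₚ.*-zeroˡ (ind b))

  module _ {A : Set} where

    avoid : (A → Bool) → (L : List A) → Subset (length L) → Bool
    avoid P []      []      = true
    avoid P (a ∷ L) (b ∷ S) = not (b ∧ P a) ∧ avoid P L S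

    avoid-∨ : ∀ P R L S → avoid (λ a → P a ∨ R a) L S ≡ avoid P L S ∧ avoid R L S
    avoid-∨ P R []      []          = refl
    avoid-∨ P R (a ∷ L) (false ∷ S) = avoid-∨ P R L S
    avoid-∨ P R (a ∷ L) (true ∷ S) with P a | R a
    ... | true  | _     = refl
    ... | false | false = avoid-∨ P R L S
    ... | false | true with avoid P L S
    ...   | true  = refl
    ...   | false = refl

    Disjoint : (A → Bool) → (A → Bool) → Set
    Disjoint P R = ∀ a → T (P a) → T (R a) → ⊥

    count-∨ : ∀ P R → Disjoint P R → ∀ L → count (λ a → P a ∨ R a) L ≡ count P L ℕ.+ count R L
    count-∨ P R disj []      = refl
    count-∨ P R disj (a ∷ L) with P a | R a | disj a
    ... | true  | false | _ = cong suc (count-∨ P R disj L)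
    ... | false | false | _ = count-∨ P R disj L
    ... | false | true  | _ = trans (cong suc (count-∨ P R disj L)) (sym (ℕₚ.+-suc (count P L) (count R L)))
    ... | true  | true  | d with () ← d tt tt

    -- Independence: each position satisfying `P` contributes a factor 1 - x, every other position a
    -- factor 1.
    E-avoid : ∀ x P L → E x (length L) (ind ∘ avoid P L) ≡ (1ℚ - x) ^ count P L
    E-avoid x P []      = refl
    E-avoid x P (a ∷ L) with P a
    ... | true  = trans (cong₂ (λ u w → x * u + (1ℚ - x) * w) (E-const (length L) 0ℚ) (E-avoid x P L))
      (trans (cong (_+ (1ℚ - x) * (1ℚ - x) ^ count P L) (ℚₚ.*-zeroʳ x)) (ℚₚ.+-identityˡ _))
    ... | false = trans (cong₂ (λ u w → x * u + (1ℚ - x) * w) (E-avoid x P L) (E-avoid x P L))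
      (solve 2 (λ x c → x :* c :+ (con 1ℚ :- x) :* c := c) refl x _)
      where open +-*-Solver

    hitAll : List (A → Bool) → (L : List A) → Subset (length L) → ℚ
    hitAll []       L S = 1ℚ
    hitAll (P ∷ Ps) L S = (1ℚ - ind (avoid P L S)) * hitAll Ps L S

    ∏hit : ℚ → List (A → Bool) → List A → ℚ
    ∏hit x []       L = 1ℚ
    ∏hit x (P ∷ Ps) L = (1ℚ - (1ℚ - x) ^ count P L) * ∏hit x Ps L

    -- The set D is kept general so that the expansion z_D (1 - z_P) = z_D - z_{D ∪ P}, where z_D
    -- indicates the event of avoiding D, stays within the statement.
    E-hitAll : ∀ x L D Ps → All (Disjoint D) Ps → AllPairs Disjoint Ps →
               E x (length L) (λ S → ind (avoid D L S) * hitAll Ps L S) ≡ (1ℚ - x) ^ count D L * ∏hit x Ps L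
    E-hitAll x L D [] _ _ = trans (E-cong (length L) (λ S → ℚₚ.*-identityʳ _))
      (trans (E-avoid x D L) (sym (ℚₚ.*-identityʳ _)))
    E-hitAll x L D (P ∷ Ps) (dP All.∷ dPs) (P∥Ps AllPairs.∷ pw) = begin
      E x N (λ S → z D S * ((1ℚ - z P S) * hitAll Ps L S))
        ≡⟨ E-cong N (λ S → trans
             (solve 3 (λ d p h → d :* ((con 1ℚ :- p) :* h) := d :* h :- (d :* p) :* h) refl (z D S) (z P S) (hitAll Ps L S))
             (cong (λ u → z D S * hitAll Ps L S - u * hitAll Ps L S)
               (trans (sym (ind-∧ (avoid D L S) (avoid P L S))) (cong ind (sym (avoid-∨ D P L S)))))) ⟩
      E x N (λ S → z D S * hitAll Ps L S - z D∪P S * hitAll Ps L S)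
        ≡⟨ E-- N _ _ ⟩
      E x N (λ S → z D S * hitAll Ps L S) - E x N (λ S → z D∪P S * hitAll Ps L S)
        ≡⟨ cong₂ _-_ (E-hitAll x L D Ps dPs pw) (E-hitAll x L D∪P Ps (All.zipWith disj-∨ (dPs , P∥Ps)) pw) ⟩
      q ^ count D L * ∏hit x Ps L - q ^ count D∪P L * ∏hit x Ps L
        ≡⟨ cong (λ u → q ^ count D L * ∏hit x Ps L - u * ∏hit x Ps L)
             (trans (cong (q ^_) (count-∨ D P dP L)) (^-+ q (count D L) (count P L))) ⟩
      q ^ count D L * ∏hit x Ps L - (q ^ count D L * q ^ count P L) * ∏hit x Ps L
        ≡⟨ solve 3 (λ d p h → d :* h :- (d :* p) :* h := d :* ((con 1ℚ :- p) :* h)) refl (q ^ count D L) (q ^ count P L) (∏hit x Ps L) ⟩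
      q ^ count D L * ∏hit x (P ∷ Ps) L ∎
      where
      open ≡-Reasoning
      open +-*-Solver
      N = length L
      q = 1ℚ - x
      z : (A → Bool) → Subset N → ℚ
      z R S = ind (avoid R L S)
      D∪P : A → Bool
      D∪P a = D a ∨ P a
      disj-∨ : ∀ {R} → Disjoint D R × Disjoint P R → Disjoint D∪P R
      disj-∨ (dD , dP) a t r with D a | dD a
      ... | true  | d = d tt r
      ... | false | _ = dP a t r

    0≤hitAll : ∀ Ps L S → 0ℚ ≤ hitAll Ps L S
    0≤hitAll []       L S = 0≤1
    0≤hitAll (P ∷ Ps) L S = *-nonNeg (0≤q-p (ind≤1 (avoid P L S))) (0≤hitAll Ps L S)

    hitAll≡1 : ∀ Ps L S → (∃ λ P → P Mem.∈ Ps × T (avoid P L S)) ⊎ hitAll Ps L S ≡ 1ℚ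
    hitAll≡1 []       L S = inj₂ refl
    hitAll≡1 (P ∷ Ps) L S with avoid P L S in eq | hitAll≡1 Ps L S
    ... | true  | _                    = inj₁ (P , here refl , subst T (sym eq) tt)
    ... | false | inj₁ (R , R∈ , av)   = inj₁ (R , there R∈ , av)
    ... | false | inj₂ h≡1             = inj₂ (cong ((1ℚ - 0ℚ) *_) h≡1)

    -- z_D - z_D ∏ (1 - z_P) is the indicator that `D` and at least one of the `Ps` are avoided;
    -- `E-avoid` and `E-hitAll` give its expectation exactly.
    avoid-some : ∀ {x} → Unit x → ∀ L D Ps (f : Subset (length L) → Bool) →
      All (Disjoint D) Ps → AllPairs Disjoint Ps →
      (∀ S {P} → P Mem.∈ Ps → T (avoid D L S) → T (avoid P L S) → T (f S)) →
      (1ℚ - x) ^ count D L * (1ℚ - ∏hit x Ps L) ≤ E x (length L) (ind ∘ f)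
    avoid-some {x} u L D Ps f dPs pw ok = subst (_≤ E x N (ind ∘ f)) eq (E-mono u N pointwise)
      where
      open +-*-Solver
      N = length L
      pointwise : ∀ S → ind (avoid D L S) - ind (avoid D L S) * hitAll Ps L S ≤ ind (f S)
      pointwise S with avoid D L S | ok S
      ... | false | _ = ℚₚ.≤-trans
        (ℚₚ.≤-reflexive (solve 1 (λ h → con 0ℚ :- con 0ℚ :* h := con 0ℚ) refl (hitAll Ps L S))) (0≤ind (f S))
      ... | true | ok′ with hitAll≡1 Ps L S
      ...   | inj₂ h≡1 = ℚₚ.≤-trans (ℚₚ.≤-reflexive (cong (λ h → 1ℚ - 1ℚ * h) h≡1)) (0≤ind (f S))
      ...   | inj₁ (P , P∈ , av) with f S | ok′ P∈ tt av
      ...     | true | _ = ≤-by (hitAll Ps L S) (0≤hitAll Ps L S)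
        (solve 1 (λ h → (con 1ℚ :- con 1ℚ :* h) :+ h := con 1ℚ) refl (hitAll Ps L S))
      eq : E x N (λ S → ind (avoid D L S) - ind (avoid D L S) * hitAll Ps L S)
         ≡ (1ℚ - x) ^ count D L * (1ℚ - ∏hit x Ps L)
      eq = trans (E-- N _ _) (trans (cong₂ _-_ (E-avoid x D L) (E-hitAll x L D Ps dPs pw))
        (solve 2 (λ d h → d :- d :* h := d :* (con 1ℚ :- h)) refl ((1ℚ - x) ^ count D L) (∏hit x Ps L)))

  4ℚ : ℚ
  4ℚ = (1ℚ + 1ℚ) + (1ℚ + 1ℚ)

  ∣+∣≤ : ∀ a b {c d} → ℚ.∣ a ∣ ≤ c → ℚ.∣ b ∣ ≤ d → ℚ.∣ a + b ∣ ≤ c + d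
  ∣+∣≤ a b h h′ = ℚₚ.≤-trans (ℚₚ.∣p+q∣≤∣p∣+∣q∣ a b) (ℚₚ.+-mono-≤ h h′)

  ∣*∣≤ : ∀ a b {c d} → 0ℚ ≤ c → ℚ.∣ a ∣ ≤ c → ℚ.∣ b ∣ ≤ d → ℚ.∣ a * b ∣ ≤ c * d
  ∣*∣≤ a b {c} {d} 0≤c h h′ = subst (_≤ c * d) (sym (ℚₚ.∣p*q∣≡∣p∣*∣q∣ a b)) (*-mono 0≤c (ℚₚ.0≤∣p∣ b) h h′)

  module _ {a b δ : ℚ} (b∈ : Unit b) (a-b : ℚ.∣ a - b ∣ ≤ δ) (δ≤1 : δ ≤ 1ℚ) where

    open +-*-Solver

    private
      0≤b = proj₁ b∈
      0≤1-b = 0≤q-p (proj₂ b∈)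
      0≤δ = ℚₚ.≤-trans (ℚₚ.0≤∣p∣ (a - b)) a-b
      2ℚ = 1ℚ + 1ℚ
      0≤2 : 0ℚ ≤ 2ℚ
      0≤2 = +-nonNeg 0≤1 0≤1
      ∣a∣≤2 : ℚ.∣ a ∣ ≤ 2ℚ
      ∣a∣≤2 = ℚₚ.≤-trans (∣p∣≤∣p-q∣+∣q∣ a b)
        (ℚₚ.+-mono-≤ (ℚₚ.≤-trans a-b δ≤1) (ℚₚ.≤-trans (ℚₚ.≤-reflexive (ℚₚ.0≤p⇒∣p∣≡p 0≤b)) (proj₂ b∈)))
      ∣1-a∣≤2 : ℚ.∣ 1ℚ - a ∣ ≤ 2ℚ
      ∣1-a∣≤2 = subst (λ t → ℚ.∣ t ∣ ≤ 2ℚ) (solve 2 (λ a b → (b :- a) :+ (con 1ℚ :- b) := con 1ℚ :- a) refl a b)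
        (∣+∣≤ (b - a) (1ℚ - b)
          (ℚₚ.≤-trans (ℚₚ.≤-reflexive (∣p-q∣-sym b a)) (ℚₚ.≤-trans a-b δ≤1))
          (ℚₚ.≤-trans (ℚₚ.≤-reflexive (ℚₚ.0≤p⇒∣p∣≡p 0≤1-b))
            (≤-by b 0≤b (solve 1 (λ b → (con 1ℚ :- b) :+ b := con 1ℚ) refl b))))

    -- Because δ ≤ 1, both |a| and |1 - a| are at most 2, so every coordinate costs a factor 2 + 2.
    ∣E∣≤ : ∀ N {f : Subset N → ℚ} → (∀ S → ℚ.∣ f S ∣ ≤ 1ℚ) → ℚ.∣ E a N f ∣ ≤ 4ℚ ^ N
    ∣E∣≤ zero    ∣f∣≤1 = ∣f∣≤1 []
    ∣E∣≤ (suc N) ∣f∣≤1 = ℚₚ.≤-trans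
      (∣+∣≤ (a * _) ((1ℚ - a) * _)
        (∣*∣≤ a _ 0≤2 ∣a∣≤2 (∣E∣≤ N (∣f∣≤1 ∘ (true ∷_))))
        (∣*∣≤ (1ℚ - a) _ 0≤2 ∣1-a∣≤2 (∣E∣≤ N (∣f∣≤1 ∘ (false ∷_)))))
      (ℚₚ.≤-reflexive (solve 2 (λ t p → t :* p :+ t :* p := (t :+ t) :* p) refl 2ℚ (4ℚ ^ N)))

    -- Weighting the differences of the two branches by b and 1 - b gives δ 4ᴺ by convexity; the
    -- change of weight (a - b)(X - X′) adds at most 2 δ 4ᴺ. The total 3 δ 4ᴺ is below δ 4ᴺ⁺¹.
    E-lipschitz : ∀ N {f : Subset N → ℚ} → (∀ S → ℚ.∣ f S ∣ ≤ 1ℚ) → ℚ.∣ E a N f - E b N f ∣ ≤ δ * 4ℚ ^ N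
    E-lipschitz zero {f} ∣f∣≤1 = subst (λ t → ℚ.∣ t ∣ ≤ δ * 1ℚ) (sym (ℚₚ.+-inverseʳ (f [])))
      (*-nonNeg 0≤δ 0≤1)
    E-lipschitz (suc N) {f} ∣f∣≤1 = subst (λ t → ℚ.∣ t ∣ ≤ δ * 4ℚ ^ suc N)
      (solve 6 (λ a b X X′ Y Y′ →
          (b :* (X :- Y) :+ (con 1ℚ :- b) :* (X′ :- Y′)) :+ (a :- b) :* (X :- X′)
        := (a :* X :+ (con 1ℚ :- a) :* X′) :- (b :* Y :+ (con 1ℚ :- b) :* Y′)) refl a b X X′ Y Y′)
      (ℚₚ.≤-trans
        (∣+∣≤ (b * (X - Y) + (1ℚ - b) * (X′ - Y′)) ((a - b) * (X - X′))
          (∣+∣≤ (b * (X - Y)) ((1ℚ - b) * (X′ - Y′))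
            (∣*∣≤ b (X - Y) 0≤b (ℚₚ.≤-reflexive (ℚₚ.0≤p⇒∣p∣≡p 0≤b)) (E-lipschitz N (∣f∣≤1 ∘ (true ∷_))))
            (∣*∣≤ (1ℚ - b) (X′ - Y′) 0≤1-b (ℚₚ.≤-reflexive (ℚₚ.0≤p⇒∣p∣≡p 0≤1-b)) (E-lipschitz N (∣f∣≤1 ∘ (false ∷_)))))
          (∣*∣≤ (a - b) (X - X′) 0≤δ a-b (ℚₚ.≤-trans (ℚₚ.∣p-q∣≤∣p∣+∣q∣ X X′)
            (ℚₚ.+-mono-≤ (∣E∣≤ N (∣f∣≤1 ∘ (true ∷_))) (∣E∣≤ N (∣f∣≤1 ∘ (false ∷_)))))))
        (≤-by (δ * p) (*-nonNeg 0≤δ (^-nonNeg N (+-nonNeg 0≤2 0≤2)))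
          (solve 3 (λ b δ p → (b :* (δ :* p) :+ (con 1ℚ :- b) :* (δ :* p)) :+ δ :* (p :+ p) :+ δ :* p
               := δ :* (((con 1ℚ :+ con 1ℚ) :+ (con 1ℚ :+ con 1ℚ)) :* p)) refl b δ p)))
      where
      p = 4ℚ ^ N
      X  = E a N (f ∘ (true ∷_))
      X′ = E a N (f ∘ (false ∷_))
      Y  = E b N (f ∘ (true ∷_))
      Y′ = E b N (f ∘ (false ∷_))

  ∑ˡ : ∀ {A : Set} → List A → (A → ℚ) → ℚ
  ∑ˡ []       f = 0ℚ
  ∑ˡ (a ∷ as) f = f a + ∑ˡ as f

  ∑ˡ-++ : ∀ {A : Set} (as bs : List A) f → ∑ˡ (as ++ bs) f ≡ ∑ˡ as f + ∑ˡ bs f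
  ∑ˡ-++ []       bs f = sym (ℚₚ.+-identityˡ _)
  ∑ˡ-++ (a ∷ as) bs f = trans (cong (f a +_) (∑ˡ-++ as bs f)) (sym (ℚₚ.+-assoc (f a) _ _))

  ∑ˡ-map : ∀ {A B : Set} c (g : A → B) as {f : B → ℚ} {f′ : A → ℚ} → (∀ a → f (g a) ≡ c * f′ a) →
           ∑ˡ (map g as) f ≡ c * ∑ˡ as f′
  ∑ˡ-map c g []       h = sym (ℚₚ.*-zeroʳ c)
  ∑ˡ-map c g (a ∷ as) h = trans (cong₂ _+_ (h a) (∑ˡ-map c g as h)) (sym (ℚₚ.*-distribˡ-+ c _ _))

  module _ (p : ℝ) (j : ℕ) where

    private
      x = seq p j

    E-weight : ∀ N f → ∑ˡ (allSubsets N) (λ S → seq (weight p S) j * f S) ≡ E x N f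
    E-weight zero    f = trans (ℚₚ.+-identityʳ _) (ℚₚ.*-identityˡ (f []))
    E-weight (suc N) f = trans (∑ˡ-++ (map (true ∷_) (allSubsets N)) _ _)
      (cong₂ _+_
        (trans (∑ˡ-map x (true ∷_) (allSubsets N) (λ S → ℚₚ.*-assoc x _ _)) (cong (x *_) (E-weight N _)))
        (trans (∑ˡ-map (1ℚ - x) (false ∷_) (allSubsets N) (λ S → ℚₚ.*-assoc (1ℚ - x) _ _)) (cong ((1ℚ - x) *_) (E-weight N _))))

    -- Real sums, products and differences act termwise on the sequences, so evaluating the
    -- polynomial commutes exactly with taking the `j`-th approximation.
    Pr-E : ∀ k n {A : Pred (Hypergraph k n) 0ℓ} (A? : Decidable A) →
           seq (Pr k n p A?) j ≡ E x (length (kSubsets k n)) (λ S → ind (does (A? (hypergraph S))))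
    Pr-E k n A? = trans (filtered (allSubsets N)) (E-weight N holds)
      where
      N = length (kSubsets k n)
      holds : Subset N → ℚ
      holds S = ind (does (A? (hypergraph S)))
      filtered : ∀ Ss → seq (∑ (map (weight p ∘ edges) (filter A? (map hypergraph Ss)))) j
                      ≡ ∑ˡ Ss (λ S → seq (weight p S) j * holds S)
      filtered []       = refl
      filtered (S ∷ Ss) with A? (hypergraph S)
      ... | yes _ = cong₂ _+_ (sym (ℚₚ.*-identityʳ (seq (weight p S) j))) (filtered Ss)
      ... | no _  = trans (filtered Ss)
        (sym (trans (cong (_+ rest) (ℚₚ.*-zeroʳ (seq (weight p S) j))) (ℚₚ.+-identityˡ rest)))
        where rest = ∑ˡ Ss (λ S → seq (weight p S) j * holds S)

open Expectation

-- First moment over all colourings.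

module FirstMoment where

  open import Data.Rational using (_+_; _*_; _-_; -_; _≤_; _<_)
  open import Data.Rational.Solver using (module +-*-Solver)
  open import Algebra.Properties.CommutativeMonoid.Sum ℚₚ.+-0-commutativeMonoid
    using (sum; sum-cong-≗; ∑-distrib-+; sum-replicate-zero)

  module _ {A : Set} where

    avoid⁺ : ∀ (P : A → Bool) L S → (∀ i → i ∈ S → ¬ T (P (List.lookup L i))) → T (avoid P L S)
    avoid⁺ P []      []          h = tt
    avoid⁺ P (a ∷ L) (false ∷ S) h = avoid⁺ P L S (λ i i∈ → h (suc i) (Vec.there i∈))
    avoid⁺ P (a ∷ L) (true ∷ S)  h with P a | h zero Vec.here
    ... | true  | ¬t = contradiction tt ¬t
    ... | false | _  = avoid⁺ P L S (λ i i∈ → h (suc i) (Vec.there i∈))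

    avoid⁻ : ∀ (P : A → Bool) L S → T (avoid P L S) → ∀ i → i ∈ S → ¬ T (P (List.lookup L i))
    avoid⁻ P (a ∷ L) (b ∷ S)    av zero    Vec.here       t with P a
    ... | true = av
    avoid⁻ P (a ∷ L) (false ∷ S) av (suc i) (Vec.there i∈) t = avoid⁻ P L S av i i∈ t
    avoid⁻ P (a ∷ L) (true ∷ S)  av (suc i) (Vec.there i∈) t with P a
    ... | false = avoid⁻ P L S av i i∈ t

  colourable : ∀ k n → Subset (length (kSubsets k n)) → Bool
  colourable k n S = does (rainbowFreeColourable? {k} {n} (hypergraph S))

  surjective? : ∀ {k n} (c : Fin n → Fin k) → Dec (StrictlySurjective _≡_ c)
  surjective? c = Finₚ.all? λ j → Finₚ.any? λ v → c v Finₚ.≟ j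

  T⇒ind≡1 : ∀ {b} → T b → ind b ≡ 1ℚ
  T⇒ind≡1 {true} _ = refl

  -- Union bound. The surjectivity indicator is essential: a colouring that misses a colour has no
  -- rainbow edge and would contribute 1.
  colourable≤∑ᶜ : ∀ {x} → Unit x → ∀ k n →
    E x (length (kSubsets k n)) (ind ∘ colourable k n) ≤
    ∑ᶜ n (λ v → ind (does (surjective? (lookup v))) * (1ℚ - x) ^ count (does ∘ rainbow? (lookup v)) (kSubsets k n))
  colourable≤∑ᶜ {x} u k n = subst (E x N (ind ∘ colourable k n) ≤_) eq (E-mono u N pointwise)
    where
    L = kSubsets k n
    N = length L
    term : Vec (Fin k) n → Subset N → ℚ
    term v S = ind (does (surjective? (lookup v))) * ind (avoid (does ∘ rainbow? (lookup v)) L S)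
    0≤term : ∀ S v → 0ℚ ≤ term v S
    0≤term S v = *-nonNeg (0≤ind (does (surjective? (lookup v)))) (0≤ind (avoid (does ∘ rainbow? (lookup v)) L S))
    pointwise : ∀ S → ind (colourable k n S) ≤ ∑ᶜ n (λ v → term v S)
    pointwise S with rainbowFreeColourable? {k} {n} (hypergraph S)
    ... | no _        = ∑ᶜ-nonNeg n (0≤term S)
    -- The colouring found is a function; `tabulate` turns it into one of the vectors over which
    -- `∑ᶜ` runs.
    ... | yes (c , h) with surj , rf ← RainbowFree-resp (hypergraph S) {c} {lookup (tabulate c)} (λ v → sym (lookup∘tabulate c v)) h =
      ℚₚ.≤-trans (ℚₚ.≤-reflexive (sym (cong₂ _*_
          (T⇒ind≡1 (T-does⁺ (surjective? (lookup v)) surj))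
          (T⇒ind≡1 (avoid⁺ _ L S λ i i∈ t → rf (List.lookup L i) (i , i∈ , refl) (T-does⁻ (rainbow? (lookup v) _) t))))))
        (term≤∑ᶜ n (0≤term S) v)
      where v = tabulate c
    E-term : ∀ v → E x N (term v) ≡ ind (does (surjective? (lookup v))) * (1ℚ - x) ^ count (does ∘ rainbow? (lookup v)) L
    E-term v with does (surjective? (lookup v))
    ... | true  = trans (E-cong N (λ S → ℚₚ.*-identityˡ (z S)))
      (trans (E-avoid x P L) (sym (ℚₚ.*-identityˡ ((1ℚ - x) ^ count P L))))
      where
      P = does ∘ rainbow? (lookup v)
      z = ind ∘ avoid P L
    ... | false = trans (E-cong N (λ S → ℚₚ.*-zeroˡ (z S)))
      (trans (E-const N 0ℚ) (sym (ℚₚ.*-zeroˡ ((1ℚ - x) ^ count P L))))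
      where
      P = does ∘ rainbow? (lookup v)
      z = ind ∘ avoid P L
    ∑ᶜ-cong : ∀ m {f g : Vec (Fin k) m → ℚ} → (∀ v → f v ≡ g v) → ∑ᶜ m f ≡ ∑ᶜ m g
    ∑ᶜ-cong zero    f≡g = f≡g []
    ∑ᶜ-cong (suc m) f≡g = sum-cong-≗ (λ a → ∑ᶜ-cong m (f≡g ∘ (a ∷_)))
    eq : E x N (λ S → ∑ᶜ n (λ v → term v S)) ≡ _
    eq = trans (E-∑ᶜ N n term) (∑ᶜ-cong n E-term)

  sum-ind : ∀ {k} (j : Fin k) X → sum (λ a → ind (does (a Finₚ.≟ j)) * X) ≡ X
  sum-ind {suc k} zero    X = trans (cong₂ _+_ (ℚₚ.*-identityˡ X)
    (trans (sum-cong-≗ {n = k} (λ _ → ℚₚ.*-zeroˡ X)) (sum-replicate-zero k))) (ℚₚ.+-identityʳ X)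
  sum-ind {suc k} (suc j) X = trans (cong₂ _+_ (ℚₚ.*-zeroˡ X) (sum-ind j X)) (ℚₚ.+-identityˡ X)

  ∑ᶜ-* : ∀ {k} n c (f : Vec (Fin k) n → ℚ) → ∑ᶜ n (λ v → c * f v) ≡ c * ∑ᶜ n f
  ∑ᶜ-* zero    c f = refl
  ∑ᶜ-* (suc n) c f = trans (sum-cong-≗ (λ a → ∑ᶜ-* n c (f ∘ (a ∷_)))) (sym (*-distribˡ-sum c (λ a → ∑ᶜ n (f ∘ (a ∷_)))))
    where
    *-distribˡ-sum : ∀ {k} c (f : Fin k → ℚ) → c * sum f ≡ sum (λ i → c * f i)
    *-distribˡ-sum {zero}  c f = ℚₚ.*-zeroʳ c
    *-distribˡ-sum {suc k} c f = trans (ℚₚ.*-distribˡ-+ c _ _) (cong (c * f zero +_) (*-distribˡ-sum c (f ∘ suc)))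

  -- The value 0 at exponent 0 removes the colouring constantly equal to j, whose term y⁰ = 1 would
  -- not be small.
  _^⁺_ : ℚ → ℕ → ℚ
  z ^⁺ zero  = 0ℚ
  z ^⁺ suc t = z ^ suc t

  module _ {k : ℕ} {y : ℚ} (0≤y : 0ℚ ≤ y) (j : Fin k) where

    open +-*-Solver

    private
      U = 1ℚ + ι k * y
      0≤U : 0ℚ ≤ U
      0≤U = +-nonNeg 0≤1 (*-nonNeg (0≤ι k) 0≤y)

    -- Every colour is charged `Y`, even `j`; this yields the factor k and with it the closed form
    -- `U`.
    sum-split : ∀ {g : Fin k → ℚ} X Y → 0ℚ ≤ X → 0ℚ ≤ Y →
                (∀ a → g a ≤ (if does (a Finₚ.≟ j) then X else Y)) → sum g ≤ X + ι k * Y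
    sum-split {g} X Y 0≤X 0≤Y h = ℚₚ.≤-trans (sum-mono h′) (ℚₚ.≤-reflexive
      (trans (∑-distrib-+ {n = k} (λ a → ind (does (a Finₚ.≟ j)) * X) (λ _ → Y)) (cong₂ _+_ (sum-ind j X) (sum-const k Y))))
      where
      h′ : ∀ a → g a ≤ ind (does (a Finₚ.≟ j)) * X + Y
      h′ a with does (a Finₚ.≟ j) | h a
      ... | true  | g≤ = ℚₚ.≤-trans g≤ (≤-by Y 0≤Y (cong (_+ Y) (sym (ℚₚ.*-identityˡ X))))
      ... | false | g≤ = ℚₚ.≤-trans g≤ (ℚₚ.≤-reflexive (sym (trans (cong (_+ Y) (ℚₚ.*-zeroˡ X)) (ℚₚ.+-identityˡ Y))))

    -- The sum factorises over the vertices: colour `j` contributes 1 and any other colour `y`.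
    ∑ᶜ-off : ∀ n → ∑ᶜ n (λ v → y ^ off j v) ≤ U ^ n
    ∑ᶜ-off zero    = ℚₚ.≤-refl
    ∑ᶜ-off (suc n) = ℚₚ.≤-trans (sum-split (U ^ n) (y * U ^ n) 0≤Uⁿ (*-nonNeg 0≤y 0≤Uⁿ) h)
      (ℚₚ.≤-reflexive (solve 3 (λ k y u → u :+ k :* (y :* u) := (con 1ℚ :+ k :* y) :* u) refl (ι k) y (U ^ n)))
      where
      0≤Uⁿ = ^-nonNeg n 0≤U
      h : ∀ a → ∑ᶜ n (λ v → y ^ off j (a ∷ v)) ≤ (if does (a Finₚ.≟ j) then U ^ n else y * U ^ n)
      h a with does (a Finₚ.≟ j)
      ... | true  = ∑ᶜ-off n
      ... | false = ℚₚ.≤-trans (ℚₚ.≤-reflexive (∑ᶜ-* n y _)) (*-monoˡ y 0≤y (∑ᶜ-off n))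

    -- The subtracted 1 is the colouring constantly equal to `j`. Once the first vertex avoids `j`
    -- the exponent is positive, and `∑ᶜ-off` bounds the rest.
    ∑ᶜ-off⁺ : ∀ n → ∑ᶜ n (λ v → y ^⁺ off j v) ≤ U ^ n - 1ℚ
    ∑ᶜ-off⁺ zero    = ℚₚ.≤-refl
    ∑ᶜ-off⁺ (suc n) = ℚₚ.≤-trans (sum-split (U ^ n - 1ℚ) (y * U ^ n) 0≤Uⁿ-1 (*-nonNeg 0≤y (^-nonNeg n 0≤U)) h)
      (ℚₚ.≤-reflexive (solve 3 (λ k y u → (u :- con 1ℚ) :+ k :* (y :* u) := (con 1ℚ :+ k :* y) :* u :- con 1ℚ) refl (ι k) y (U ^ n)))
      where
      0≤y^⁺ : ∀ t → 0ℚ ≤ y ^⁺ t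
      0≤y^⁺ zero    = ℚₚ.≤-refl
      0≤y^⁺ (suc t) = ^-nonNeg (suc t) 0≤y
      0≤Uⁿ-1 = ℚₚ.≤-trans (∑ᶜ-nonNeg n (λ v → 0≤y^⁺ (off j v))) (∑ᶜ-off⁺ n)
      h : ∀ a → ∑ᶜ n (λ v → y ^⁺ off j (a ∷ v)) ≤ (if does (a Finₚ.≟ j) then U ^ n - 1ℚ else y * U ^ n)
      h a with does (a Finₚ.≟ j)
      ... | true  = ∑ᶜ-off⁺ n
      ... | false = ℚₚ.≤-trans (ℚₚ.≤-reflexive (∑ᶜ-* n y _)) (*-monoˡ y 0≤y (∑ᶜ-off n))

  guard : ∀ {A : Set} (A? : Dec A) {x y} → 0ℚ ≤ y → (A → x ≤ y) → ind (does A?) * x ≤ y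
  guard (yes a) {x} {y} 0≤y x≤y = subst (_≤ y) (sym (ℚₚ.*-identityˡ x)) (x≤y a)
  guard (no _)  {x} {y} 0≤y _   = subst (_≤ y) (sym (ℚₚ.*-zeroˡ x)) 0≤y

  -- A colouring is charged to its major colour. That colour varies with the colouring, so the bound
  -- sums over all j, whence the outer factor k.
  first-moment : ∀ {x} → Unit x → ∀ b n h → let k = 2 ℕ.+ b in k ℕ.* k ℕ.* h ℕ.≤ n →
    E x (length (kSubsets k n)) (ind ∘ colourable k n) ≤ ι k * ((1ℚ + ι k * (1ℚ - x) ^ h) ^ n - 1ℚ)
  first-moment {x} u@(0≤x , x≤1) b n h k²h≤n = begin
    E x (length L) (ind ∘ colourable k n)          ≤⟨ colourable≤∑ᶜ u k n ⟩
    ∑ᶜ n (λ v → ind (does (surjective? (lookup v))) * q ^ count (does ∘ rainbow? (lookup v)) L)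
                                                   ≤⟨ ∑ᶜ-mono n bound ⟩
    ∑ᶜ n (λ v → sum (λ j → F j v))                 ≡⟨ ∑ᶜ-sum n F ⟩
    sum (λ j → ∑ᶜ n (F j))                         ≤⟨ sum-mono (λ j → ∑ᶜ-off⁺ 0≤y j n) ⟩
    sum {k} (λ _ → (1ℚ + ι k * y) ^ n - 1ℚ)        ≡⟨ sum-const k ((1ℚ + ι k * y) ^ n - 1ℚ) ⟩
    ι k * ((1ℚ + ι k * y) ^ n - 1ℚ)                ∎
    where
    open ℚₚ.≤-Reasoning
    k = 2 ℕ.+ b
    L = kSubsets k n
    q = 1ℚ - x
    y = q ^ h
    0≤q = 0≤q-p x≤1
    q≤1 = proj₂ (1-x∈Unit u)
    0≤y : 0ℚ ≤ y
    0≤y = ^-nonNeg h 0≤q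
    F : Fin k → Vec (Fin k) n → ℚ
    F j v = y ^⁺ off j v
    0≤F : ∀ v j → 0ℚ ≤ F j v
    0≤F v j with off j v
    ... | zero  = ℚₚ.≤-refl
    ... | suc t = ^-nonNeg (suc t) 0≤y
    bound : ∀ v → ind (does (surjective? (lookup v))) * q ^ count (does ∘ rainbow? (lookup v)) L ≤ sum (λ j → F j v)
    bound v = guard (surjective? (lookup v)) (sum-nonNeg (0≤F v)) λ surj →
      let j , 1≤t , count≥ = major-colour v surj in
      ℚₚ.≤-trans (ℚₚ.≤-trans (^-anti 0≤q q≤1 (count≥ h k²h≤n)) (y^t≤F 1≤t)) (term≤sum (0≤F v) j)
      where
      y^t≤F : ∀ {t} → 1 ℕ.≤ t → q ^ (t ℕ.* h) ≤ y ^⁺ t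
      y^t≤F {suc t} _ = ℚₚ.≤-reflexive (^-* q h (suc t))

open FirstMoment

-- Smallness of the first moment in the dense range.

module FirstMomentEstimate where

  open import Data.Rational using (_+_; _*_; _-_; -_; _≤_; _<_)
  open import Data.Rational.Solver using (module +-*-Solver)
  open import Data.Nat.Solver using () renaming (module +-*-Solver to ℕ-Solver)

  -- The quotient is at least 1, so the remainder, being below d, is at most r d.
  half-cover : ∀ n d → 0 ℕ.< d → d ℕ.≤ n → ∃ λ r → r ℕ.* d ℕ.≤ n × n ℕ.≤ 2 ℕ.* (r ℕ.* d)
  half-cover n d 0<d d≤n = r , m/n*n≤m n d , (begin
    n                      ≡⟨ m≡m%n+[m/n]*n n d ⟩
    n % d ℕ.+ r ℕ.* d      ≤⟨ ℕₚ.+-monoˡ-≤ (r ℕ.* d) (ℕₚ.<⇒≤ (m%n<n n d)) ⟩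
    d ℕ.+ r ℕ.* d          ≡⟨ cong (ℕ._+ r ℕ.* d) (ℕₚ.*-identityˡ d) ⟨
    1 ℕ.* d ℕ.+ r ℕ.* d    ≤⟨ ℕₚ.+-monoˡ-≤ (r ℕ.* d) (ℕₚ.*-monoˡ-≤ d (m≥n⇒m/n>0 d≤n)) ⟩
    r ℕ.* d ℕ.+ r ℕ.* d    ≡⟨ cong (r ℕ.* d ℕ.+_) (ℕₚ.+-identityʳ (r ℕ.* d)) ⟨
    2 ℕ.* (r ℕ.* d)        ∎)
    where
    open ℕₚ.≤-Reasoning
    instance _ = ℕ.>-nonZero 0<d
    r = n / d

  [1-x]^r≤½ : ∀ {x} → Unit x → ∀ r → 1ℚ ≤ ι r * x → (1ℚ - x) ^ r ≤ ½
  [1-x]^r≤½ {x} (0≤x , x≤1) r 1≤rx = begin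
    q                              ≡⟨ solve 1 (λ q → q := con ½ :* (q :* (con 1ℚ :+ con 1ℚ))) refl q ⟩
    ½ * (q * (1ℚ + 1ℚ))            ≤⟨ *-monoˡ ½ 0≤½ (ℚₚ.≤-trans
      (*-monoˡ q (^-nonNeg r (0≤q-p x≤1)) (ℚₚ.+-monoʳ-≤ 1ℚ 1≤rx)) ([1-x]^n[1+nx]≤1 0≤x x≤1 r)) ⟩
    ½ * 1ℚ                         ≡⟨⟩
    ½                              ∎
    where
    open ℚₚ.≤-Reasoning
    open +-*-Solver
    q = (1ℚ - x) ^ r

  -- The power is at most 1 / (1 - θ), and (1 - θ)(1 + 2θ) = 1 + θ (1 - 2θ) ≥ 1 for 0 ≤ θ ≤ ½.
  [1+u]^n≤1+2θ : ∀ {u θ} n → 0ℚ ≤ u → ι n * u ≤ θ → θ ≤ ½ → (1ℚ + u) ^ n ≤ 1ℚ + (θ + θ)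
  [1+u]^n≤1+2θ {u} {θ} n 0≤u nu≤θ θ≤½ = *-cancelˡ (1ℚ - θ) 0<1-θ (begin
    (1ℚ - θ) * V              ≤⟨ *-monoʳ V 0≤V (ℚₚ.+-monoʳ-≤ 1ℚ (ℚₚ.neg-antimono-≤ nu≤θ)) ⟩
    (1ℚ - ι n * u) * V        ≡⟨ ℚₚ.*-comm (1ℚ - ι n * u) V ⟩
    V * (1ℚ - ι n * u)        ≤⟨ [1+x]^n[1-nx]≤1 0≤u n ⟩
    1ℚ                        ≤⟨ ≤-by (θ * ((½ - θ) + (½ - θ))) (*-nonNeg 0≤θ (+-nonNeg (0≤q-p θ≤½) (0≤q-p θ≤½)))
      (solve 1 (λ t → con 1ℚ :+ t :* ((con ½ :- t) :+ (con ½ :- t)) := (con 1ℚ :- t) :* (con 1ℚ :+ (t :+ t))) refl θ) ⟩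
    (1ℚ - θ) * (1ℚ + (θ + θ)) ∎)
    where
    open ℚₚ.≤-Reasoning
    open +-*-Solver
    V = (1ℚ + u) ^ n
    0≤V = ^-nonNeg n (+-nonNeg 0≤1 0≤u)
    0≤θ = ℚₚ.≤-trans (*-nonNeg (0≤ι n) 0≤u) nu≤θ
    0<1-θ : 0ℚ < 1ℚ - θ
    0<1-θ = ℚₚ.<-≤-trans (ℚₚ.positive⁻¹ ½) (ℚₚ.+-monoʳ-≤ 1ℚ (ℚₚ.neg-antimono-≤ θ≤½))

  -- Each of the 17 s blocks of length r ≈ n / (17 s k²) at least halves (1 - x)ʰ, h = 17 s r, which
  -- therefore beats n ≤ 2^(16 s) by a factor 2ˢ.
  first-moment-small : ∀ {x} → Unit x → ∀ k n s → 1 ℕ.≤ k → 1 ℕ.≤ s →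
    17 ℕ.* s ℕ.* (k ℕ.* k) ℕ.≤ n → n ℕ.≤ 2 ℕ.^ (16 ℕ.* s) →
    ι (34 ℕ.* (k ℕ.* k) ℕ.* s) ≤ ι n * x → ι k * ½ ^ s ≤ ½ →
    ∃ λ h → k ℕ.* k ℕ.* h ℕ.≤ n × ι k * ((1ℚ + ι k * (1ℚ - x) ^ h) ^ n - 1ℚ) ≤ ι (2 ℕ.* (k ℕ.* k)) * ½ ^ s
  first-moment-small {x} unit@(0≤x , x≤1) k n s 1≤k 1≤s d≤n n≤ c≤nx θ≤½
    with r , rd≤n , n≤2rd ← half-cover n (17 ℕ.* s ℕ.* (k ℕ.* k))
      (ℕₚ.*-mono-≤ (ℕₚ.*-mono-≤ {1} {17} (s≤s z≤n) 1≤s) (ℕₚ.*-mono-≤ 1≤k 1≤k)) d≤n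
    = h ,
      subst (ℕ._≤ n)
        (ℕ-solve 3 (λ r s k → r ⊗ (ℕ-con 17 ⊗ s ⊗ (k ⊗ k)) ⊜ k ⊗ k ⊗ (ℕ-con 17 ⊗ s ⊗ r)) refl r s k)
        rd≤n ,
      (begin
      ι k * ((1ℚ + ι k * y) ^ n - 1ℚ)      ≤⟨ *-monoˡ (ι k) (0≤ι k) (ℚₚ.+-monoˡ-≤ (- 1ℚ) ([1+u]^n≤1+2θ n (*-nonNeg (0≤ι k) 0≤y) nu≤θ θ≤½)) ⟩
      ι k * (1ℚ + (θ + θ) - 1ℚ)            ≡⟨ solve 2 (λ k w → k :* (con 1ℚ :+ (k :* w :+ k :* w) :- con 1ℚ) := (con 1ℚ :+ con 1ℚ) :* (k :* k) :* w) refl (ι k) (½ ^ s) ⟩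
      (1ℚ + 1ℚ) * (ι k * ι k) * ½ ^ s      ≡⟨ cong (_* ½ ^ s) (trans (ι-* 2 (k ℕ.* k)) (cong₂ _*_ ι-2 (ι-* k k))) ⟨
      ι (2 ℕ.* (k ℕ.* k)) * ½ ^ s          ∎)
    where
    open ℚₚ.≤-Reasoning
    open +-*-Solver
    open ℕ-Solver using () renaming (solve to ℕ-solve; _:*_ to _⊗_; _:=_ to _⊜_; con to ℕ-con)
    h = 17 ℕ.* s ℕ.* r
    y = (1ℚ - x) ^ h
    0≤q = 0≤q-p x≤1
    0≤y = ^-nonNeg h 0≤q
    θ = ι k * ½ ^ s
    c = 34 ℕ.* (k ℕ.* k) ℕ.* s
    -- 34 is twice 17: rounding gives n ≤ 2 r (17 s k²) = c r, hence c ≤ n x ≤ c r x.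
    1≤rx : 1ℚ ≤ ι r * x
    1≤rx = *-cancelˡ (ι c) (0<ι (ℕₚ.*-mono-≤ (ℕₚ.*-mono-≤ {1} {34} (s≤s z≤n) (ℕₚ.*-mono-≤ 1≤k 1≤k)) 1≤s)) (begin
      ι c * 1ℚ              ≡⟨ ℚₚ.*-identityʳ (ι c) ⟩
      ι c                   ≤⟨ c≤nx ⟩
      ι n * x               ≤⟨ *-monoʳ x 0≤x (ι-mono n≤2rd) ⟩
      ι (2 ℕ.* (r ℕ.* (17 ℕ.* s ℕ.* (k ℕ.* k)))) * x
        ≡⟨ cong (λ m → ι m * x) (ℕ-solve 3 (λ r s k → ℕ-con 2 ⊗ (r ⊗ (ℕ-con 17 ⊗ s ⊗ (k ⊗ k))) ⊜ ℕ-con 34 ⊗ (k ⊗ k) ⊗ s ⊗ r) refl r s k) ⟩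
      ι (c ℕ.* r) * x       ≡⟨ cong (_* x) (ι-* c r) ⟩
      ι c * ι r * x         ≡⟨ ℚₚ.*-assoc (ι c) (ι r) x ⟩
      ι c * (ι r * x)       ∎)
    y≤ : y ≤ ½ ^ (17 ℕ.* s)
    y≤ = subst (_≤ ½ ^ (17 ℕ.* s)) (sym (^-* (1ℚ - x) r (17 ℕ.* s)))
      (^-mono (17 ℕ.* s) (^-nonNeg r 0≤q) ([1-x]^r≤½ unit r 1≤rx))
    ny≤ : ι n * y ≤ ½ ^ s
    ny≤ = begin
      ι n * y                                         ≤⟨ *-mono (0≤ι (2 ℕ.^ (16 ℕ.* s))) 0≤y (ι-mono n≤) y≤ ⟩
      ι (2 ℕ.^ (16 ℕ.* s)) * ½ ^ (17 ℕ.* s)           ≡⟨ cong (λ m → ι (2 ℕ.^ (16 ℕ.* s)) * ½ ^ m) (ℕₚ.+-comm s (16 ℕ.* s)) ⟩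
      ι (2 ℕ.^ (16 ℕ.* s)) * ½ ^ (16 ℕ.* s ℕ.+ s)     ≡⟨ cong (ι (2 ℕ.^ (16 ℕ.* s)) *_) (^-+ ½ (16 ℕ.* s) s) ⟩
      ι (2 ℕ.^ (16 ℕ.* s)) * (½ ^ (16 ℕ.* s) * ½ ^ s) ≡⟨ ℚₚ.*-assoc (ι (2 ℕ.^ (16 ℕ.* s))) (½ ^ (16 ℕ.* s)) (½ ^ s) ⟨
      ι (2 ℕ.^ (16 ℕ.* s)) * ½ ^ (16 ℕ.* s) * ½ ^ s   ≡⟨ cong (_* ½ ^ s) (ι2^*½^ (16 ℕ.* s)) ⟩
      1ℚ * ½ ^ s                                      ≡⟨ ℚₚ.*-identityˡ (½ ^ s) ⟩
      ½ ^ s                                           ∎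
    nu≤θ : ι n * (ι k * y) ≤ θ
    nu≤θ = begin
      ι n * (ι k * y)    ≡⟨ solve 3 (λ n k y → n :* (k :* y) := k :* (n :* y)) refl (ι n) (ι k) y ⟩
      ι k * (ι n * y)    ≤⟨ *-monoˡ (ι k) (0≤ι k) ny≤ ⟩
      θ                  ∎

open FirstMomentEstimate

-- Almost independent colourings for the sparse range.

module PrivateColourings where

  open import Data.Rational using (_+_; _*_; _-_; -_; _≤_; _<_)
  open import Data.Rational.Solver using (module +-*-Solver)

  -- The first b vertices receive private colours, vertex vᵢ among the next m receives colour 0,
  -- and all other vertices receive colour 1.
  module _ (b m r : ℕ) where

    private
      n k : ℕ
      n = b ℕ.+ (m ℕ.+ suc r)
      k = 2 ℕ.+ b
      L = kSubsets k n

    vertex : Fin m → Fin n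
    vertex i = b ↑ʳ (i ↑ˡ suc r)

    colouring : Fin m → Fin n → Fin k
    colouring i v with splitAt b v
    ... | inj₁ x = suc (suc x)
    ... | inj₂ y = if does (y Finₚ.≟ i ↑ˡ suc r) then 0F else 1F

    colouring-base : ∀ i x → colouring i (x ↑ˡ (m ℕ.+ suc r)) ≡ suc (suc x)
    colouring-base i x rewrite Finₚ.splitAt-↑ˡ b x (m ℕ.+ suc r) = refl

    colouring-rest : ∀ i y → y ≢ i ↑ˡ suc r → colouring i (b ↑ʳ y) ≡ 1F
    colouring-rest i y y≢ rewrite Finₚ.splitAt-↑ʳ b (m ℕ.+ suc r) y
      | dec-false (y Finₚ.≟ i ↑ˡ suc r) y≢ = refl

    colouring-vertex : ∀ i → colouring i (vertex i) ≡ 0F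
    colouring-vertex i rewrite Finₚ.splitAt-↑ʳ b (m ℕ.+ suc r) (i ↑ˡ suc r)
      | dec-true (i ↑ˡ suc r Finₚ.≟ i ↑ˡ suc r) refl = refl

    colouring-other : ∀ {i j} → i ≢ j → colouring i (vertex j) ≡ 1F
    colouring-other {i} {j} i≢j =
      colouring-rest i (j ↑ˡ suc r) (λ eq → i≢j (sym (Finₚ.↑ˡ-injective (suc r) j i eq)))

    colouring-surjective : ∀ i → StrictlySurjective _≡_ (colouring i)
    colouring-surjective i 0F            = vertex i , colouring-vertex i
    -- The `suc r` in the number of vertices guarantees a vertex that has colour 1 under every
    -- `colouring i`.
    colouring-surjective i 1F            = b ↑ʳ (m ↑ʳ zero) , colouring-rest i (m ↑ʳ zero) (↑ʳ≢↑ˡ zero i)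
      where
      ↑ʳ≢↑ˡ : ∀ y x → m ↑ʳ y ≢ x ↑ˡ suc r
      ↑ʳ≢↑ˡ y x eq with () ← trans (sym (Finₚ.splitAt-↑ʳ m (suc r) y)) (trans (cong (splitAt m) eq) (Finₚ.splitAt-↑ˡ m x (suc r)))
    colouring-surjective i (suc (suc x)) = x ↑ˡ (m ℕ.+ suc r) , colouring-base i x

    section : Fin m → Fin k → Fin n
    section i 0F            = vertex i
    -- A default value: colour 1 has no canonical vertex, and `section-colouring` excludes it.
    section i 1F            = vertex i
    section i (suc (suc x)) = x ↑ˡ (m ℕ.+ suc r)

    section-colouring : ∀ i v → colouring i v ≢ 1F → section i (colouring i v) ≡ v
    section-colouring i v ≢1 with splitAt b v in eq
    ... | inj₁ x = Finₚ.splitAt⁻¹-↑ˡ eq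
    ... | inj₂ y with y Finₚ.≟ i ↑ˡ suc r
    ...   | yes refl = Finₚ.splitAt⁻¹-↑ʳ eq
    ...   | no _     = contradiction refl ≢1

    colouring-single : ∀ i v w → colouring i v ≢ 1F → colouring i v ≡ colouring i w → v ≡ w
    colouring-single i v w ≢1 eq = trans (sym (section-colouring i v ≢1))
      (trans (cong (section i) eq) (section-colouring i w (≢1 ∘ trans eq)))

    Shared : Subset n → Set
    Shared e = ∃₂ λ i j → i ≢ j × Rainbow (colouring i) e × Rainbow (colouring j) e

    Private : Fin m → Subset n → Set
    Private i e = Rainbow (colouring i) e × ¬ ∃ λ j → i ≢ j × Rainbow (colouring j) e

    other? : ∀ i e → Dec (∃ λ j → i ≢ j × Rainbow (colouring j) e)
    other? i e = Finₚ.any? λ j → ¬? (i Finₚ.≟ j) ×-dec rainbow? (colouring j) e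

    shared? : Decidable Shared
    shared? e = Finₚ.any? λ i → Finₚ.any? λ j →
      ¬? (i Finₚ.≟ j) ×-dec (rainbow? (colouring i) e ×-dec rainbow? (colouring j) e)

    private? : ∀ i → Decidable (Private i)
    private? i e = rainbow? (colouring i) e ×-dec ¬? (other? i e)

    sharedᵇ : Subset n → Bool
    sharedᵇ e = does (shared? e)

    privateᵇ : Fin m → Subset n → Bool
    privateᵇ i e = does (private? i e)

    ∈-filterᵇ-L : ∀ {P : Subset n → Set} (P? : Decidable P) {e} → e Mem.∈ filterᵇ (does ∘ P?) L → ∣ e ∣ ≡ k × P e
    ∈-filterᵇ-L P? {e} e∈ = let e∈L , t = ∈-filterᵇ⁻ (does ∘ P?) L e∈ in ∈-kSubsets⁻ {k} {n} e∈L , T-does⁻ (P? e) t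

    vertex-∈ : ∀ {j e} → Rainbow (colouring j) e → vertex j ∈ e
    vertex-∈ {j} {e} full = let w , w∈e , cw≡0 = full 0F in
      subst (_∈ e) (trans (sym (section-colouring j w (λ cw≡1 → contradiction (trans (sym cw≡0) cw≡1) (λ ()))))
        (cong (section j) cw≡0)) w∈e

    -- An edge rainbow for both i and j contains `vertex j`, the only vertex that `colouring j`
    -- gives colour 0. Under `colouring i` this is the edge's vertex of colour 1, so the pair (i, j)
    -- determines the edge.
    count-shared : count sharedᵇ L ℕ.≤ m ℕ.* m
    count-shared = subst (count sharedᵇ L ℕ.≤_)
      (trans (length-cartesianProduct (allFin m) (allFin m)) (cong₂ ℕ._*_ (Listₚ.length-tabulate {n = m} id) (Listₚ.length-tabulate {n = m} id)))
      (length-≤ R (filterᵇ sharedᵇ L) (cartesianProduct (allFin m) (allFin m)) (Uniqueₚ.filter⁺ (T? ∘ sharedᵇ) (kSubsets-unique k n))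
        (λ e∈ → let _ , i , j , h = ∈-filterᵇ-L shared? e∈ in (i , j) , ∈-cartesianProduct⁺ (∈-allFin i) (∈-allFin j) , h)
        λ { {e} {e′} {i , j} e∈ e′∈ (i≢j , fi , fj) (_ , fi′ , fj′) →
          rainbow-unique (colouring i) 1F (colouring-single i)
            (proj₁ (∈-filterᵇ-L shared? e∈)) (proj₁ (∈-filterᵇ-L shared? e′∈)) fi fi′
            (vertex-∈ fj) (vertex-∈ fj′) (colouring-other i≢j) })
      where
      R : Subset n → Fin m × Fin m → Set
      R e (i , j) = i ≢ j × Rainbow (colouring i) e × Rainbow (colouring j) e

    -- By `rainbow-unique` such an edge is determined by its vertex of colour 1.
    count-private : ∀ i → count (privateᵇ i) L ℕ.≤ n
    count-private i = subst (count (privateᵇ i) L ℕ.≤_) (Listₚ.length-tabulate {n = n} id)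
      (length-≤ (λ e w → w ∈ e × colouring i w ≡ 1F) (filterᵇ (privateᵇ i) L) (allFin n) (Uniqueₚ.filter⁺ (T? ∘ privateᵇ i) (kSubsets-unique k n))
        (λ e∈ → let w , h = proj₁ (proj₂ (∈-filterᵇ-L (private? i) e∈)) 1F in w , ∈-allFin w , h)
        λ e∈ e′∈ (w∈e , cw≡1) (w∈e′ , _) →
          let ∣e∣ , f , _ = ∈-filterᵇ-L (private? i) e∈ ; ∣e′∣ , f′ , _ = ∈-filterᵇ-L (private? i) e′∈ in
          rainbow-unique (colouring i) 1F (colouring-single i) ∣e∣ ∣e′∣ f f′ w∈e w∈e′ cw≡1)

    privates : List (Subset n → Bool)
    privates = map privateᵇ (allFin m)

    shared-disjoint : All (Disjoint sharedᵇ) privates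
    shared-disjoint = Allₚ.map⁺ (All.tabulate {xs = allFin m} λ {i} _ e s p → disj i (T-does⁻ (shared? e) s) (T-does⁻ (private? i e) p))
      where
      disj : ∀ i {e} → Shared e → ¬ Private i e
      disj i (j , j′ , j≢j′ , fj , fj′) (_ , alone) with i Finₚ.≟ j
      ... | yes refl = alone (j′ , j≢j′ , fj′)
      ... | no  i≢j  = alone (j , i≢j , fj)

    privates-disjoint : AllPairs Disjoint privates
    privates-disjoint = AllPairsₚ.map⁺ (AllPairs.map
      (λ {i} {j} i≢j e p p′ → proj₂ (T-does⁻ (private? i e) p) (j , i≢j , proj₁ (T-does⁻ (private? j e) p′)))
      (Uniqueₚ.allFin⁺ m))

    avoid⇒colourable : ∀ S {P} → P Mem.∈ privates → T (avoid sharedᵇ L S) → T (avoid P L S) → T (colourable k n S)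
    avoid⇒colourable S P∈ avS avP with i , _ , refl ← ∈-map⁻ privateᵇ P∈ =
      T-does⁺ (rainbowFreeColourable? (hypergraph S)) (colouring i , colouring-surjective i , rainbow-free)
      where
      rainbow-free : ∀ e → e ∈E hypergraph S → ¬ Rainbow (colouring i) e
      -- An edge rainbow for `colouring i` is either shared or private to i, so the two avoided sets
      -- cover all of them.
      rainbow-free e (t , t∈S , refl) full with other? i e
      ... | yes (j , i≢j , f) = avoid⁻ sharedᵇ L S avS t t∈S (T-does⁺ (shared? e) (i , j , i≢j , full , f))
      ... | no  alone         = avoid⁻ (privateᵇ i) L S avP t t∈S (T-does⁺ (private? i e) (full , alone))

    ∏hit-≤ : ∀ {x} → Unit x → ∀ Ps → All (λ P → count P L ℕ.≤ n) Ps →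
             0ℚ ≤ ∏hit x Ps L × ∏hit x Ps L ≤ (1ℚ - (1ℚ - x) ^ n) ^ length Ps
    ∏hit-≤ u []       _ = 0≤1 , ℚₚ.≤-refl
    ∏hit-≤ {x} u@(0≤x , x≤1) (P ∷ Ps) (c≤n All.∷ cs≤n) with 0≤ , ≤^ ← ∏hit-≤ u Ps cs≤n =
      *-nonNeg 0≤factor 0≤ , *-mono (ℚₚ.≤-trans 0≤factor factor≤) 0≤ factor≤ ≤^
      where
      q≤1 = proj₂ (1-x∈Unit u)
      0≤q = 0≤q-p x≤1
      0≤factor = 0≤q-p (^-≤1 (count P L) 0≤q q≤1)
      factor≤ : 1ℚ - (1ℚ - x) ^ count P L ≤ 1ℚ - (1ℚ - x) ^ n
      factor≤ = ℚₚ.+-monoʳ-≤ 1ℚ (ℚₚ.neg-antimono-≤ (^-anti 0≤q q≤1 c≤n))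

    -- The first factor keeps all shared edges absent; the second lets some colouring lose all its
    -- private edges. Both decrease when the exact edge counts are replaced by m² and n.
    colourable-≥ : ∀ {x} → Unit x → (1ℚ - x) ^ (m ℕ.* m) * (1ℚ - (1ℚ - (1ℚ - x) ^ n) ^ m) ≤ E x (length L) (ind ∘ colourable k n)
    colourable-≥ {x} u@(0≤x , x≤1) = ℚₚ.≤-trans
      (*-mono (^-nonNeg (count sharedᵇ L) 0≤q) 0≤1-zᵐ (^-anti 0≤q q≤1 count-shared) (ℚₚ.+-monoʳ-≤ 1ℚ (ℚₚ.neg-antimono-≤ ∏≤)))
      (avoid-some u L sharedᵇ privates (colourable k n) shared-disjoint privates-disjoint avoid⇒colourable)
      where
      q≤1 = proj₂ (1-x∈Unit u)
      0≤q = 0≤q-p x≤1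
      z = 1ℚ - (1ℚ - x) ^ n
      z∈Unit : Unit z
      z∈Unit = 1-x∈Unit (^-nonNeg n 0≤q , ^-≤1 n 0≤q q≤1)
      0≤1-zᵐ = 0≤q-p (^-≤1 m (proj₁ z∈Unit) (proj₂ z∈Unit))
      ∏≤ : ∏hit x privates L ≤ z ^ m
      ∏≤ = subst (λ l → ∏hit x privates L ≤ z ^ l) (trans (Listₚ.length-map privateᵇ (allFin m)) (Listₚ.length-tabulate {n = m} id))
        (proj₂ (∏hit-≤ u privates (Allₚ.map⁺ (All.tabulate λ {i} _ → count-private i))))

open PrivateColourings

-- Choice of parameters in the sparse range.

module PrivateColouringsEstimate where

  open import Data.Rational using (_+_; _*_; _-_; -_; _≤_; _<_)
  open import Data.Rational.Solver using (module +-*-Solver)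
  open import Data.Nat.Solver using () renaming (module +-*-Solver to ℕ-Solver)

  ceil-cover : ∀ n d → 0 ℕ.< d → d ℕ.≤ n → ∃ λ r → n ℕ.≤ d ℕ.* r × d ℕ.* r ℕ.≤ 2 ℕ.* n
  ceil-cover n d 0<d d≤n = suc (n / d) , (begin
    n                      ≡⟨ m≡m%n+[m/n]*n n d ⟩
    n % d ℕ.+ n / d ℕ.* d  ≤⟨ ℕₚ.+-monoˡ-≤ (n / d ℕ.* d) (ℕₚ.<⇒≤ (m%n<n n d)) ⟩
    suc (n / d) ℕ.* d      ≡⟨ ℕₚ.*-comm (suc (n / d)) d ⟩
    d ℕ.* suc (n / d)      ∎) , (begin
    d ℕ.* suc (n / d)      ≡⟨ ℕₚ.*-comm d (suc (n / d)) ⟩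
    d ℕ.+ n / d ℕ.* d      ≤⟨ ℕₚ.+-mono-≤ d≤n (m/n*n≤m n d) ⟩
    n ℕ.+ n                ≡⟨ cong (n ℕ.+_) (ℕₚ.+-identityʳ n) ⟨
    2 ℕ.* n                ∎)
    where
    open ℕₚ.≤-Reasoning
    instance _ = ℕ.>-nonZero 0<d

  module _ {x : ℚ} (unit : Unit x) (n s : ℕ) (1≤s : 1 ℕ.≤ s)
           (a⁸≤n : (2 ℕ.^ s) ℕ.^ 8 ℕ.≤ n) (4nx≤s : ι (4 ℕ.* n) * x ≤ ι s) where

    open ℚₚ.≤-Reasoning
    open +-*-Solver
    open ℕ-Solver using () renaming (solve to ℕ-solve; _:*_ to _⊗_; _:=_ to _⊜_; con to ℕ-con)

    private
      0≤x = proj₁ unit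
      x≤1 = proj₂ unit
      a m : ℕ
      a = 2 ℕ.^ s
      -- With a = 2ˢ about n^{1/8}, this is m of order n^{1/4}, so that m w = a and m² = a⁴.
      m = a ℕ.* a
      w q : ℚ
      w = ½ ^ s
      q = 1ℚ - x
      0≤q = 0≤q-p x≤1
      q≤1 = proj₂ (1-x∈Unit unit)
      0≤w = ^-nonNeg s 0≤½
      w≤1 = ^-≤1 s 0≤½ ½≤1
      0<a : 0 ℕ.< a
      0<a = ℕₚ.≤-trans (s≤s z≤n) (n<2^n s)

      aw≡1 : ι a * w ≡ 1ℚ
      aw≡1 = ι2^*½^ s

      a^-mono : ∀ {i j} → i ℕ.≤ j → a ℕ.^ i ℕ.≤ a ℕ.^ j
      a^-mono = ℕₚ.^-monoʳ-≤ a {{ℕ.>-nonZero 0<a}}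

      s≤n : s ℕ.≤ n
      s≤n = ℕₚ.≤-trans (ℕₚ.<⇒≤ (n<2^n s)) (ℕₚ.≤-trans (ℕₚ.≤-reflexive (sym (ℕₚ.*-identityʳ a)))
        (ℕₚ.≤-trans (a^-mono {1} {8} (s≤s z≤n)) a⁸≤n))

      ≤w : ∀ {y} → ι a * y ≤ 1ℚ → y ≤ w
      ≤w {y} h = *-cancelˡ (ι a) (0<ι 0<a) (ℚₚ.≤-trans h (ℚₚ.≤-reflexive (sym aw≡1)))

      -- The exponent n is covered by s blocks of length r. Since s r ≤ 2 n and 4 n x ≤ s, each
      -- block has r x ≤ ½, and Bernoulli's inequality leaves at least one half per block.
      w≤qⁿ : w ≤ q ^ n
      w≤qⁿ with r , n≤sr , sr≤2n ← ceil-cover n s 1≤s s≤n = begin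
        ½ ^ s          ≤⟨ ^-mono s 0≤½ (ℚₚ.≤-trans half≤ (bernoulli 0≤x x≤1 r)) ⟩
        (q ^ r) ^ s    ≡⟨ ^-* q r s ⟨
        q ^ (s ℕ.* r)  ≤⟨ ^-anti 0≤q q≤1 n≤sr ⟩
        q ^ n          ∎
        where
        rx≤½ : ι r * x ≤ ½
        rx≤½ = *-cancelˡ (ι s) (0<ι 1≤s) (begin
          ι s * (ι r * x)                           ≡⟨ ℚₚ.*-assoc (ι s) (ι r) x ⟨
          ι s * ι r * x                             ≡⟨ cong (_* x) (ι-* s r) ⟨
          ι (s ℕ.* r) * x                           ≤⟨ *-monoʳ x 0≤x (ι-mono sr≤2n) ⟩
          ι (2 ℕ.* n) * x                           ≡⟨ solve 2 (λ t x → t :* x := con ½ :* ((con 1ℚ :+ con 1ℚ) :* t :* x)) refl (ι (2 ℕ.* n)) x ⟩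
          ½ * ((1ℚ + 1ℚ) * ι (2 ℕ.* n) * x)         ≡⟨ cong (λ t → ½ * (t * x)) (trans (cong (_* ι (2 ℕ.* n)) (sym ι-2)) (sym (ι-* 2 (2 ℕ.* n)))) ⟩
          ½ * (ι (2 ℕ.* (2 ℕ.* n)) * x)             ≡⟨ cong (λ t → ½ * (ι t * x)) (ℕₚ.*-assoc 2 2 n) ⟨
          ½ * (ι (4 ℕ.* n) * x)                     ≤⟨ *-monoˡ ½ 0≤½ 4nx≤s ⟩
          ½ * ι s                                   ≡⟨ ℚₚ.*-comm ½ (ι s) ⟩
          ι s * ½                                   ∎)
        half≤ : ½ ≤ 1ℚ - ι r * x
        half≤ = ≤-by (½ - ι r * x) (0≤q-p rx≤½)
          (solve 1 (λ t → con ½ :+ (con ½ :- t) := con 1ℚ :- t) refl (ι r * x))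

      -- From m w = a follows (1 - w)ᵐ ≤ 1 / (1 + a) ≤ w.
      [1-w]ᵐ≤w : (1ℚ - w) ^ m ≤ w
      [1-w]ᵐ≤w = ≤w (begin
        ι a * v               ≤⟨ *-monoʳ v 0≤v (≤-by {ι a} {1ℚ + ι a} 1ℚ 0≤1 (ℚₚ.+-comm (ι a) 1ℚ)) ⟩
        (1ℚ + ι a) * v        ≡⟨ cong (λ t → (1ℚ + t) * v) (sym mw≡a) ⟩
        (1ℚ + ι m * w) * v    ≡⟨ ℚₚ.*-comm (1ℚ + ι m * w) v ⟩
        v * (1ℚ + ι m * w)    ≤⟨ [1-x]^n[1+nx]≤1 0≤w w≤1 m ⟩
        1ℚ                    ∎)
        where
        v = (1ℚ - w) ^ m
        0≤v = ^-nonNeg m (0≤q-p w≤1)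
        mw≡a : ι m * w ≡ ι a
        mw≡a = trans (cong (_* w) (ι-* a a)) (trans (ℚₚ.*-assoc (ι a) (ι a) w)
          (trans (cong (ι a *_) aw≡1) (ℚₚ.*-identityʳ (ι a))))

      -- a² m² = a⁶ ≤ 4 n gives a² m² x ≤ s ≤ a; dividing by a² leaves 1 / a = w.
      m²x≤w : ι (m ℕ.* m) * x ≤ w
      m²x≤w = ≤w (*-cancelˡ (ι a) (0<ι 0<a) (begin
        ι a * (ι a * (ι (m ℕ.* m) * x))
          ≡⟨ solve 3 (λ a b x → a :* (a :* (b :* x)) := (a :* (a :* b)) :* x) refl (ι a) (ι (m ℕ.* m)) x ⟩
        (ι a * (ι a * ι (m ℕ.* m))) * x
          ≡⟨ cong (_* x) (trans (ι-* a (a ℕ.* (m ℕ.* m))) (cong (ι a *_) (ι-* a (m ℕ.* m)))) ⟨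
        ι (a ℕ.* (a ℕ.* (m ℕ.* m))) * x      ≤⟨ *-monoʳ x 0≤x (ι-mono a⁶≤4n) ⟩
        ι (4 ℕ.* n) * x                      ≤⟨ 4nx≤s ⟩
        ι s                                  ≤⟨ ι-mono (ℕₚ.<⇒≤ (n<2^n s)) ⟩
        ι a                                  ≡⟨ ℚₚ.*-identityʳ (ι a) ⟨
        ι a * 1ℚ                             ∎))
        where
        a⁶≤4n : a ℕ.* (a ℕ.* (m ℕ.* m)) ℕ.≤ 4 ℕ.* n
        a⁶≤4n = ℕₚ.≤-trans (ℕₚ.≤-reflexive (ℕ-solve 1 (λ a → a ⊗ (a ⊗ ((a ⊗ a) ⊗ (a ⊗ a))) ⊜
            a ⊗ (a ⊗ (a ⊗ (a ⊗ (a ⊗ (a ⊗ ℕ-con 1)))))) refl a))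
          (ℕₚ.≤-trans (a^-mono {6} {8} (s≤s (s≤s (s≤s (s≤s (s≤s (s≤s z≤n)))))))
            (ℕₚ.≤-trans a⁸≤n (ℕₚ.m≤m+n n _)))

    -- Each factor is at least 1 - w: the first by Bernoulli and `m²x≤w`, the second by `w≤qⁿ` and
    -- `[1-w]ᵐ≤w`.
    private-estimate : 1ℚ - (w + w) ≤ q ^ (m ℕ.* m) * (1ℚ - (1ℚ - q ^ n) ^ m)
    private-estimate = begin
      1ℚ - (w + w)             ≤⟨ ≤-by (w * w) (*-nonNeg 0≤w 0≤w)
        (solve 1 (λ w → (con 1ℚ :- (w :+ w)) :+ w :* w := (con 1ℚ :- w) :* (con 1ℚ :- w)) refl w) ⟩
      (1ℚ - w) * (1ℚ - w)      ≤⟨ *-mono (^-nonNeg (m ℕ.* m) 0≤q) (0≤q-p w≤1)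
        (ℚₚ.≤-trans (ℚₚ.+-monoʳ-≤ 1ℚ (ℚₚ.neg-antimono-≤ m²x≤w)) (bernoulli 0≤x x≤1 (m ℕ.* m)))
        (ℚₚ.+-monoʳ-≤ 1ℚ (ℚₚ.neg-antimono-≤ (ℚₚ.≤-trans
          (^-mono m (0≤q-p (^-≤1 n 0≤q q≤1)) (ℚₚ.+-monoʳ-≤ 1ℚ (ℚₚ.neg-antimono-≤ w≤qⁿ))) [1-w]ᵐ≤w))) ⟩
      q ^ (m ℕ.* m) * (1ℚ - (1ℚ - q ^ n) ^ m) ∎

open PrivateColouringsEstimate

-- Comparison of the logarithm with powers of two.

module Logarithm where

  open import Data.Rational using (_+_; _*_; _-_; -_; _≤_; _<_)
  open import Data.Rational.Solver using (module +-*-Solver)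

  lnSum-mono : ∀ {d e} m → d ℕ.≤ e → lnSum d m ≤ lnSum e m
  lnSum-mono {d} m d≤e with o , refl ← ℕₚ.m≤n⇒∃[o]m+o≡n d≤e =
    ≤-by (∑< (o ℕ.* M) (λ i → f (d ℕ.* M ℕ.+ i))) (0≤∑< (o ℕ.* M))
      (sym (trans (cong (λ l → ∑< l f) (ℕₚ.*-distribʳ-+ M d o)) (∑<-+ (d ℕ.* M) (o ℕ.* M) f)))
    where
    M = suc m
    f : ℕ → ℚ
    f i = 1/suc (M ℕ.+ i)
    0≤∑< : ∀ l → 0ℚ ≤ ∑< l (λ i → f (d ℕ.* M ℕ.+ i))
    0≤∑< zero    = ℚₚ.≤-refl
    0≤∑< (suc l) = +-nonNeg (0≤∑< l) (ℚₚ.<⇒≤ (0<1/suc (M ℕ.+ (d ℕ.* M ℕ.+ l))))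

  -- The terms of the Riemann sum for ln (2N) - ln N are N M in number and lie between
  -- 1/(2 N M) and 1/(N M).
  lnSum-double : ∀ N m → 0 ℕ.< N →
    ½ + lnSum (N ℕ.∸ 1) m ≤ lnSum (2 ℕ.* N ℕ.∸ 1) m × lnSum (2 ℕ.* N ℕ.∸ 1) m ≤ 1ℚ + lnSum (N ℕ.∸ 1) m
  lnSum-double (suc N) m _ =
    subst (½ + lnSum N m ≤_) (sym split) (subst (_≤ lnSum N m + block) (ℚₚ.+-comm (lnSum N m) ½) (ℚₚ.+-monoʳ-≤ (lnSum N m) ½≤block)) ,
    subst (_≤ 1ℚ + lnSum N m) (sym split) (subst (lnSum N m + block ≤_) (ℚₚ.+-comm (lnSum N m) 1ℚ) (ℚₚ.+-monoʳ-≤ (lnSum N m) block≤1))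
    where
    M = suc m
    f : ℕ → ℚ
    f i = 1/suc (M ℕ.+ i)
    -- `suc K` is the product of `suc N` and `M`. It is both the length of the block and the offset
    -- of its denominators, which therefore stay between `suc K` and `suc K₂`, twice as large.
    K = m ℕ.+ N ℕ.* M
    block = ∑< (suc K) (λ i → f (N ℕ.* M ℕ.+ i))
    split : lnSum (2 ℕ.* suc N ℕ.∸ 1) m ≡ lnSum N m + block
    split = trans (cong (λ l → ∑< l f) (trans (cong (λ t → (N ℕ.+ t) ℕ.* M) (ℕₚ.+-identityʳ (suc N)))
      (ℕₚ.*-distribʳ-+ M N (suc N)))) (∑<-+ (N ℕ.* M) (suc K) f)
    index : ∀ i → M ℕ.+ (N ℕ.* M ℕ.+ i) ≡ suc K ℕ.+ i
    index i = sym (ℕₚ.+-assoc M (N ℕ.* M) i)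
    block≤1 : block ≤ 1ℚ
    block≤1 = begin
      block                         ≤⟨ ∑<-mono (suc K) (λ i _ → 1/suc-anti (ℕₚ.≤-trans
                                         (ℕₚ.≤-trans (ℕₚ.n≤1+n K) (ℕₚ.m≤m+n (suc K) i)) (ℕₚ.≤-reflexive (sym (index i))))) ⟩
      ∑< (suc K) (λ _ → 1/suc K)    ≡⟨ trans (∑<-const (suc K) (1/suc K)) (cong (_* 1/suc K) (sym (ι-def (suc K)))) ⟩
      ι (suc K) * 1/suc K           ≡⟨ ι*1/suc K ⟩
      1ℚ                            ∎
      where open ℚₚ.≤-Reasoning
    K₂ = K ℕ.+ suc K
    ½≤block : ½ ≤ block
    ½≤block = begin
      ½                             ≡⟨ cong (½ *_) (ι*1/suc K₂) ⟨
      ½ * (ι (suc K₂) * 1/suc K₂)   ≡⟨ cong (λ t → ½ * (t * 1/suc K₂)) (ι-+ (suc K) (suc K)) ⟩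
      ½ * ((ι (suc K) + ι (suc K)) * 1/suc K₂)
        ≡⟨ solve 2 (λ a b → con ½ :* ((a :+ a) :* b) := a :* b) refl (ι (suc K)) (1/suc K₂) ⟩
      ι (suc K) * 1/suc K₂          ≡⟨ trans (∑<-const (suc K) (1/suc K₂)) (cong (_* 1/suc K₂) (sym (ι-def (suc K)))) ⟨
      ∑< (suc K) (λ _ → 1/suc K₂)   ≤⟨ ∑<-mono (suc K) (λ i i<K → 1/suc-anti (ℕₚ.≤-trans (ℕₚ.≤-reflexive (index i))
                                         (ℕₚ.≤-trans (ℕₚ.+-monoʳ-≤ (suc K) (ℕₚ.≤-pred i<K)) (ℕₚ.≤-reflexive (sym (ℕₚ.+-suc K K)))))) ⟩
      block                         ∎
      where
      open ℚₚ.≤-Reasoning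
      open +-*-Solver

  -- Each doubling adds between ½ and 1, uniformly in the mesh, so the bounds hold for every
  -- approximation and not only in the limit.
  lnSum-2^ : ∀ l m → ½ * ι l ≤ lnSum (2 ℕ.^ l ℕ.∸ 1) m × lnSum (2 ℕ.^ l ℕ.∸ 1) m ≤ ι l
  lnSum-2^ zero    m = ℚₚ.≤-reflexive (trans (cong (½ *_) ι-0) (ℚₚ.*-zeroʳ ½)) , ℚₚ.≤-reflexive (sym ι-0)
  lnSum-2^ (suc l) m with lo , hi ← lnSum-2^ l m | dlo , dhi ← lnSum-double (2 ℕ.^ l) m (ℕₚ.m^n>0 2 l) =
    ℚₚ.≤-trans (ℚₚ.≤-reflexive (trans (cong (½ *_) (ι-suc l)) (solve 1 (λ t → con ½ :* (t :+ con 1ℚ) := con ½ :+ con ½ :* t) refl (ι l))))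
      (ℚₚ.≤-trans (ℚₚ.+-monoʳ-≤ ½ lo) dlo) ,
    ℚₚ.≤-trans dhi (ℚₚ.≤-trans (ℚₚ.+-monoʳ-≤ 1ℚ hi) (ℚₚ.≤-reflexive (trans (ℚₚ.+-comm 1ℚ (ι l)) (sym (ι-suc l)))))
    where open +-*-Solver

  -- The scale s = ⌊log₂ n / 8⌋ measures ln n up to constant factors.
  scale-of : ∀ n → 1 ℕ.≤ n → ∃ λ s → 2 ℕ.^ (8 ℕ.* s) ℕ.≤ n × n ℕ.< 2 ℕ.^ (8 ℕ.* suc s)
  scale-of (suc zero)    _ = 0 , s≤s z≤n , ℕₚ.^-monoʳ-< 2 (s≤s (s≤s z≤n)) {0} {8} (s≤s z≤n)
  scale-of (suc (suc n)) _ with s , lo , hi ← scale-of (suc n) (s≤s z≤n) with suc (suc n) ℕ.<? 2 ℕ.^ (8 ℕ.* suc s)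
  ... | yes n< = s , ℕₚ.m≤n⇒m≤1+n lo , n<
  ... | no  n≮ = suc s , ℕₚ.≮⇒≥ n≮ , ℕₚ.≤-<-trans hi (ℕₚ.^-monoʳ-< 2 (s≤s (s≤s z≤n)) (ℕₚ.*-monoʳ-< 8 (ℕₚ.n<1+n (suc s))))

  scale-≥ : ∀ {n s} s₀ → 2 ℕ.^ (8 ℕ.* s₀) ℕ.≤ n → n ℕ.< 2 ℕ.^ (8 ℕ.* suc s) → s₀ ℕ.≤ s
  scale-≥ {n} {s} s₀ lo hi with s₀ ℕ.≤? s
  ... | yes s₀≤s = s₀≤s
  ... | no  s₀≰s with () ← ℕₚ.<-irrefl refl (ℕₚ.<-≤-trans hi
    (ℕₚ.≤-trans (ℕₚ.^-monoʳ-≤ 2 (ℕₚ.*-monoʳ-≤ 8 (ℕₚ.≰⇒> s₀≰s))) lo))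

  lnSum-bounds : ∀ n s m → 2 ℕ.^ (8 ℕ.* s) ℕ.≤ n → n ℕ.< 2 ℕ.^ (8 ℕ.* suc s) →
                 ι s ≤ lnSum (n ℕ.∸ 1) m × lnSum (n ℕ.∸ 1) m ≤ ι (8 ℕ.* suc s)
  lnSum-bounds n s m lo hi =
    ℚₚ.≤-trans s≤ (ℚₚ.≤-trans (proj₁ (lnSum-2^ (8 ℕ.* s) m)) (lnSum-mono m (ℕₚ.∸-monoˡ-≤ 1 lo))) ,
    ℚₚ.≤-trans (lnSum-mono m (ℕₚ.∸-monoˡ-≤ 1 (ℕₚ.<⇒≤ hi))) (proj₂ (lnSum-2^ (8 ℕ.* suc s) m))
    where
    s≤ : ι s ≤ ½ * ι (8 ℕ.* s)
    s≤ = ℚₚ.≤-trans (ℚₚ.≤-reflexive (trans (solve 1 (λ t → t := con ½ :* ((con 1ℚ :+ con 1ℚ) :* t)) refl (ι s))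
        (cong (½ *_) (trans (cong (_* ι s) (sym ι-2)) (sym (ι-* 2 s))))))
      (*-monoˡ ½ 0≤½ (ι-mono (ℕₚ.*-monoˡ-≤ s {2} {8} (s≤s (s≤s z≤n)))))
      where open +-*-Solver

open Logarithm

-- From rational estimates to limits of real probabilities.

module Threshold where

  open import Data.Rational using (_+_; _*_; _-_; -_; _≤_; _<_)
  open import Data.Rational.Solver using (module +-*-Solver)
  open import Data.Nat.Solver using () renaming (module +-*-Solver to ℕ-Solver)

  Eventually : (ℕ → Set) → Set
  Eventually P = ∃ λ N → ∀ n → N ℕ.≤ n → P n

  Eventually-× : ∀ {P Q : ℕ → Set} → Eventually P → Eventually Q → Eventually (λ n → P n × Q n)
  Eventually-× (M , p) (N , q) = M ℕ.⊔ N , λ n n≥ → p n (ℕₚ.m⊔n≤o⇒m≤o M N n≥) , q n (ℕₚ.m⊔n≤o⇒n≤o M N n≥)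

  common-lower : ∀ {a b} → 0ℚ < a → 0ℚ < b → ∃ λ c → 0ℚ < c × c ≤ a × c ≤ b
  common-lower {a} {b} 0<a 0<b with ℚₚ.≤-total a b
  ... | inj₁ a≤b = a , 0<a , ℚₚ.≤-refl , a≤b
  ... | inj₂ b≤a = b , 0<b , b≤a , ℚₚ.≤-refl

  clamp : ∀ q {δ} → 0ℚ ≤ δ → 0ℚ ≤ q + δ → q ≤ 1ℚ + δ → ∃ λ x → Unit x × ℚ.∣ q - x ∣ ≤ δ
  clamp q {δ} 0≤δ lo hi with ℚₚ.≤-total q 0ℚ | ℚₚ.≤-total q 1ℚ
  ... | inj₁ q≤0 | _        = 0ℚ , (ℚₚ.≤-refl , 0≤1) ,
    ∣p-q∣-bound (subst (q ≤_) (sym (ℚₚ.+-identityʳ δ)) (ℚₚ.≤-trans q≤0 0≤δ)) (subst (0ℚ ≤_) (ℚₚ.+-comm q δ) lo)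
  ... | inj₂ 0≤q | inj₁ q≤1 = q , (0≤q , q≤1) , subst (_≤ δ) (sym (cong ℚ.∣_∣ (ℚₚ.+-inverseʳ q))) 0≤δ
  ... | inj₂ 0≤q | inj₂ 1≤q = 1ℚ , (0≤1 , ℚₚ.≤-refl) ,
    ∣p-q∣-bound (subst (q ≤_) (ℚₚ.+-comm 1ℚ δ) hi) (≤-by (δ + (q - 1ℚ)) (+-nonNeg 0≤δ (0≤q-p 1≤q))
      (solve 2 (λ q δ → con 1ℚ :+ (δ :+ (q :- con 1ℚ)) := δ :+ q) refl q δ))
    where open +-*-Solver

  clamp-real : ∀ p → 0ℝ Defs.≤ p → p Defs.≤ 1ℝ → ∀ {δ} → 0ℚ < δ →
               Eventually (λ j → ∃ λ x → Unit x × ℚ.∣ seq p j - x ∣ ≤ δ)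
  clamp-real p 0≤p p≤1 {δ} 0<δ with N , h ← Eventually-× (0≤p δ 0<δ) (p≤1 δ 0<δ) =
    N , λ j j≥ → clamp (seq p j) (ℚₚ.<⇒≤ 0<δ) (ℚₚ.<⇒≤ (proj₁ (h j j≥))) (ℚₚ.<⇒≤ (proj₂ (h j j≥)))

  opaque
    E-colourable : ℚ → (k n : ℕ) → ℚ
    E-colourable x k n = E x (length (kSubsets k n)) (ind ∘ colourable k n)

    0≤E-colourable : ∀ {x} → Unit x → ∀ k n → 0ℚ ≤ E-colourable x k n
    0≤E-colourable {x} u k n = subst (_≤ E-colourable x k n) (E-const (length (kSubsets k n)) 0ℚ)
      (E-mono u (length (kSubsets k n)) (λ S → 0≤ind (colourable k n S)))

    E-colourable≤1 : ∀ {x} → Unit x → ∀ k n → E-colourable x k n ≤ 1ℚ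
    E-colourable≤1 {x} u k n = subst (E-colourable x k n ≤_) (E-const (length (kSubsets k n)) 1ℚ)
      (E-mono u (length (kSubsets k n)) (λ S → ind≤1 (colourable k n S)))

    E-colourable-first-moment : ∀ {x} → Unit x → ∀ b n h → let k = 2 ℕ.+ b in k ℕ.* k ℕ.* h ℕ.≤ n →
      E-colourable x k n ≤ ι k * ((1ℚ + ι k * (1ℚ - x) ^ h) ^ n - 1ℚ)
    E-colourable-first-moment = first-moment

    E-colourable-≥ : ∀ b m r {x} → Unit x → let n = b ℕ.+ (m ℕ.+ suc r) in
      (1ℚ - x) ^ (m ℕ.* m) * (1ℚ - (1ℚ - (1ℚ - x) ^ n) ^ m) ≤ E-colourable x (2 ℕ.+ b) n
    E-colourable-≥ b m r = colourable-≥ b m r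

    Pr-close : ∀ p j k n {x δ} → Unit x → ℚ.∣ seq p j - x ∣ ≤ δ → δ ≤ 1ℚ →
      ℚ.∣ seq (Pr k n p rainbowFreeColourable?) j - E-colourable x k n ∣ ≤ δ * 4ℚ ^ length (kSubsets k n)
    Pr-close p j k n {x} {δ} x∈ p-x≤δ δ≤1 =
      subst (λ t → ℚ.∣ t - E-colourable x k n ∣ ≤ δ * 4ℚ ^ length (kSubsets k n))
        (sym (Pr-E p j k n rainbowFreeColourable?))
        (E-lipschitz x∈ p-x≤δ δ≤1 (length (kSubsets k n)) λ S →
          ℚₚ.≤-trans (ℚₚ.≤-reflexive (ℚₚ.0≤p⇒∣p∣≡p (0≤ind (colourable k n S)))) (ind≤1 (colourable k n S)))

  0<4^ : ∀ m → 0ℚ < 4ℚ ^ m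
  0<4^ zero    = ℚₚ.positive⁻¹ 1ℚ
  0<4^ (suc m) = 0<* (ℚₚ.positive⁻¹ 4ℚ) (0<4^ m)

  Eventually-map : ∀ {P Q : ℕ → Set} → (∀ n → P n → Q n) → Eventually P → Eventually Q
  Eventually-map f (N , h) = N , λ n n≥ → f n (h n n≥)

  -- A positive real eventually exceeds a rational ε₀. Half of ε₀ bounds the distance, and the other
  -- half is the gap that strict inequality of reals demands.
  ⟶-criterion : ∀ {f : ℕ → ℝ} {L} →
    (∀ ε → 0ℚ < ε → Eventually λ n → Eventually λ j → ℚ.∣ seq (f n) j - L ∣ ≤ ε) → f ⟶ fromℚ L
  ⟶-criterion {f} {L} h ε (ε₀ , 0<ε₀ , N₀ , ε₀<ε) =
    Eventually-map (λ n near → ½ * ε₀ , half 0<ε₀ , Eventually-map (λ j → bound n j) (Eventually-× near (N₀ , ε₀<ε)))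
      (h (½ * ε₀) (half 0<ε₀))
    where
    bound : ∀ n j → ℚ.∣ seq (f n) j - L ∣ ≤ ½ * ε₀ × 0ℚ + ε₀ < seq ε j → ℚ.∣ seq (f n) j - L ∣ + ½ * ε₀ < seq ε j
    bound n j (near , ε₀<) = ℚₚ.≤-<-trans (ℚₚ.+-monoˡ-≤ (½ * ε₀) near)
      (subst (_< seq ε j) (trans (ℚₚ.+-identityˡ ε₀) (sym (half+half ε₀))) ε₀<)

  -- The tolerance δ may depend on n, so it can be shrunk until the Lipschitz constant 4ᴮ of the
  -- probability polynomial, B the number of k-sets, costs only half of ε.
  Pr⟶ : ∀ k (p : ℕ → ℝ) → (∀ n → 0ℝ Defs.≤ p n × p n Defs.≤ 1ℝ) → ∀ L →
    (∀ ε → 0ℚ < ε → Eventually λ n → ∃ λ δ → 0ℚ < δ × Eventually λ j →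
       ∀ x → Unit x → ℚ.∣ seq (p n) j - x ∣ ≤ δ → ℚ.∣ E-colourable x k n - L ∣ ≤ ε) →
    (λ n → Pr k n (p n) rainbowFreeColourable?) ⟶ fromℚ L
  Pr⟶ k p p∈ L close = ⟶-criterion {λ n → Pr k n (p n) rainbowFreeColourable?} {L} λ ε 0<ε → Eventually-map (near ε 0<ε) (close (½ * ε) (half 0<ε))
    where
    near : ∀ ε → 0ℚ < ε → ∀ n → (∃ λ δ → 0ℚ < δ × Eventually λ j →
             ∀ x → Unit x → ℚ.∣ seq (p n) j - x ∣ ≤ δ → ℚ.∣ E-colourable x k n - L ∣ ≤ ½ * ε) →
           Eventually λ j → ℚ.∣ seq (Pr k n (p n) rainbowFreeColourable?) j - L ∣ ≤ ε
    near ε 0<ε n (δ , 0<δ , h) =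
      let B = length (kSubsets k n)
          η , 0<η , Bη≡           = quotient {4ℚ ^ B} {½ * ε} (0<4^ B) (half 0<ε)
          δ₁ , 0<δ₁ , δ₁≤δ , δ₁≤η = common-lower 0<δ 0<η
          δ₂ , 0<δ₂ , δ₂≤δ₁ , δ₂≤1 = common-lower 0<δ₁ (ℚₚ.positive⁻¹ 1ℚ)
      in Eventually-map (λ { j (h , x , x∈ , p-x≤δ₂) → bound (seq (Pr k n (p n) rainbowFreeColourable?) j) (E-colourable x k n)
           (ℚₚ.≤-trans (Pr-close (p n) j k n x∈ p-x≤δ₂ δ₂≤1) (ℚₚ.≤-trans
             (*-monoʳ (4ℚ ^ B) (ℚₚ.<⇒≤ (0<4^ B)) (ℚₚ.≤-trans δ₂≤δ₁ δ₁≤η))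
             (ℚₚ.≤-reflexive (trans (ℚₚ.*-comm η (4ℚ ^ B)) Bη≡))))
           (h x x∈ (ℚₚ.≤-trans p-x≤δ₂ (ℚₚ.≤-trans δ₂≤δ₁ δ₁≤δ))) })
         (Eventually-× h (clamp-real (p n) (proj₁ (p∈ n)) (proj₂ (p∈ n)) 0<δ₂))
      where
      open +-*-Solver
      bound : ∀ e₁ e₂ → ℚ.∣ e₁ - e₂ ∣ ≤ ½ * ε → ℚ.∣ e₂ - L ∣ ≤ ½ * ε → ℚ.∣ e₁ - L ∣ ≤ ε
      bound e₁ e₂ h h′ = subst₂ _≤_
        (cong ℚ.∣_∣ (solve 3 (λ a b c → (a :- b) :+ (b :- c) := a :- c) refl e₁ e₂ L))
        (half+half ε) (∣+∣≤ (e₁ - e₂) (e₂ - L) h h′)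

  *recip-cancel : ∀ {a b ε} → b ≢ 0ℚ → ℚ.∣ a * recip b ∣ ≤ ε → ℚ.∣ a ∣ ≤ ε * ℚ.∣ b ∣
  *recip-cancel {a} {b} {ε} b≢0 h = begin
    ℚ.∣ a ∣                      ≡⟨ cong ℚ.∣_∣ (trans (sym (ℚₚ.*-identityʳ a)) (cong (a *_) (sym (recip-inverse b b≢0)))) ⟩
    ℚ.∣ a * (b * recip b) ∣      ≡⟨ cong ℚ.∣_∣ (solve 3 (λ a b r → a :* (b :* r) := (a :* r) :* b) refl a b (recip b)) ⟩
    ℚ.∣ a * recip b * b ∣        ≡⟨ ℚₚ.∣p*q∣≡∣p∣*∣q∣ (a * recip b) b ⟩
    ℚ.∣ a * recip b ∣ * ℚ.∣ b ∣  ≤⟨ *-monoʳ ℚ.∣ b ∣ (ℚₚ.0≤∣p∣ b) h ⟩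
    ε * ℚ.∣ b ∣                  ∎
    where
    open ℚₚ.≤-Reasoning
    open +-*-Solver

  -- Apartness keeps the approximations of `g` away from 0, where `recip` is a true inverse and not
  -- its default 0, so the quotient bound can be multiplied out.
  ≪⇒≤ : ∀ f g → f ≪ g → ∀ ε → 0ℚ < ε →
        Eventually λ n → Eventually λ j → ℚ.∣ seq (f n) j ∣ ≤ ε * ℚ.∣ seq (g n) j ∣
  ≪⇒≤ f g (M , g#0 , lim) ε 0<ε = M ℕ.+ proj₁ eventually , bound
    where
    0<εᴿ : 0ℝ Defs.< fromℚ ε
    0<εᴿ = ½ * ε , half 0<ε , 0 , λ _ _ →
      subst (0ℚ + ½ * ε <_) (half+half ε) (ℚₚ.+-monoˡ-< (½ * ε) (half 0<ε))
    eventually = lim (fromℚ ε) 0<εᴿ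
    bound : ∀ n → M ℕ.+ proj₁ eventually ℕ.≤ n → Eventually λ j → ℚ.∣ seq (f n) j ∣ ≤ ε * ℚ.∣ seq (g n) j ∣
    bound n n≥
      with o , refl ← ℕₚ.m≤n⇒∃[o]m+o≡n (ℕₚ.≤-trans (ℕₚ.m≤m+n M (proj₁ eventually)) n≥)
      with ε′ , 0<ε′ , J , small ← proj₂ eventually o (ℕₚ.+-cancelˡ-≤ M _ _ n≥)
      with δ , 0<δ , J₁ , away ← #0⇒away (g (M ℕ.+ o)) (g#0 o) =
      J ℕ.⊔ J₁ , λ j j≥ →
        *recip-cancel {seq (f (M ℕ.+ o)) j} {seq (g (M ℕ.+ o)) j}
          (δ<∣q∣⇒q≢0 0<δ (away j (ℕₚ.m⊔n≤o⇒n≤o J J₁ j≥)))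
          (drop-zero {seq (f (M ℕ.+ o)) j * recip (seq (g (M ℕ.+ o)) j)} 0<ε′ (small j (ℕₚ.m⊔n≤o⇒m≤o J J₁ j≥)))
      where
      drop-zero : ∀ {t ε′} → 0ℚ < ε′ → ℚ.∣ t - 0ℚ ∣ + ε′ < ε → ℚ.∣ t ∣ ≤ ε
      drop-zero {t} {ε′} 0<ε′ h = ℚₚ.≤-trans
        (≤-by ε′ (ℚₚ.<⇒≤ 0<ε′) (cong (λ u → ℚ.∣ u ∣ + ε′) (sym (ℚₚ.+-identityʳ t)))) (ℚₚ.<⇒≤ h)

  p*-scaled : ∀ b m j → let q = seq (p* (2 ℕ.+ b) (suc m)) j in
              0ℚ ≤ q × ι (suc m) * q ≡ ι (suc b) * lnSum m j
  p*-scaled b m j =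
    *-nonNeg (*-nonNeg (subst (0ℚ ≤_) (ι-def (suc b)) (0≤ι (suc b))) (0≤lnSum m)) (ℚₚ.<⇒≤ (0<1/suc m)) , (begin
    ι (suc m) * ((ℤ.+ suc b ℚ./ 1) * lnSum m j * 1/suc m)
      ≡⟨ cong (λ t → ι (suc m) * (t * lnSum m j * 1/suc m)) (sym (ι-def (suc b))) ⟩
    ι (suc m) * (ι (suc b) * lnSum m j * 1/suc m)
      ≡⟨ solve 3 (λ n l u → n :* (l :* u) := (n :* u) :* l) refl (ι (suc m)) (ι (suc b) * lnSum m j) (1/suc m) ⟩
    ι (suc m) * 1/suc m * (ι (suc b) * lnSum m j)
      ≡⟨ cong (_* (ι (suc b) * lnSum m j)) (ι*1/suc m) ⟩
    1ℚ * (ι (suc b) * lnSum m j)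
      ≡⟨ ℚₚ.*-identityˡ (ι (suc b) * lnSum m j) ⟩
    ι (suc b) * lnSum m j ∎)
    where
    open ≡-Reasoning
    open +-*-Solver
    0≤lnSum : ∀ d → 0ℚ ≤ lnSum d j
    0≤lnSum d = lnSum-mono {0} {d} j z≤n

  scaled-≤ : ∀ C n {q a} → q ≤ 1/suc C * a → ι (suc C) * (ι n * q) ≤ ι n * a
  scaled-≤ C n {q} {a} q≤ = begin
    ι (suc C) * (ι n * q)               ≤⟨ *-monoˡ (ι (suc C)) (0≤ι (suc C)) (*-monoˡ (ι n) (0≤ι n) q≤) ⟩
    ι (suc C) * (ι n * (1/suc C * a))   ≡⟨ solve 4 (λ c n u a → c :* (n :* (u :* a)) := (c :* u) :* (n :* a)) refl (ι (suc C)) (ι n) (1/suc C) a ⟩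
    ι (suc C) * 1/suc C * (ι n * a)     ≡⟨ cong (_* (ι n * a)) (ι*1/suc C) ⟩
    1ℚ * (ι n * a)                      ≡⟨ ℚₚ.*-identityˡ (ι n * a) ⟩
    ι n * a                             ∎
    where
    open ℚₚ.≤-Reasoning
    open +-*-Solver

  -- The reason for the accuracy 1 / n: after scaling by n the clamping error is 1, which is
  -- absorbed by s.
  near-scaled : ∀ m {a b} → ℚ.∣ a - b ∣ ≤ 1/suc m → ι (suc m) * ℚ.∣ a ∣ ≤ ι (suc m) * ℚ.∣ b ∣ + 1ℚ
  near-scaled m {a} {b} h = begin
    ι (suc m) * ℚ.∣ a ∣                           ≤⟨ *-monoˡ (ι (suc m)) (0≤ι (suc m)) (ℚₚ.≤-trans (∣p∣≤∣p-q∣+∣q∣ a b) (ℚₚ.+-monoˡ-≤ ℚ.∣ b ∣ h)) ⟩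
    ι (suc m) * (1/suc m + ℚ.∣ b ∣)               ≡⟨ ℚₚ.*-distribˡ-+ (ι (suc m)) (1/suc m) ℚ.∣ b ∣ ⟩
    ι (suc m) * 1/suc m + ι (suc m) * ℚ.∣ b ∣     ≡⟨ cong (_+ ι (suc m) * ℚ.∣ b ∣) (ι*1/suc m) ⟩
    1ℚ + ι (suc m) * ℚ.∣ b ∣                      ≡⟨ ℚₚ.+-comm 1ℚ (ι (suc m) * ℚ.∣ b ∣) ⟩
    ι (suc m) * ℚ.∣ b ∣ + 1ℚ                      ∎
    where open ℚₚ.≤-Reasoning

  2^8s : ∀ s → (2 ℕ.^ s) ℕ.^ 8 ≡ 2 ℕ.^ (8 ℕ.* s)
  2^8s s = trans (ℕₚ.^-*-assoc 2 s 8) (cong (2 ℕ.^_) (ℕₚ.*-comm s 8))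

  shuffle : ∀ b m r → suc (b ℕ.+ m) ℕ.+ r ≡ b ℕ.+ (m ℕ.+ suc r)
  shuffle b m r = trans (sym (ℕₚ.+-suc (b ℕ.+ m) r)) (ℕₚ.+-assoc b m (suc r))
  -- The construction needs b base vertices, m = 4ˢ candidates and one vertex that always has the
  -- common colour.
  room : ∀ b n s → suc b ℕ.≤ s → 2 ℕ.^ (8 ℕ.* s) ℕ.≤ n → suc (b ℕ.+ 2 ℕ.^ s ℕ.* 2 ℕ.^ s) ℕ.≤ n
  room b n s b<s lo = begin
    suc b ℕ.+ a ℕ.* a      ≤⟨ ℕₚ.+-monoˡ-≤ (a ℕ.* a) (ℕₚ.≤-trans b<s (ℕₚ.<⇒≤ (n<2^n s))) ⟩
    a ℕ.+ a ℕ.* a          ≤⟨ ℕₚ.+-monoˡ-≤ (a ℕ.* a) (ℕₚ.m≤m*n a a) ⟩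
    a ℕ.* a ℕ.+ a ℕ.* a    ≡⟨ solve 1 (λ a → a :* a :+ a :* a := (con 2 :* (a :* a))) refl a ⟩
    2 ℕ.* (a ℕ.* a)        ≤⟨ ℕₚ.*-monoˡ-≤ (a ℕ.* a) (ℕₚ.≤-trans (s≤s (ℕₚ.≤-trans (s≤s z≤n) b<s)) (n<2^n s)) ⟩
    a ℕ.* (a ℕ.* a)        ≡⟨ solve 1 (λ a → a :* (a :* a) := a :* (a :* (a :* con 1))) refl a ⟩
    a ℕ.^ 3                ≤⟨ ℕₚ.^-monoʳ-≤ a {3} {8} (s≤s (s≤s (s≤s z≤n))) ⟩
    a ℕ.^ 8                ≡⟨ 2^8s s ⟩
    2 ℕ.^ (8 ℕ.* s)        ≤⟨ lo ⟩
    n                      ∎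
    where
    open ℕₚ.≤-Reasoning
    open ℕ-Solver
    a = 2 ℕ.^ s
    instance _ = ℕ.>-nonZero (ℕₚ.m^n>0 2 s)

  subcritical-≥ : ∀ {x} → Unit x → ∀ b n s → suc b ℕ.≤ s → 2 ℕ.^ (8 ℕ.* s) ℕ.≤ n → ι (4 ℕ.* n) * x ≤ ι s →
    1ℚ - (½ ^ s + ½ ^ s) ≤ E-colourable x (2 ℕ.+ b) n
  subcritical-≥ {x} u b n s b<s lo h
    with r , eq ← ℕₚ.m≤n⇒∃[o]m+o≡n (room b n s b<s lo)
    with refl ← trans (sym (shuffle b (2 ℕ.^ s ℕ.* 2 ℕ.^ s) r)) eq =
    ℚₚ.≤-trans (private-estimate u _ s (ℕₚ.≤-trans (s≤s z≤n) b<s) (ℕₚ.≤-trans (ℕₚ.≤-reflexive (2^8s s)) lo) h)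
      (E-colourable-≥ b (2 ℕ.^ s ℕ.* 2 ℕ.^ s) r u)

  supercritical-≤ : ∀ {x} → Unit x → ∀ b n s → let k = 2 ℕ.+ b in 1 ℕ.≤ s → 17 ℕ.* (k ℕ.* k) ℕ.≤ s →
    2 ℕ.^ (8 ℕ.* s) ℕ.≤ n → n ℕ.< 2 ℕ.^ (8 ℕ.* suc s) → ι (34 ℕ.* (k ℕ.* k) ℕ.* s) ≤ ι n * x → ι k * ½ ^ s ≤ ½ →
    E-colourable x k n ≤ ι (2 ℕ.* (k ℕ.* k)) * ½ ^ s
  supercritical-≤ {x} u b n s 1≤s 17k²≤s lo hi h θ≤½ =
    let l , k²l≤n , small = first-moment-small u k n s (s≤s z≤n) 1≤s d≤n n≤ h θ≤½ in
    ℚₚ.≤-trans (E-colourable-first-moment u b n l k²l≤n) small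
    where
    k = 2 ℕ.+ b
    n≤ : n ℕ.≤ 2 ℕ.^ (16 ℕ.* s)
    n≤ = ℕₚ.≤-trans (ℕₚ.<⇒≤ hi) (ℕₚ.^-monoʳ-≤ 2 (begin
      8 ℕ.* suc s          ≡⟨ ℕₚ.*-suc 8 s ⟩
      8 ℕ.+ 8 ℕ.* s        ≤⟨ ℕₚ.+-monoˡ-≤ (8 ℕ.* s) (ℕₚ.*-monoʳ-≤ 8 1≤s) ⟩
      8 ℕ.* s ℕ.+ 8 ℕ.* s  ≡⟨ ℕₚ.*-distribʳ-+ s 8 8 ⟨
      16 ℕ.* s             ∎))
      where open ℕₚ.≤-Reasoning
    d≤n : 17 ℕ.* s ℕ.* (k ℕ.* k) ℕ.≤ n
    d≤n = begin
      17 ℕ.* s ℕ.* (k ℕ.* k)       ≡⟨ solve 2 (λ s k → con 17 :* s :* (k :* k) := con 17 :* (k :* k) :* s) refl s k ⟩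
      17 ℕ.* (k ℕ.* k) ℕ.* s       ≤⟨ ℕₚ.*-mono-≤ (ℕₚ.≤-trans 17k²≤s (ℕₚ.<⇒≤ (n<2^n s))) (ℕₚ.<⇒≤ (n<2^n s)) ⟩
      2 ℕ.^ s ℕ.* 2 ℕ.^ s          ≡⟨ ℕₚ.^-distribˡ-+-* 2 s s ⟨
      2 ℕ.^ (s ℕ.+ s)              ≤⟨ ℕₚ.^-monoʳ-≤ 2 (ℕₚ.+-monoʳ-≤ s (ℕₚ.m≤m+n s (6 ℕ.* s))) ⟩
      2 ℕ.^ (8 ℕ.* s)              ≤⟨ lo ⟩
      n                            ∎
      where
      open ℕₚ.≤-Reasoning
      open ℕ-Solver

  module _ (b m s j : ℕ) (lo : 2 ℕ.^ (8 ℕ.* s) ℕ.≤ suc m) (hi : suc m ℕ.< 2 ℕ.^ (8 ℕ.* suc s))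
           {a x : ℚ} (0≤x : 0ℚ ≤ x) (near : ℚ.∣ a - x ∣ ≤ 1/suc m) where

    open ℚₚ.≤-Reasoning
    open +-*-Solver
    open ℕ-Solver using () renaming (solve to ℕ-solve; _:*_ to _⊗_; _:=_ to _⊜_; con to ℕ-con)

    private
      n = suc m
      q = seq (p* (2 ℕ.+ b) n) j

    -- From n p* = (k - 1) ln n ≤ 8 (k - 1)(s + 1), the factor 64 (k - 1) leaves 8 n |a| ≤ s + 1.
    -- Clamping adds 8, and s + 9 ≤ 2 s.
    4nx≤s : ∀ C → suc C ≡ 64 ℕ.* suc b → 9 ℕ.≤ s → ℚ.∣ a ∣ ≤ 1/suc C * ℚ.∣ q ∣ → ι (4 ℕ.* n) * x ≤ ι s
    4nx≤s C 1+C≡ 9≤s small = *-cancelˡ (ι 2) (0<ι {2} (s≤s z≤n)) (begin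
      ι 2 * (ι (4 ℕ.* n) * x)             ≡⟨ cong (λ t → ι 2 * (t * x)) (ι-* 4 n) ⟩
      ι 2 * (ι 4 * ι n * x)               ≡⟨ solve 4 (λ a c n x → a :* (c :* n :* x) := (a :* c) :* (n :* x)) refl (ι 2) (ι 4) (ι n) x ⟩
      ι 2 * ι 4 * (ι n * x)               ≡⟨ cong (_* (ι n * x)) (ι-* 2 4) ⟨
      ι 8 * (ι n * x)                     ≤⟨ *-monoˡ (ι 8) (0≤ι 8) nx≤X+1 ⟩
      ι 8 * (X + 1ℚ)                      ≡⟨ trans (ℚₚ.*-distribˡ-+ (ι 8) X 1ℚ) (cong (ι 8 * X +_) (ℚₚ.*-identityʳ (ι 8))) ⟩
      ι 8 * X + ι 8                       ≤⟨ ℚₚ.+-monoˡ-≤ (ι 8) 8X≤ ⟩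
      ι (suc s) + ι 8                     ≡⟨ ι-+ (suc s) 8 ⟨
      ι (suc s ℕ.+ 8)                     ≤⟨ ι-mono s+9≤2s ⟩
      ι (2 ℕ.* s)                         ≡⟨ ι-* 2 s ⟩
      ι 2 * ι s                           ∎)
      where
      X = ι n * ℚ.∣ a ∣
      d = 8 ℕ.* suc b
      s+9≤2s : suc s ℕ.+ 8 ℕ.≤ 2 ℕ.* s
      s+9≤2s = ℕₚ.≤-trans (ℕₚ.≤-reflexive (sym (ℕₚ.+-suc s 8)))
        (ℕₚ.+-monoʳ-≤ s (ℕₚ.≤-trans 9≤s (ℕₚ.m≤m+n s 0)))
      nx≤X+1 : ι n * x ≤ X + 1ℚ
      nx≤X+1 = subst (λ t → ι n * t ≤ X + 1ℚ) (ℚₚ.0≤p⇒∣p∣≡p 0≤x)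
        (near-scaled m {x} {a} (subst (_≤ 1/suc m) (∣p-q∣-sym a x) near))
      8X≤ : ι 8 * X ≤ ι (suc s)
      8X≤ = *-cancelˡ (ι d) (0<ι {d} (s≤s z≤n)) (begin
        ι d * (ι 8 * X)                   ≡⟨ ℚₚ.*-assoc (ι d) (ι 8) X ⟨
        ι d * ι 8 * X                     ≡⟨ cong (_* X) (ι-* d 8) ⟨
        ι (d ℕ.* 8) * X                   ≡⟨ cong (λ t → ι t * X) (ℕ-solve 1 (λ b → (ℕ-con 8 ⊗ b) ⊗ ℕ-con 8 ⊜ ℕ-con 64 ⊗ b) refl (suc b)) ⟩
        ι (64 ℕ.* suc b) * X              ≡⟨ cong (λ t → ι t * X) 1+C≡ ⟨
        ι (suc C) * X                     ≤⟨ scaled-≤ C n small ⟩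
        ι n * ℚ.∣ q ∣                     ≡⟨ cong (ι n *_) (ℚₚ.0≤p⇒∣p∣≡p (proj₁ (p*-scaled b m j))) ⟩
        ι n * q                           ≡⟨ proj₂ (p*-scaled b m j) ⟩
        ι (suc b) * lnSum m j             ≤⟨ *-monoˡ (ι (suc b)) (0≤ι (suc b)) (proj₂ (lnSum-bounds n s j lo hi)) ⟩
        ι (suc b) * ι (8 ℕ.* suc s)       ≡⟨ ι-* (suc b) (8 ℕ.* suc s) ⟨
        ι (suc b ℕ.* (8 ℕ.* suc s))       ≡⟨ cong ι (ℕ-solve 2 (λ b s → b ⊗ (ℕ-con 8 ⊗ s) ⊜ ℕ-con 8 ⊗ b ⊗ s) refl (suc b) (suc s)) ⟩
        ι (d ℕ.* suc s)                   ≡⟨ ι-* d (suc s) ⟩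
        ι d * ι (suc s)                   ∎)

    -- One multiple of s out of C + 1 pays for the clamping error 1, since s ≥ 1.
    Cs≤nx : ∀ C → 1 ℕ.≤ s → ℚ.∣ q ∣ ≤ 1/suc C * ℚ.∣ a ∣ → ι (C ℕ.* s) ≤ ι n * x
    Cs≤nx C 1≤s small = begin
      ι (C ℕ.* s)                          ≡⟨ cancel-sum 1ℚ (ι (C ℕ.* s)) ⟩
      1ℚ + ι (C ℕ.* s) - 1ℚ                ≤⟨ p-q≤r (begin
        1ℚ + ι (C ℕ.* s)                     ≤⟨ ℚₚ.+-monoˡ-≤ (ι (C ℕ.* s)) 1≤ιs ⟩
        ι s + ι (C ℕ.* s)                    ≡⟨ ι-+ s (C ℕ.* s) ⟨
        ι (suc C ℕ.* s)                      ≡⟨ ι-* (suc C) s ⟩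
        ι (suc C) * ι s                      ≤⟨ *-monoˡ (ι (suc C)) (0≤ι (suc C)) ιs≤nq ⟩
        ι (suc C) * (ι n * ℚ.∣ q ∣)          ≤⟨ scaled-≤ C n small ⟩
        ι n * ℚ.∣ a ∣                        ≤⟨ near-scaled m {a} {x} near ⟩
        ι n * ℚ.∣ x ∣ + 1ℚ                   ≡⟨ cong (λ t → ι n * t + 1ℚ) (ℚₚ.0≤p⇒∣p∣≡p 0≤x) ⟩
        ι n * x + 1ℚ                         ∎) ⟩
      ι n * x                              ∎
      where
      1≤ιs : 1ℚ ≤ ι s
      1≤ιs = subst (_≤ ι s) ι-1 (ι-mono 1≤s)
      ιs≤nq : ι s ≤ ι n * ℚ.∣ q ∣
      ιs≤nq = begin
        ι s                                  ≡⟨ ℚₚ.*-identityˡ (ι s) ⟨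
        1ℚ * ι s                             ≤⟨ *-mono (0≤ι (suc b)) (0≤ι s) (subst (_≤ ι (suc b)) ι-1 (ι-mono (s≤s z≤n)))
                                                  (proj₁ (lnSum-bounds n s j lo hi)) ⟩
        ι (suc b) * lnSum m j                ≡⟨ proj₂ (p*-scaled b m j) ⟨
        ι n * q                              ≡⟨ cong (ι n *_) (ℚₚ.0≤p⇒∣p∣≡p (proj₁ (p*-scaled b m j))) ⟨
        ι n * ℚ.∣ q ∣                        ∎

  module _ (b : ℕ) (p : ℕ → ℝ) (p∈ : ∀ n → 0ℝ Defs.≤ p n × p n Defs.≤ 1ℝ) where

    private
      k : ℕ
      k = 2 ℕ.+ b

    Close : ℚ → ℚ → ℕ → Set
    Close L ε n = ∃ λ δ → 0ℚ < δ × Eventually λ j →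
      ∀ x → Unit x → ℚ.∣ seq (p n) j - x ∣ ≤ δ → ℚ.∣ E-colourable x k n - L ∣ ≤ ε

    -- Trades "n large" for "s large", so that estimates may use powers of 2ˢ, and disposes of n =
    -- 0, where `p*` is a junk value.
    Close-eventually : ∀ L ε {P : ℕ → Set} s₀ → Eventually P →
      (∀ m s → P (suc m) → s₀ ℕ.≤ s → 2 ℕ.^ (8 ℕ.* s) ℕ.≤ suc m → suc m ℕ.< 2 ℕ.^ (8 ℕ.* suc s) → Close L ε (suc m)) →
      Eventually (Close L ε)
    Close-eventually L ε {P} s₀ (N , holds) close = N ℕ.⊔ 2 ℕ.^ (8 ℕ.* s₀) , λ n n≥ →
      at n (holds n (ℕₚ.m⊔n≤o⇒m≤o N _ n≥)) (ℕₚ.m⊔n≤o⇒n≤o N _ n≥)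
      where
      at : ∀ n → P n → 2 ℕ.^ (8 ℕ.* s₀) ℕ.≤ n → Close L ε n
      at zero    _ 2^≤0 = contradiction 2^≤0 (ℕₚ.<⇒≱ (ℕₚ.m^n>0 2 (8 ℕ.* s₀)))
      at (suc m) h 2^≤n = let s , lo , hi = scale-of (suc m) (s≤s z≤n) in
        close m s h (scale-≥ s₀ 2^≤n hi) lo hi

    -- The constant of comparison is 1 / (64 (k - 1)); the equation for `suc C` avoids writing out a
    -- predecessor.
    subcritical : ∀ C → suc C ≡ 64 ℕ.* suc b → p ≪ p* k → (λ n → Pr k n (p n) rainbowFreeColourable?) ⟶ 1ℝ
    subcritical C 1+C≡ p≪p* = Pr⟶ k p p∈ 1ℚ λ ε 0<ε →
      let s₁ , tiny = ½^-small 2 ε 0<ε in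
      -- `s₁` makes 2 · 2⁻ˢ at most ε, 9 absorbs the clamping error, and `suc b` makes room for the
      -- base vertices.
      Close-eventually 1ℚ ε (s₁ ℕ.⊔ (9 ℕ.⊔ suc b)) (≪⇒≤ p (p* k) p≪p* (1/suc C) (0<1/suc C)) (close ε 0<ε s₁ tiny)
      where
      close : ∀ ε → 0ℚ < ε → ∀ s₁ → (∀ s → s₁ ℕ.≤ s → ι 2 * ½ ^ s ≤ ε) → ∀ m s →
        Eventually (λ j → ℚ.∣ seq (p (suc m)) j ∣ ≤ 1/suc C * ℚ.∣ seq (p* k (suc m)) j ∣) →
        s₁ ℕ.⊔ (9 ℕ.⊔ suc b) ℕ.≤ s → 2 ℕ.^ (8 ℕ.* s) ℕ.≤ suc m → suc m ℕ.< 2 ℕ.^ (8 ℕ.* suc s) → Close 1ℚ ε (suc m)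
      close ε 0<ε s₁ tiny m s (J , small) s₀≤s lo hi = 1/suc m , 0<1/suc m , J , λ j j≥ x x∈ near → ∣p-q∣-bound
        (ℚₚ.≤-trans (E-colourable≤1 x∈ k (suc m)) (≤-by ε (ℚₚ.<⇒≤ 0<ε) (ℚₚ.+-comm 1ℚ ε)))
        (begin
          1ℚ                                         ≡⟨ solve 1 (λ w → con 1ℚ := (w :+ w) :+ (con 1ℚ :- (w :+ w))) refl (½ ^ s) ⟩
          (½ ^ s + ½ ^ s) + (1ℚ - (½ ^ s + ½ ^ s))   ≤⟨ ℚₚ.+-mono-≤ 2w≤ε (subcritical-≥ x∈ b (suc m) s b<s lo
                                                          (4nx≤s b m s j lo hi (proj₁ x∈) near C 1+C≡ 9≤s (small j j≥))) ⟩
          ε + E-colourable x k (suc m)               ∎)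
        where
        open ℚₚ.≤-Reasoning
        open +-*-Solver
        9≤s : 9 ℕ.≤ s
        9≤s = ℕₚ.m⊔n≤o⇒m≤o 9 (suc b) (ℕₚ.m⊔n≤o⇒n≤o s₁ (9 ℕ.⊔ suc b) s₀≤s)
        b<s : suc b ℕ.≤ s
        b<s = ℕₚ.m⊔n≤o⇒n≤o 9 (suc b) (ℕₚ.m⊔n≤o⇒n≤o s₁ (9 ℕ.⊔ suc b) s₀≤s)
        2w≤ε : ½ ^ s + ½ ^ s ≤ ε
        2w≤ε = begin
          ½ ^ s + ½ ^ s         ≡⟨ solve 1 (λ w → w :+ w := (con 1ℚ :+ con 1ℚ) :* w) refl (½ ^ s) ⟩
          (1ℚ + 1ℚ) * ½ ^ s     ≡⟨ cong (_* ½ ^ s) ι-2 ⟨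
          ι 2 * ½ ^ s           ≤⟨ tiny s (ℕₚ.m⊔n≤o⇒m≤o s₁ (9 ℕ.⊔ suc b) s₀≤s) ⟩
          ε                     ∎

    supercritical : ∀ C → C ≡ 34 ℕ.* (k ℕ.* k) → p* k ≪ p → (λ n → Pr k n (p n) rainbowFreeColourable?) ⟶ 0ℝ
    supercritical C C≡ p*≪p = Pr⟶ k p p∈ 0ℚ λ ε 0<ε →
      let s₁ , tiny  = ½^-small (2 ℕ.* (k ℕ.* k)) ε 0<ε
          s₂ , tiny′ = ½^-small k ½ (ℚₚ.positive⁻¹ ½)
      -- `s₁` makes the final bound small, `s₂` gives θ ≤ ½, and s ≥ 17 k² makes the block divisor
      -- 17 s k² at most 4ˢ, hence at most n.
      in Close-eventually 0ℚ ε (s₁ ℕ.⊔ (s₂ ℕ.⊔ 17 ℕ.* (k ℕ.* k))) (≪⇒≤ (p* k) p p*≪p (1/suc C) (0<1/suc C)) (close ε 0<ε s₁ tiny s₂ tiny′)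
      where
      close : ∀ ε → 0ℚ < ε → ∀ s₁ → (∀ s → s₁ ℕ.≤ s → ι (2 ℕ.* (k ℕ.* k)) * ½ ^ s ≤ ε) →
        ∀ s₂ → (∀ s → s₂ ℕ.≤ s → ι k * ½ ^ s ≤ ½) → ∀ m s →
        Eventually (λ j → ℚ.∣ seq (p* k (suc m)) j ∣ ≤ 1/suc C * ℚ.∣ seq (p (suc m)) j ∣) →
        s₁ ℕ.⊔ (s₂ ℕ.⊔ 17 ℕ.* (k ℕ.* k)) ℕ.≤ s → 2 ℕ.^ (8 ℕ.* s) ℕ.≤ suc m → suc m ℕ.< 2 ℕ.^ (8 ℕ.* suc s) → Close 0ℚ ε (suc m)
      close ε 0<ε s₁ tiny s₂ tiny′ m s (J , small) s₀≤s lo hi = 1/suc m , 0<1/suc m , J , λ j j≥ x x∈ near → ∣p-q∣-bound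
        (ℚₚ.≤-trans
          (supercritical-≤ x∈ b (suc m) s 1≤s 17k²≤s lo hi
            (subst (λ c → ι (c ℕ.* s) ≤ ι (suc m) * x) C≡ (Cs≤nx b m s j lo hi (proj₁ x∈) near C 1≤s (small j j≥)))
            (tiny′ s (ℕₚ.m⊔n≤o⇒m≤o s₂ _ s₂⊔≤s)))
          (ℚₚ.≤-trans (tiny s (ℕₚ.m⊔n≤o⇒m≤o s₁ _ s₀≤s)) (ℚₚ.≤-reflexive (sym (ℚₚ.+-identityʳ ε)))))
        (+-nonNeg (ℚₚ.<⇒≤ 0<ε) (0≤E-colourable x∈ k (suc m)))
        where
        s₂⊔≤s : s₂ ℕ.⊔ 17 ℕ.* (k ℕ.* k) ℕ.≤ s
        s₂⊔≤s = ℕₚ.m⊔n≤o⇒n≤o s₁ _ s₀≤s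
        17k²≤s : 17 ℕ.* (k ℕ.* k) ℕ.≤ s
        17k²≤s = ℕₚ.m⊔n≤o⇒n≤o s₂ _ s₂⊔≤s
        1≤s : 1 ℕ.≤ s
        1≤s = ℕₚ.≤-trans (s≤s z≤n) 17k²≤s

open Threshold using (subcritical; supercritical)

open import Defs using (_≤_)

theorem7 : (k : ℕ) → 2 ℕ.≤ k →
    (p : ℕ → ℝ) → (∀ n → 0ℝ ≤ p n × p n ≤ 1ℝ) →
    (p ≪ p* k →
    (λ n → Pr k n (p n) rainbowFreeColourable?) ⟶ 1ℝ)
    ×
    (p* k ≪ p →
    (λ n → Pr k n (p n) rainbowFreeColourable?) ⟶ 0ℝ)
theorem7 (suc zero)    (s≤s ())
-- The proofs `refl` determine C: the predecessor of 64 (k - 1) on the sparse side, 34 k² on the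
-- dense side.
theorem7 (suc (suc b)) _ p p∈ = subcritical b p p∈ _ refl , supercritical b p p∈ _ refl
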